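{- The $\mathbb Q$-algebra ${\rm sQSym}$ of quasisymmetric functions in superspace, with the coproduct $\Delta$, is a commutative (in the signed sense, $fg=(-1)^{\deg(f)\deg(g)}gf$ for $f,g$ homogeneous in the fermionic degree $\deg$) graded connected Hopf algebra. Moreover, it contains the ring $\mathbf{\Lambda}$ of symmetric functions in superspace as a Hopf subalgebra.
   Context: Variables $x_1,x_2,\dots$ commute; $\theta_1,\theta_2,\dots$ anticommute ($\theta_i\theta_j=-\theta_j\theta_i$, $\theta_i^2=0$). The total degree is the degree in the $x$'s and the fermionic degree, denoted $\deg$, is the degree in the $\theta$'s. A dotted composition $\alpha=(\alpha_1,\dots,\alpha_l)$ is a finite (possibly empty) sequence whose entries belong to $\{1,2,3,\dots\}$ (non-dotted) or $\{\dot0,\dot1,\dot2,\dots\}$ (dotted). Put $\eta_i=1$ if $\alpha_i$ is dotted and $\eta_i=0$ otherwise. ${\rm sQSym}$ is the $\mathbb Q$-vector space of formal power series $f$ of bounded degree in these variables such that, for every dotted composition $\alpha$, all monomials $\theta_{i_1}^{\eta_1}\cdots\theta_{i_l}^{\eta_l}x_{i_1}^{\alpha_1}\cdots x_{i_l}^{\alpha_l}$ with $i_1<\cdots<i_l$ have the same coefficient in $f$ (dots ignored in exponents). It is closed under multiplication of power series. The grading is ${\rm sQSym}=\bigoplus_n{\rm sQSym}_n$, with ${\rm sQSym}_n$ the span of elements whose total degree plus fermionic degree is $n$; connected means ${\rm sQSym}_0$ is one-dimensional. ${\rm sQSym}\otimes{\rm sQSym}$ is identified with functions, quasisymmetric in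 each set, of two sets of variables $(x;\theta)$ and $(y;\phi)$, ordered by $x_1<x_2<\cdots<y_1<y_2<\cdots$ and $\theta_1<\theta_2<\cdots<\phi_1<\phi_2<\cdots$, with the $\theta$'s and $\phi$'s anticommuting with each other; $f\otimes g$ corresponds to $f(x;\theta)g(y;\phi)$, so $(f_1\otimes g_1)(f_2\otimes g_2)=(-1)^{\deg(g_1)\deg(f_2)}f_1f_2\otimes g_1g_2$. The coproduct is $(\Delta f)(x,y;\theta,\phi)=f(x,y;\theta,\phi)$, i.e. $f$ evaluated on the ordered union of the two sets. The counit $\epsilon$ is the identity on ${\rm sQSym}_0=\mathbb Q$ and zero on ${\rm sQSym}_n$, $n>0$. A graded Hopf algebra here means: an associative unital algebra that is a coassociative counital coalgebra, with $\Delta$ and $\epsilon$ algebra morphisms (the tensor square carrying the signed product above), with product and coproduct respecting the grading, possessing an antipode, i.e. a linear map $S$ with $\mathrm{mult}\circ(S\otimes1)\circ\Delta=u\circ\epsilon=\mathrm{mult}\circ(1\otimes S)\circ\Delta$ ($\mathrm{mult}$ the multiplication, $u$ the unit map). $\mathbf{\Lambda}$ is the ring of bounded-degree formal power series over $\mathbb Q$ in the same variables invariant under simultaneous permutation of the pairs $(x_i,\theta_i)$, with its own Hopf algebra structure: the coproduct is $(\Delta f)(x,y;\theta,\phi)=f(x,y;\theta,\phi)$, where $f\otimes g\in\mathbf{\Lambda}\otimes\mathbf{\Lambda}$ is identified with $f(x;\theta)g(y;\phi)$ ($\theta$'s and $\phi$'s anticommuting), and the counit is the projection on constants. -}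

module Defs where

open import Algebra.Module.Bundles using (LeftModule)
open import Algebra.Module.Morphism.Structures using (module LeftModuleMorphisms)
open import Algebra.Structures using (IsRing)
import Algebra.Module.Construct.TensorUnit as TensorUnit
import Algebra.Properties.CommutativeMonoid.Sum as CMSum
open import Data.Bool.Base using (Bool; true; false; if_then_else_; _∧_)
open import Data.Fin.Base using (Fin; toℕ)
open import Data.Fin.Permutation using (Permutation′; _⟨$⟩ʳ_; _⟨$⟩ˡ_)
open import Data.List.Base
  using (List; []; _∷_; [_]; _++_; _∷ʳ_; map; foldr; length; upTo; allFin
        ; mapMaybe; filterᵇ; cartesianProduct; cartesianProductWith)
open import Data.Maybe.Base using (Maybe; just; nothing)
open import Data.Nat.Base as ℕ using (ℕ; zero; suc; _<_; _<ᵇ_; _≡ᵇ_; NonZero)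
open import Data.Product.Base using (Σ-syntax; ∃-syntax; _×_; _,_; proj₂)
open import Data.Rational.Base as ℚ using (ℚ; 0ℚ; 1ℚ)
import Data.Nat.Properties as ℕₚ
import Data.Rational.Properties as ℚₚ
open import Data.Vec.Base as Vec using (Vec; toList; tabulate)
open import Function.Base using (id)
open import Level using (0ℓ)
open import Relation.Binary.PropositionalEquality
  using (_≡_; _≢_; refl; sym; trans; cong; cong₂)
open import Relation.Nullary.Negation using (¬_)
open import Relation.Unary using (Pred)

VectorSpace : Set₁
VectorSpace = LeftModule ℚₚ.+-*-ring 0ℓ 0ℓ

∣_∣ : VectorSpace → Set
∣ V ∣ = LeftModule.Carrierᴹ V

ℚ¹ : VectorSpace
ℚ¹ = TensorUnit.leftModule {R = ℚₚ.+-*-ring}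

IsLinear : (U V : VectorSpace) → (∣ U ∣ → ∣ V ∣) → Set
IsLinear U V = IsLeftModuleHomomorphism
  where open LeftModuleMorphisms (LeftModule.rawLeftModule U) (LeftModule.rawLeftModule V)

sign : ℕ → ℚ
sign zero    = 1ℚ
sign (suc n) = ℚ.- sign n

-- The tensor product over ℚ: formal linear combinations of pure tensors
-- modulo the vector space axioms and bilinearity of _⊗_.

module Tensor (U V : VectorSpace) where

  private
    module U = LeftModule U
    module V = LeftModule V

  infixr 8 _⊗_
  infixr 7 _·_
  infixl 6 _+_
  infix  4 _≈_

  data Term : Set where
    _⊗_ : ∣ U ∣ → ∣ V ∣ → Term
    0#  : Term
    _+_ : Term → Term → Term
    _·_ : ℚ → Term → Term

  data _≈_ : Term → Term → Set where
    ≈-refl  : ∀ {t} → t ≈ t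
    ≈-sym   : ∀ {s t} → s ≈ t → t ≈ s
    ≈-trans : ∀ {r s t} → r ≈ s → s ≈ t → r ≈ t

    +-cong      : ∀ {s s′ t t′} → s ≈ s′ → t ≈ t′ → s + t ≈ s′ + t′
    +-assoc     : ∀ r s t → (r + s) + t ≈ r + (s + t)
    +-comm      : ∀ s t → s + t ≈ t + s
    +-identityˡ : ∀ t → 0# + t ≈ t

    ·-cong     : ∀ {c s t} → s ≈ t → c · s ≈ c · t
    ·-assoc    : ∀ c d t → (c ℚ.* d) · t ≈ c · d · t
    ·-identity : ∀ t → 1ℚ · t ≈ t
    ·-zeroˡ    : ∀ t → 0ℚ · t ≈ 0#
    ·-zeroʳ    : ∀ c → c · 0# ≈ 0#
    ·-distribˡ : ∀ c s t → c · (s + t) ≈ c · s + c · t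
    ·-distribʳ : ∀ t c d → (c ℚ.+ d) · t ≈ c · t + d · t

    ⊗-cong     : ∀ {u u′ v v′} → u U.≈ᴹ u′ → v V.≈ᴹ v′ → u ⊗ v ≈ u′ ⊗ v′
    ⊗-distribˡ : ∀ u v v′ → u ⊗ (v V.+ᴹ v′) ≈ u ⊗ v + u ⊗ v′
    ⊗-distribʳ : ∀ v u u′ → (u U.+ᴹ u′) ⊗ v ≈ u ⊗ v + u′ ⊗ v
    ⊗-scaleˡ   : ∀ c u v → (c U.*ₗ u) ⊗ v ≈ c · (u ⊗ v)
    ⊗-scaleʳ   : ∀ c u v → u ⊗ (c V.*ₗ v) ≈ c · (u ⊗ v)

  private
    +-identityʳ : ∀ t → t + 0# ≈ t
    +-identityʳ t = ≈-trans (+-comm t 0#) (+-identityˡ t)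

    -1ℚ : ℚ
    -1ℚ = ℚ.- 1ℚ

    inverseˡ : ∀ t → -1ℚ · t + t ≈ 0#
    inverseˡ t =
      ≈-trans (+-cong ≈-refl (≈-sym (·-identity t)))
        (≈-trans (≈-sym (·-distribʳ t -1ℚ 1ℚ)) (·-zeroˡ t))

  space : VectorSpace
  space = record
    { Carrierᴹ = Term
    ; _≈ᴹ_     = _≈_
    ; _+ᴹ_     = _+_
    ; _*ₗ_     = _·_
    ; 0ᴹ       = 0#
    ; -ᴹ_      = λ t → -1ℚ · t
    ; isLeftModule = record
      { isLeftSemimodule = record
        { +ᴹ-isCommutativeMonoid = record
          { isMonoid = record
            { isSemigroup = record
              { isMagma = record
                { isEquivalence = record { refl = ≈-refl ; sym = ≈-sym ; trans = ≈-trans }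
                ; ∙-cong = +-cong
                }
              ; assoc = +-assoc
              }
            ; identity = +-identityˡ , +-identityʳ
            }
          ; comm = +-comm
          }
        ; isPreleftSemimodule = record
          { *ₗ-cong      = λ { refl s≈t → ·-cong s≈t }
          ; *ₗ-zeroˡ     = ·-zeroˡ
          ; *ₗ-distribʳ  = ·-distribʳ
          ; *ₗ-identityˡ = ·-identity
          ; *ₗ-assoc     = ·-assoc
          ; *ₗ-zeroʳ     = ·-zeroʳ
          ; *ₗ-distribˡ  = ·-distribˡ
          }
        }
      ; -ᴹ‿cong    = ·-cong
      ; -ᴹ‿inverse = inverseˡ , λ t → ≈-trans (+-comm t _) (inverseˡ t)
      }
    }

open Tensor using (_⊗_; 0#; _+_; _·_)

infixr 8 _⊠_

_⊠_ : VectorSpace → VectorSpace → VectorSpace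
U ⊠ V = Tensor.space U V

-- The linear map U ⊠ V → W induced by a map of two arguments; it respects
-- the equality of U ⊠ V as soon as that map is bilinear.

extend : (U V W : VectorSpace) → (∣ U ∣ → ∣ V ∣ → ∣ W ∣) → ∣ U ⊠ V ∣ → ∣ W ∣
extend U V W b = go
  where
  open LeftModule W
  go : ∣ U ⊠ V ∣ → ∣ W ∣
  go (u ⊗ v) = b u v
  go 0#      = 0ᴹ
  go (s + t) = go s +ᴹ go t
  go (c · t) = c *ₗ go t

tensorMap : (U V U′ V′ : VectorSpace) → (∣ U ∣ → ∣ U′ ∣) → (∣ V ∣ → ∣ V′ ∣) →
            ∣ U ⊠ V ∣ → ∣ U′ ⊠ V′ ∣
tensorMap U V U′ V′ φ ψ = extend U V (U′ ⊠ V′) (λ u v → φ u ⊗ ψ v)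

associate : (U V W : VectorSpace) → ∣ (U ⊠ V) ⊠ W ∣ → ∣ U ⊠ (V ⊠ W) ∣
associate U V W = extend (U ⊠ V) W (U ⊠ (V ⊠ W)) λ t w →
  extend U V (U ⊠ (V ⊠ W)) (λ u v → u ⊗ (v ⊗ w)) t

-- V is the internal direct sum of the subspaces Hom n.

record IsGrading (V : VectorSpace) (Hom : ℕ → Pred ∣ V ∣ 0ℓ) : Set where
  open LeftModule V
  open CMSum +ᴹ-commutativeMonoid using (sum)
  field
    resp      : ∀ {n f g} → f ≈ᴹ g → Hom n f → Hom n g
    0-closed  : ∀ {n} → Hom n 0ᴹ
    +-closed  : ∀ {n f g} → Hom n f → Hom n g → Hom n (f +ᴹ g)
    *ₗ-closed : ∀ {n} c {f} → Hom n f → Hom n (c *ₗ f)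
    spanning  : ∀ f → Σ[ N ∈ ℕ ] Σ[ h ∈ (ℕ → ∣ V ∣) ]
                  (∀ n → Hom n (h n)) × f ≈ᴹ sum {N} (λ i → h (toℕ i))
    independent : ∀ N (h : ℕ → ∣ V ∣) → (∀ n → Hom n (h n)) →
                  sum {N} (λ i → h (toℕ i)) ≈ᴹ 0ᴹ → ∀ n → n < N → h n ≈ᴹ 0ᴹ

-- TensorDegree V Hom n is the subspace Σ_{i+j=n} Hom i ⊗ Hom j of V ⊠ V.

data TensorDegree (V : VectorSpace) (Hom : ℕ → Pred ∣ V ∣ 0ℓ) (n : ℕ) :
                  ∣ V ⊠ V ∣ → Set where
  pure  : ∀ {i j f g} → Hom i f → Hom j g → i ℕ.+ j ≡ n → TensorDegree V Hom n (f ⊗ g)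
  zero  : TensorDegree V Hom n 0#
  plus  : ∀ {s t} → TensorDegree V Hom n s → TensorDegree V Hom n t →
          TensorDegree V Hom n (s + t)
  scale : ∀ c {t} → TensorDegree V Hom n t → TensorDegree V Hom n (c · t)
  resp  : ∀ {s t} → LeftModule._≈ᴹ_ (V ⊠ V) s t →
          TensorDegree V Hom n s → TensorDegree V Hom n t

-- Deg k is the subspace of elements of fermionic degree k.

record HopfAlgebra (V : VectorSpace) (Deg : ℕ → Pred ∣ V ∣ 0ℓ) : Set where
  open LeftModule V
  open LeftModule (V ⊠ V) using () renaming (_≈ᴹ_ to _≈²_; _*ₗ_ to _*²_)
  open LeftModule (V ⊠ (V ⊠ V)) using () renaming (_≈ᴹ_ to _≈³_)
  infixl 7 _∙_ _⊛_
  field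
    _∙_ : ∣ V ∣ → ∣ V ∣ → ∣ V ∣
    1#  : ∣ V ∣
    Δ   : ∣ V ∣ → ∣ V ⊠ V ∣
    ε   : ∣ V ∣ → ℚ
    S   : ∣ V ∣ → ∣ V ∣

    isGrading : IsGrading V Deg

    isRing : IsRing _≈ᴹ_ _+ᴹ_ _∙_ -ᴹ_ 0ᴹ 1#
    scaleˡ : ∀ c f g → (c *ₗ f) ∙ g ≈ᴹ c *ₗ (f ∙ g)
    scaleʳ : ∀ c f g → f ∙ (c *ₗ g) ≈ᴹ c *ₗ (f ∙ g)

    Δ-linear : IsLinear V (V ⊠ V) Δ
    ε-linear : IsLinear V ℚ¹ ε
    coassociative : ∀ f →
      associate V V V (tensorMap V V (V ⊠ V) V Δ id (Δ f))
        ≈³ tensorMap V V V (V ⊠ V) id Δ (Δ f)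
    counitˡ : ∀ f → extend V V V (λ g h → ε g *ₗ h) (Δ f) ≈ᴹ f
    counitʳ : ∀ f → extend V V V (λ g h → ε h *ₗ g) (Δ f) ≈ᴹ f

    -- The signed product of V ⊠ V.  Bilinearity and the sign rule determine
    -- it, since the homogeneous elements span V.
    _⊛_      : ∣ V ⊠ V ∣ → ∣ V ⊠ V ∣ → ∣ V ⊠ V ∣
    ⊛-linearˡ : ∀ t → IsLinear (V ⊠ V) (V ⊠ V) (λ s → s ⊛ t)
    ⊛-linearʳ : ∀ s → IsLinear (V ⊠ V) (V ⊠ V) (λ t → s ⊛ t)
    ⊛-sign   : ∀ {j k} f₁ {g₁ f₂} g₂ → Deg j g₁ → Deg k f₂ →
               (f₁ ⊗ g₁) ⊛ (f₂ ⊗ g₂) ≈² sign (j ℕ.* k) *² ((f₁ ∙ f₂) ⊗ (g₁ ∙ g₂))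

    Δ-∙ : ∀ f g → Δ (f ∙ g) ≈² Δ f ⊛ Δ g
    Δ-1 : Δ 1# ≈² 1# ⊗ 1#
    ε-∙ : ∀ f g → ε (f ∙ g) ≡ ε f ℚ.* ε g
    ε-1 : ε 1# ≡ 1ℚ

    S-linear  : IsLinear V V S
    antipodeˡ : ∀ f → extend V V V _∙_ (tensorMap V V V V S id (Δ f)) ≈ᴹ ε f *ₗ 1#
    antipodeʳ : ∀ f → extend V V V _∙_ (tensorMap V V V V id S (Δ f)) ≈ᴹ ε f *ₗ 1#

module _ {V : VectorSpace} {Deg : ℕ → Pred ∣ V ∣ 0ℓ} (H : HopfAlgebra V Deg) where
  open LeftModule V
  open HopfAlgebra H

  SignedCommutative : Set
  SignedCommutative = ∀ {j k f g} → Deg j f → Deg k g → f ∙ g ≈ᴹ sign (j ℕ.* k) *ₗ (g ∙ f)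

  record IsGradedBy (Hom : ℕ → Pred ∣ V ∣ 0ℓ) : Set where
    field
      direct-sum : IsGrading V Hom
      ∙-graded   : ∀ {i j f g} → Hom i f → Hom j g → Hom (i ℕ.+ j) (f ∙ g)
      1-graded   : Hom 0 1#
      Δ-graded   : ∀ {n f} → Hom n f → TensorDegree V Hom n (Δ f)
      ε-graded   : ∀ {n f} → 0 < n → Hom n f → ε f ≡ 0ℚ

Connected : (V : VectorSpace) → (ℕ → Pred ∣ V ∣ 0ℓ) → Set
Connected V Hom =
  Σ[ b ∈ ∣ V ∣ ] Hom 0 b × ¬ (b ≈ᴹ 0ᴹ) × (∀ f → Hom 0 f → ∃[ c ] f ≈ᴹ c *ₗ b)
  where open LeftModule V

record IsHopfSubalgebra {V W : VectorSpace}
                        {DegV : ℕ → Pred ∣ V ∣ 0ℓ} {DegW : ℕ → Pred ∣ W ∣ 0ℓ}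
                        (K : HopfAlgebra V DegV) (H : HopfAlgebra W DegW)
                        (ι : ∣ V ∣ → ∣ W ∣) : Set where
  private
    module V  = LeftModule V
    module W  = LeftModule W
    module W² = LeftModule (W ⊠ W)
    module K  = HopfAlgebra K
    module H  = HopfAlgebra H
  field
    ι-linear    : IsLinear V W ι
    ι-injective : ∀ {f g} → ι f W.≈ᴹ ι g → f V.≈ᴹ g
    ι-Deg       : ∀ {k f} → DegV k f → DegW k (ι f)
    ι-∙ : ∀ f g → ι (f K.∙ g) W.≈ᴹ ι f H.∙ ι g
    ι-1 : ι K.1# W.≈ᴹ H.1#
    ι-Δ : ∀ f → tensorMap V V W W ι ι (K.Δ f) W².≈ᴹ H.Δ (ι f)
    ι-ε : ∀ f → K.ε f ≡ H.ε (ι f)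
    ι-S : ∀ f → ι (K.S f) W.≈ᴹ H.S (ι f)

-- (a , η) is the factor θᵢ^η xᵢ^a at a single index i.

Exponent : Set
Exponent = ℕ × Bool

trivial : Exponent
trivial = 0 , false

-- [ (a₁ , η₁) , … , (aₙ , ηₙ) ] is θ₁^η₁ ⋯ θₙ^ηₙ x₁^a₁ ⋯ xₙ^aₙ.  Lists that
-- differ by trailing trivial entries denote the same monomial.

Monomial : Set
Monomial = List Exponent

fermionic : Bool → ℕ
fermionic η = if η then 1 else 0

xDegree θDegree degree : Monomial → ℕ
xDegree = foldr (λ (a , _) n → a ℕ.+ n) 0
θDegree = foldr (λ (_ , η) n → fermionic η ℕ.+ n) 0
degree m = xDegree m ℕ.+ θDegree m

Coefficients : Set
Coefficients = Monomial → ℚ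

-- A formal power series of bounded degree: the coefficient does not depend
-- on the list representing a monomial, and the degree in all the variables
-- (x's and θ's together) is bounded.

WellDefined : Coefficients → Set
WellDefined f = ∀ m → f (m ∷ʳ trivial) ≡ f m

Bounded : Coefficients → Set
Bounded f = Σ[ N ∈ ℕ ] ∀ m → N < degree m → f m ≡ 0ℚ

one : Coefficients
one m = if degree m ≡ᵇ 0 then 1ℚ else 0ℚ

-- θ^m₁ θ^m₂ = (-1)^(crossings m₁ m₂) θ^(m₁ m₂) when m₁ and m₂ share no θ:
-- each θⱼ of m₂ moves past the θᵢ of m₁ with i > j.

crossings : Monomial → Monomial → ℕ
crossings (_ ∷ m₁) ((_ , η) ∷ m₂) = fermionic η ℕ.* θDegree m₁ ℕ.+ crossings m₁ m₂
crossings _        _              = 0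

splitη : Bool → List (Bool × Bool)
splitη false = [ false , false ]
splitη true  = (true , false) ∷ (false , true) ∷ []

splitExponent : Exponent → List (Exponent × Exponent)
splitExponent (a , η) =
  cartesianProductWith (λ k (η₁ , η₂) → (k , η₁) , (a ℕ.∸ k , η₂)) (upTo (suc a)) (splitη η)

-- All pairs of monomials whose product is ± the given one.

splits : Monomial → List (Monomial × Monomial)
splits []      = [ [] , [] ]
splits (e ∷ m) =
  cartesianProductWith (λ (e₁ , e₂) (m₁ , m₂) → e₁ ∷ m₁ , e₂ ∷ m₂) (splitExponent e) (splits m)

product : Coefficients → Coefficients → Coefficients
product f g m = foldr ℚ._+_ 0ℚ
  (map (λ (m₁ , m₂) → sign (crossings m₁ m₂) ℚ.* (f m₁ ℚ.* g m₂)) (splits m))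

record Subspace : Set₁ where
  field
    Member    : Coefficients → Set
    0-closed  : Member (λ _ → 0ℚ)
    +-closed  : ∀ {f g} → Member f → Member g → Member (λ m → f m ℚ.+ g m)
    neg-closed : ∀ {f} → Member f → Member (λ m → ℚ.- f m)
    *-closed  : ∀ c {f} → Member f → Member (λ m → c ℚ.* f m)

module _ (P : Subspace) where
  open Subspace P

  record Series : Set where
    constructor _,_
    field
      coeff  : Coefficients
      member : Member coeff

open Series public using (coeff)

space : Subspace → VectorSpace
space P = record
  { Carrierᴹ = Series P
  ; _≈ᴹ_     = λ f g → ∀ m → coeff f m ≡ coeff g m
  ; _+ᴹ_     = λ { (f , p) (g , q) → (λ m → f m ℚ.+ g m) , +-closed p q }
  ; _*ₗ_     = λ { c (f , p) → (λ m → c ℚ.* f m) , *-closed c p }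
  ; 0ᴹ       = (λ _ → 0ℚ) , 0-closed
  ; -ᴹ_      = λ { (f , p) → (λ m → ℚ.- f m) , neg-closed p }
  ; isLeftModule = record
    { isLeftSemimodule = record
      { +ᴹ-isCommutativeMonoid = record
        { isMonoid = record
          { isSemigroup = record
            { isMagma = record
              { isEquivalence = record
                { refl  = λ _ → refl
                ; sym   = λ p m → sym (p m)
                ; trans = λ p q m → trans (p m) (q m)
                }
              ; ∙-cong = λ p q m → cong₂ ℚ._+_ (p m) (q m)
              }
            ; assoc = λ f g h m → ℚₚ.+-assoc (coeff f m) (coeff g m) (coeff h m)
            }
          ; identity = (λ f m → ℚₚ.+-identityˡ (coeff f m))
                     , (λ f m → ℚₚ.+-identityʳ (coeff f m))
          }
        ; comm = λ f g m → ℚₚ.+-comm (coeff f m) (coeff g m)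
        }
      ; isPreleftSemimodule = record
        { *ₗ-cong      = λ p q m → cong₂ ℚ._*_ p (q m)
        ; *ₗ-zeroˡ     = λ f m → ℚₚ.*-zeroˡ (coeff f m)
        ; *ₗ-distribʳ  = λ f c d m → ℚₚ.*-distribʳ-+ (coeff f m) c d
        ; *ₗ-identityˡ = λ f m → ℚₚ.*-identityˡ (coeff f m)
        ; *ₗ-assoc     = λ c d f m → ℚₚ.*-assoc c d (coeff f m)
        ; *ₗ-zeroʳ     = λ c _ → ℚₚ.*-zeroʳ c
        ; *ₗ-distribˡ  = λ c f g m → ℚₚ.*-distribˡ-+ c (coeff f m) (coeff g m)
        }
      }
    ; -ᴹ‿cong    = λ p m → cong ℚ.-_ (p m)
    ; -ᴹ‿inverse = (λ f m → ℚₚ.+-inverseˡ (coeff f m))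
                 , (λ f m → ℚₚ.+-inverseʳ (coeff f m))
    }
  }
  where open Subspace P

module _ {P : Subspace} where

  FermionicDegree : ℕ → Pred (Series P) 0ℓ
  FermionicDegree k f = ∀ m → θDegree m ≢ k → coeff f m ≡ 0ℚ

  Degree : ℕ → Pred (Series P) 0ℓ
  Degree n f = ∀ m → degree m ≢ n → coeff f m ≡ 0ℚ

  -- Coefficient of (monomial m in x, θ) · (monomial n in y, φ) in the
  -- function of two sets of variables identified with a tensor: f ⊗ g goes
  -- to f(x;θ) g(y;φ).

  twoSets : ∣ space P ⊠ space P ∣ → Monomial → Monomial → ℚ
  twoSets (f ⊗ g) m n = coeff f m ℚ.* coeff g n
  twoSets 0#      m n = 0ℚ
  twoSets (s + t) m n = twoSets s m n ℚ.+ twoSets t m n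
  twoSets (c · t) m n = c ℚ.* twoSets t m n

  -- Coefficient of the same monomial in f(x,y;θ,φ).  In the ordered union the
  -- indices occurring in m precede those in n, so the dotted composition read
  -- off is the one of m ++ n (f is quasisymmetric, also when it is symmetric,
  -- so how far after the x's the y's are put is irrelevant).

  union : Series P → Monomial → Monomial → ℚ
  union f m n = coeff f (m ++ n)

  -- The Hopf algebra has the product of power series, the coproduct
  -- (Δ f)(x,y;θ,φ) = f(x,y;θ,φ) and the projection on constants as counit.

  record IsSuperspaceHopf (H : HopfAlgebra (space P) FermionicDegree) : Set where
    open HopfAlgebra H
    field
      ∙-series : ∀ f g m → coeff (f ∙ g) m ≡ product (coeff f) (coeff g) m
      1-series : ∀ m → coeff 1# m ≡ one m
      twoSets-injective : ∀ s t → (∀ m n → twoSets s m n ≡ twoSets t m n) →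
                          LeftModule._≈ᴹ_ (space P ⊠ space P) s t
      Δ-union  : ∀ f m n → twoSets (Δ f) m n ≡ union f m n
      ε-const  : ∀ f → ε f ≡ coeff f []

data Part : Set where
  undotted : (a : ℕ) .{{_ : NonZero a}} → Part
  dotted   : (a : ℕ) → Part

part : Exponent → Maybe Part
part (zero  , false) = nothing
part (suc a , false) = just (undotted (suc a))
part (a     , true)  = just (dotted a)

-- m is θ_{i₁}^η₁ ⋯ θ_{iₗ}^ηₗ x_{i₁}^α₁ ⋯ x_{iₗ}^αₗ for some i₁ < ⋯ < iₗ
-- exactly when composition m ≡ α.

composition : Monomial → List Part
composition = mapMaybe part

Quasisymmetric : Coefficients → Set
Quasisymmetric f = ∀ α m m′ → composition m ≡ α → composition m′ ≡ α → f m ≡ f m′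

-- The substitution xᵢ ↦ x_{σ i}, θᵢ ↦ θ_{σ i} sends the monomial v to
-- (-1)^(inversions σ v) times the monomial permute σ v.

permute : ∀ {n} → Permutation′ n → Vec Exponent n → Vec Exponent n
permute σ v = tabulate (λ j → Vec.lookup v (σ ⟨$⟩ˡ j))

inversions : ∀ {n} → Permutation′ n → Vec Exponent n → ℕ
inversions {n} σ v = length (filterᵇ inverted (cartesianProduct (allFin n) (allFin n)))
  where
  hasθ : Fin n → Bool
  hasθ i = proj₂ (Vec.lookup v i)
  inverted : Fin n × Fin n → Bool
  inverted (i , j) = (toℕ i <ᵇ toℕ j) ∧ (toℕ (σ ⟨$⟩ʳ j) <ᵇ toℕ (σ ⟨$⟩ʳ i)) ∧ hasθ i ∧ hasθ j

Symmetric : Coefficients → Set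
Symmetric f = ∀ n (σ : Permutation′ n) (v : Vec Exponent n) →
  f (toList (permute σ v)) ≡ sign (inversions σ v) ℚ.* f (toList v)

infixr 7 _∩_

_∩_ : Subspace → Subspace → Subspace
P ∩ Q = record
  { Member     = λ f → P.Member f × Q.Member f
  ; 0-closed   = P.0-closed , Q.0-closed
  ; +-closed   = λ (p , q) (p′ , q′) → P.+-closed p p′ , Q.+-closed q q′
  ; neg-closed = λ (p , q) → P.neg-closed p , Q.neg-closed q
  ; *-closed   = λ c (p , q) → P.*-closed c p , Q.*-closed c q
  }
  where
  module P = Subspace P
  module Q = Subspace Q

wellDefined : Subspace
wellDefined = record
  { Member     = WellDefined
  ; 0-closed   = λ _ → refl
  ; +-closed   = λ p q m → cong₂ ℚ._+_ (p m) (q m)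
  ; neg-closed = λ p m → cong ℚ.-_ (p m)
  ; *-closed   = λ c p m → cong (c ℚ.*_) (p m)
  }

bounded : Subspace
bounded = record
  { Member     = Bounded
  ; 0-closed   = 0 , λ _ _ → refl
  ; +-closed   = λ (M , p) (N , q) → M ℕ.⊔ N , λ m M⊔N<d →
      cong₂ ℚ._+_ (p m (ℕₚ.≤-<-trans (ℕₚ.m≤m⊔n M N) M⊔N<d))
                  (q m (ℕₚ.≤-<-trans (ℕₚ.m≤n⊔m M N) M⊔N<d))
  ; neg-closed = λ (N , p) → N , λ m N<d → cong ℚ.-_ (p m N<d)
  ; *-closed   = λ c (N , p) → N , λ m N<d → trans (cong (c ℚ.*_) (p m N<d)) (ℚₚ.*-zeroʳ c)
  }

quasisymmetric : Subspace
quasisymmetric = record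
  { Member     = Quasisymmetric
  ; 0-closed   = λ _ _ _ _ _ → refl
  ; +-closed   = λ p q α m m′ e e′ → cong₂ ℚ._+_ (p α m m′ e e′) (q α m m′ e e′)
  ; neg-closed = λ p α m m′ e e′ → cong ℚ.-_ (p α m m′ e e′)
  ; *-closed   = λ c p α m m′ e e′ → cong (c ℚ.*_) (p α m m′ e e′)
  }

symmetric : Subspace
symmetric = record
  { Member     = Symmetric
  ; 0-closed   = λ n σ v → sym (ℚₚ.*-zeroʳ (sgn σ v))
  ; +-closed   = λ p q n σ v →
      trans (cong₂ ℚ._+_ (p n σ v) (q n σ v)) (sym (ℚₚ.*-distribˡ-+ (sgn σ v) _ _))
  ; neg-closed = λ p n σ v →
      trans (cong ℚ.-_ (p n σ v)) (ℚₚ.neg-distribʳ-* (sgn σ v) _)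
  ; *-closed   = λ c {f} p n σ v → let s = sgn σ v ; x = f (toList v) in
      trans (cong (c ℚ.*_) (p n σ v))
        (trans (sym (ℚₚ.*-assoc c s x))
          (trans (cong (ℚ._* x) (ℚₚ.*-comm c s)) (ℚₚ.*-assoc s c x)))
  }
  where
  sgn : ∀ {n} → Permutation′ n → Vec Exponent n → ℚ
  sgn σ v = sign (inversions σ v)

sQSymSubspace ΛSubspace : Subspace
sQSymSubspace = wellDefined ∩ bounded ∩ quasisymmetric
ΛSubspace     = wellDefined ∩ bounded ∩ symmetric

sQSym Λ : VectorSpace
sQSym = space sQSymSubspace
Λ     = space ΛSubspace

-- Both subspaces have, up to each degree, a finite basis whose coordinates are
-- coefficients: the monomial quasisymmetric functions for sQSym and their signed
-- averages for Λ.  Hence a tensor is determined by its coefficients as a function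
-- of two sets of variables, and Δ f = Σ_p e_p ⊗ f(p · _) is the only tensor with
-- coefficients f(m n).  Coassociativity is then the associativity of concatenation,
-- and Δ (f g) = Δ f Δ g amounts to counting the crossings of a concatenation.  The
-- antipode is the geometric series of uε − id for convolution.
--
-- Membership of Λ is checked on adjacent transpositions, a permutation being
-- undone by bringing one entry at a time to the front.

module Submission where

open import Defs
open import Algebra.Bundles using (module CommutativeMonoid)
open import Algebra.Module.Bundles using (LeftModule)
open import Algebra.Module.Morphism.Structures using (module LeftModuleMorphisms)
open import Algebra.Structures using (IsRing)
import Algebra.Properties.AbelianGroup as AbelianGroupProperties
import Algebra.Properties.CommutativeMonoid.Sum as CMSum
import Algebra.Properties.CommutativeSemigroup as CommutativeSemigroupProperties
open import Data.Bool.Base using (Bool; true; false; if_then_else_; _∧_)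
open import Data.Bool.Properties as 𝔹ₚ using (∧-zeroʳ)
open import Data.Fin.Base using (Fin; zero; suc; toℕ; punchIn)
import Data.Fin.Permutation as Permutation
open Permutation using (Permutation′; permutation; _⟨$⟩ʳ_; _⟨$⟩ˡ_; lift₀; remove)
open import Data.List.Base
  using (List; []; _∷_; [_]; _++_; map; foldr; length; upTo; applyUpTo; allFin; filterᵇ
        ; cartesianProduct; cartesianProductWith; tabulate; lookup)
open import Data.List.Membership.Propositional using (_∈_)
open import Data.List.Membership.Propositional.Properties
  using (∈-cartesianProductWith⁺; ∈-cartesianProductWith⁻; ∈-cartesianProduct⁺; ∈-upTo⁺)
open import Data.List.Properties
  using (++-assoc; ++-identityʳ; ∷-injective; ≡-dec; length-++; map-++; mapMaybe-++
        ; tabulate-cong; tabulate-lookup)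
open import Data.List.Relation.Unary.All as All using (All; []; _∷_)
open import Data.List.Relation.Unary.AllPairs using ([]; _∷_)
open import Data.List.Relation.Unary.Any using (here; there)
open import Data.List.Relation.Unary.Unique.Propositional using (Unique)
import Data.List.Relation.Unary.Unique.Propositional.Properties as Unique
open import Data.Nat.Base as ℕ using (ℕ; zero; suc; _∸_; _≤_; _<_; _⊔_; z≤n; s≤s)
import Data.Nat.Properties as ℕₚ
import Data.Nat.Solver as ℕSolver
open import Data.Product.Base using (Σ-syntax; _×_; _,_; proj₁; proj₂)
import Data.Product.Properties as ×ₚ
open import Data.Rational.Base
  using (ℚ; 0ℚ; 1ℚ; ½; _+_; _*_; -_; NonNegative; NonZero; 1/_)
import Data.Rational.Properties as ℚₚ
open import Data.Rational.Solver using (module +-*-Solver)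
open import Data.Sum.Base using (_⊎_; inj₁; inj₂)
open import Data.Vec.Base as Vec using (Vec; toList)
open import Data.Vec.Properties using (lookup∘tabulate; tabulate∘lookup)
open import Function.Base using (id; flip; _∘_; case_of_)
open import Level using (0ℓ)
open import Relation.Binary.Definitions using (DecidableEquality)
open import Relation.Binary.PropositionalEquality
  using (_≡_; _≢_; refl; sym; trans; cong; cong₂; subst; module ≡-Reasoning)
open import Relation.Nullary.Decidable using (yes; no)
open import Relation.Nullary.Negation using (contradiction)
open import Relation.Unary using (Pred)

open CMSum ℕₚ.+-0-commutativeMonoid using (sum; sum-cong-≗; sum-remove; ∑-distrib-+)
open Tensor using (_⊗_; 0#; _·_) renaming (_+_ to _⊕_)
open ≡-Reasoning

-- Finite sums and decompositions of monomials

-- Two obstacles shape the proof. An element of `V ⊠ V` is a formal expression modulo a generated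
-- equality, so nothing can be read off it directly. All that is used to compare tensors is the
-- identity f = Σ f(p) e_p over finitely many words p. The e_p need not be independent: for Λ the
-- averages of reordered words agree up to sign, and some vanish. Moreover the sign (-1)^(jk) in the
-- product of tensors belongs to homogeneous factors, whereas the factors of a formal tensor are
-- arbitrary. It is therefore written as a combination of terms that are a function of j times a
-- function of k, and these extend bilinearly.
--
-- Δ, the product and the antipode are built from the closure properties in `Admissible`, for both
-- spaces at once. The two coproducts are then different expressions and the two antipodes may be
-- truncated at different places. They agree under the inclusion because coefficients determine
-- tensors and longer truncations change nothing.
--
-- Quasisymmetry is used as the right to delete a trivial entry, and symmetry as a rule for
-- exchanging two neighbours: both survive the splitting of a monomial into factors.

opaque

  ∑ : {A : Set} → List A → (A → ℚ) → ℚ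
  ∑ xs F = foldr _+_ 0ℚ (map F xs)

  ∑-[] : ∀ {A : Set} (F : A → ℚ) → ∑ [] F ≡ 0ℚ
  ∑-[] F = refl

  ∑-∷ : ∀ {A : Set} (x : A) xs F → ∑ (x ∷ xs) F ≡ F x + ∑ xs F
  ∑-∷ x xs F = refl

  ∑-foldr : ∀ {A : Set} (xs : List A) F → ∑ xs F ≡ foldr _+_ 0ℚ (map F xs)
  ∑-foldr xs F = refl

  ∑-cong : ∀ {A : Set} (xs : List A) {F G} → (∀ x → F x ≡ G x) → ∑ xs F ≡ ∑ xs G
  ∑-cong []       h = refl
  ∑-cong (x ∷ xs) h = cong₂ _+_ (h x) (∑-cong xs h)

  ∑-0 : ∀ {A : Set} (xs : List A) → ∑ xs (λ _ → 0ℚ) ≡ 0ℚ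
  ∑-0 []       = refl
  ∑-0 (x ∷ xs) = trans (ℚₚ.+-identityˡ _) (∑-0 xs)

  ∑-+ : ∀ {A : Set} (xs : List A) F G → ∑ xs (λ x → F x + G x) ≡ ∑ xs F + ∑ xs G
  ∑-+ []       F G = sym (ℚₚ.+-identityˡ 0ℚ)
  ∑-+ (x ∷ xs) F G = trans (cong (F x + G x +_) (∑-+ xs F G))
    (solve 4 (λ a b c d → a :+ b :+ (c :+ d) := a :+ c :+ (b :+ d)) refl (F x) (G x) (∑ xs F) (∑ xs G))
    where open +-*-Solver

  ∑-* : ∀ {A : Set} (xs : List A) c F → ∑ xs (λ x → c * F x) ≡ c * ∑ xs F
  ∑-* []       c F = sym (ℚₚ.*-zeroʳ c)
  ∑-* (x ∷ xs) c F = trans (cong (c * F x +_) (∑-* xs c F)) (sym (ℚₚ.*-distribˡ-+ c _ _))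

  ∑-++ : ∀ {A : Set} (xs ys : List A) F → ∑ (xs ++ ys) F ≡ ∑ xs F + ∑ ys F
  ∑-++ []       ys F = sym (ℚₚ.+-identityˡ _)
  ∑-++ (x ∷ xs) ys F = trans (cong (F x +_) (∑-++ xs ys F)) (sym (ℚₚ.+-assoc (F x) _ _))

  ∑-map : ∀ {A B : Set} (f : B → A) xs F → ∑ (map f xs) F ≡ ∑ xs (λ x → F (f x))
  ∑-map f []       F = refl
  ∑-map f (x ∷ xs) F = cong (F (f x) +_) (∑-map f xs F)

  ∑-comm : ∀ {A B : Set} (xs : List A) (ys : List B) (F : A → B → ℚ) →
           ∑ xs (λ x → ∑ ys (F x)) ≡ ∑ ys (λ y → ∑ xs (λ x → F x y))
  ∑-comm []       ys F = sym (∑-0 ys)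
  ∑-comm (x ∷ xs) ys F = trans (cong (∑ ys (F x) +_) (∑-comm xs ys F))
    (sym (∑-+ ys (F x) (λ y → ∑ xs (λ x → F x y))))

  ∑-cartesianProductWith : ∀ {A B C : Set} (f : A → B → C) xs ys F →
    ∑ (cartesianProductWith f xs ys) F ≡ ∑ xs (λ x → ∑ ys (λ y → F (f x y)))
  ∑-cartesianProductWith f []       ys F = refl
  ∑-cartesianProductWith f (x ∷ xs) ys F = trans (∑-++ (map (f x) ys) _ F)
    (cong₂ _+_ (∑-map (f x) ys F) (∑-cartesianProductWith f xs ys F))

  ∑-applyUpTo : ∀ {A B : Set} (f : ℕ → A) (g : A → B) n F →
    ∑ (applyUpTo (g ∘ f) n) F ≡ ∑ (applyUpTo f n) (λ x → F (g x))
  ∑-applyUpTo f g zero    F = refl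
  ∑-applyUpTo f g (suc n) F = cong (F (g (f 0)) +_) (∑-applyUpTo (f ∘ suc) g n F)

∑-zero : ∀ {A : Set} (xs : List A) {F : A → ℚ} → (∀ x → F x ≡ 0ℚ) → ∑ xs F ≡ 0ℚ
∑-zero xs h = trans (∑-cong xs h) (∑-0 xs)

opaque
  unfolding ∑

  natSum : ℕ → (ℕ → ℕ → ℚ) → ℚ
  natSum a G = ∑ (upTo (suc a)) (λ k → G k (a ∸ k))

  natSum-upTo : ∀ a G → natSum a G ≡ ∑ (upTo (suc a)) (λ k → G k (a ∸ k))
  natSum-upTo a G = refl

  natSum-zero : ∀ G → natSum 0 G ≡ G 0 0
  natSum-zero G = ℚₚ.+-identityʳ (G 0 0)

  natSum-suc : ∀ a G → natSum (suc a) G ≡ G 0 (suc a) + natSum a (λ i j → G (suc i) j)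
  natSum-suc a G = cong (G 0 (suc a) +_) (∑-applyUpTo id suc (suc a) (λ k → G k (suc a ∸ k)))

  natSum-∑ : ∀ {A : Set} a (xs : List A) (F : ℕ → ℕ → A → ℚ) →
    natSum a (λ i j → ∑ xs (F i j)) ≡ ∑ xs (λ x → natSum a (λ i j → F i j x))
  natSum-∑ a xs F = ∑-comm (upTo (suc a)) xs (λ k → F k (a ∸ k))

  natSum-+ : ∀ a G H → natSum a (λ i j → G i j + H i j) ≡ natSum a G + natSum a H
  natSum-+ a G H = ∑-+ (upTo (suc a)) (λ k → G k (a ∸ k)) (λ k → H k (a ∸ k))

natSum-cong : ∀ a {G H} → (∀ i j → i ℕ.+ j ≡ a → G i j ≡ H i j) → natSum a G ≡ natSum a H
natSum-cong zero    {G} {H} h = trans (natSum-zero G) (trans (h 0 0 refl) (sym (natSum-zero H)))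
natSum-cong (suc a) {G} {H} h = trans (natSum-suc a G)
  (trans (cong₂ _+_ (h 0 (suc a) refl) (natSum-cong a (λ i j e → h (suc i) j (cong suc e))))
    (sym (natSum-suc a H)))

-- The recursion from the other end: `natSum-suc` splits off the term with first index 0, this one
-- the term with second index 0. Matching the two recursions gives `natSum-swap`.
natSum-last : ∀ a G → natSum (suc a) G ≡ natSum a (λ i j → G i (suc j)) + G (suc a) 0
natSum-last zero    G = begin
  natSum 1 G                          ≡⟨ natSum-suc 0 G ⟩
  G 0 1 + natSum 0 (λ i → G (suc i))  ≡⟨ cong (G 0 1 +_) (natSum-zero (λ i → G (suc i))) ⟩
  G 0 1 + G 1 0                       ≡⟨ cong (_+ G 1 0) (natSum-zero (λ i j → G i (suc j))) ⟨
  natSum 0 (λ i j → G i (suc j)) + G 1 0 ∎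
natSum-last (suc a) G = begin
  natSum (suc (suc a)) G
    ≡⟨ natSum-suc (suc a) G ⟩
  G 0 (suc (suc a)) + natSum (suc a) (λ i j → G (suc i) j)
    ≡⟨ cong (G 0 (suc (suc a)) +_) (natSum-last a (λ i j → G (suc i) j)) ⟩
  G 0 (suc (suc a)) + (natSum a (λ i j → G (suc i) (suc j)) + G (suc (suc a)) 0)
    ≡⟨ ℚₚ.+-assoc (G 0 (suc (suc a))) _ _ ⟨
  G 0 (suc (suc a)) + natSum a (λ i j → G (suc i) (suc j)) + G (suc (suc a)) 0
    ≡⟨ cong (_+ G (suc (suc a)) 0) (natSum-suc a (λ i j → G i (suc j))) ⟨
  natSum (suc a) (λ i j → G i (suc j)) + G (suc (suc a)) 0 ∎

natSum-swap : ∀ a G → natSum a G ≡ natSum a (flip G)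
natSum-swap zero    G = trans (natSum-zero G) (sym (natSum-zero (flip G)))
natSum-swap (suc a) G = begin
  natSum (suc a) G                                     ≡⟨ natSum-last a G ⟩
  natSum a (λ i j → G i (suc j)) + G (suc a) 0         ≡⟨ ℚₚ.+-comm _ (G (suc a) 0) ⟩
  G (suc a) 0 + natSum a (λ i j → G i (suc j))         ≡⟨ cong (G (suc a) 0 +_) (natSum-swap a (λ i j → G i (suc j))) ⟩
  G (suc a) 0 + natSum a (λ i j → G j (suc i))         ≡⟨ natSum-suc a (flip G) ⟨
  natSum (suc a) (flip G)                              ∎

-- Both sides run over the triples with sum `a`. The triples with first index 0 are collected from
-- all the inner sums on the left into `natSum (suc a) (F 0)`. The remaining ones have positive
-- first index and form the induction hypothesis.
natSum-assoc : ∀ a (F : ℕ → ℕ → ℕ → ℚ) →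
  natSum a (λ p l → natSum p (λ i j → F i j l)) ≡ natSum a (λ i q → natSum q (F i))
natSum-assoc zero    F = begin
  natSum 0 (λ p l → natSum p (λ i j → F i j l)) ≡⟨ natSum-zero _ ⟩
  natSum 0 (λ i j → F i j 0)                    ≡⟨ natSum-zero _ ⟩
  F 0 0 0                                       ≡⟨ natSum-zero (F 0) ⟨
  natSum 0 (F 0)                                ≡⟨ natSum-zero (λ i q → natSum q (F i)) ⟨
  natSum 0 (λ i q → natSum q (F i))             ∎
natSum-assoc (suc a) F = begin
  natSum (suc a) (λ p l → natSum p (λ i j → F i j l))
    ≡⟨ natSum-suc a (λ p l → natSum p (λ i j → F i j l)) ⟩
  natSum 0 (λ i j → F i j (suc a)) + natSum a (λ p l → natSum (suc p) (λ i j → F i j l))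
    ≡⟨ cong₂ _+_ (natSum-zero (λ i j → F i j (suc a)))
         (trans (natSum-cong a (λ p l _ → natSum-suc p (λ i j → F i j l)))
           (natSum-+ a (λ p l → F 0 (suc p) l) (λ p l → natSum p (λ i j → F (suc i) j l)))) ⟩
  F 0 0 (suc a) + (natSum a (λ p l → F 0 (suc p) l) + natSum a (λ p l → natSum p (λ i j → F (suc i) j l)))
    ≡⟨ ℚₚ.+-assoc (F 0 0 (suc a)) _ _ ⟨
  F 0 0 (suc a) + natSum a (λ p l → F 0 (suc p) l) + natSum a (λ p l → natSum p (λ i j → F (suc i) j l))
    ≡⟨ cong₂ _+_ (sym (natSum-suc a (F 0))) (natSum-assoc a (λ i → F (suc i))) ⟩
  natSum (suc a) (F 0) + natSum a (λ i q → natSum q (F (suc i)))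
    ≡⟨ natSum-suc a (λ i q → natSum q (F i)) ⟨
  natSum (suc a) (λ i q → natSum q (F i)) ∎

opaque
  unfolding ∑

  boolSum : Bool → (Bool → Bool → ℚ) → ℚ
  boolSum η G = ∑ (splitη η) (λ p → G (proj₁ p) (proj₂ p))

  boolSum-splitη : ∀ η G → boolSum η G ≡ ∑ (splitη η) (λ p → G (proj₁ p) (proj₂ p))
  boolSum-splitη η G = refl

  boolSum-false : ∀ G → boolSum false G ≡ G false false
  boolSum-false G = ℚₚ.+-identityʳ _

  boolSum-cong : ∀ η {G H} →
    (∀ η₁ η₂ → fermionic η₁ ℕ.+ fermionic η₂ ≡ fermionic η → G η₁ η₂ ≡ H η₁ η₂) →
    boolSum η G ≡ boolSum η H
  boolSum-cong false h = cong (_+ 0ℚ) (h false false refl)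
  boolSum-cong true  h = cong₂ _+_ (h true false refl) (cong (_+ 0ℚ) (h false true refl))

  boolSum-swap : ∀ η G → boolSum η G ≡ boolSum η (flip G)
  boolSum-swap false G = refl
  boolSum-swap true  G = solve 2 (λ x y → x :+ (y :+ con 0ℚ) := y :+ (x :+ con 0ℚ)) refl
                           (G true false) (G false true)
    where open +-*-Solver

  boolSum-assoc : ∀ η (F : Bool → Bool → Bool → ℚ) →
    boolSum η (λ p l → boolSum p (λ i j → F i j l)) ≡ boolSum η (λ i q → boolSum q (F i))
  boolSum-assoc false F = refl
  boolSum-assoc true  F =
    solve 3 (λ x y z → x :+ (y :+ o) :+ (z :+ o :+ o) := x :+ o :+ (y :+ (z :+ o) :+ o)) refl
      (F true false false) (F false true false) (F false false true)
    where
    open +-*-Solver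
    o : ∀ {n} → Polynomial n
    o = con 0ℚ

-- The θ-exponents are added in ℕ, where 1 + 1 is the value of no Boolean. This excludes a θ in both
-- factors, which is the relation θᵢ² = 0.
data SplitExponent : (e₁ e₂ e : Exponent) → Set where
  split : ∀ {a₁ a₂ a η₁ η₂ η} → a₁ ℕ.+ a₂ ≡ a → fermionic η₁ ℕ.+ fermionic η₂ ≡ fermionic η →
          SplitExponent (a₁ , η₁) (a₂ , η₂) (a , η)

opaque
  unfolding natSum boolSum

  expSum : Exponent → (Exponent → Exponent → ℚ) → ℚ
  expSum e F = ∑ (splitExponent e) (λ p → F (proj₁ p) (proj₂ p))

  expSum-natSum : ∀ a η F →
    expSum (a , η) F ≡ natSum a (λ i j → boolSum η (λ η₁ η₂ → F (i , η₁) (j , η₂)))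
  expSum-natSum a η F =
    ∑-cartesianProductWith (λ k p → (k , proj₁ p) , (a ∸ k , proj₂ p)) (upTo (suc a)) (splitη η) _

  expSum-∑ : ∀ {A : Set} e (xs : List A) (F : Exponent → Exponent → A → ℚ) →
    expSum e (λ i j → ∑ xs (F i j)) ≡ ∑ xs (λ x → expSum e (λ i j → F i j x))
  expSum-∑ e xs F = ∑-comm (splitExponent e) xs (λ p → F (proj₁ p) (proj₂ p))

expSum-trivial : ∀ F → expSum trivial F ≡ F trivial trivial
expSum-trivial F = trans (expSum-natSum 0 false F) (trans (natSum-zero _) (boolSum-false _))

expSum-cong : ∀ e {F G} → (∀ e₁ e₂ → SplitExponent e₁ e₂ e → F e₁ e₂ ≡ G e₁ e₂) →
              expSum e F ≡ expSum e G
expSum-cong (a , η) {F} {G} h = trans (expSum-natSum a η F)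
  (trans (natSum-cong a (λ _ _ p → boolSum-cong η (λ _ _ q → h _ _ (split p q)))) (sym (expSum-natSum a η G)))

expSum-swap : ∀ e F → expSum e F ≡ expSum e (flip F)
expSum-swap (a , η) F = trans (expSum-natSum a η F)
  (trans (natSum-swap a _)
    (trans (natSum-cong a (λ i j _ → boolSum-swap η (λ η₁ η₂ → F (j , η₁) (i , η₂))))
      (sym (expSum-natSum a η (flip F)))))

natSum-boolSum : ∀ a η (F : ℕ → ℕ → Bool → Bool → ℚ) →
  natSum a (λ i j → boolSum η (F i j)) ≡ boolSum η (λ κ ι → natSum a (λ i j → F i j κ ι))
natSum-boolSum a η F = trans (natSum-cong a (λ i j _ → boolSum-splitη η (F i j)))
  (trans (natSum-∑ a (splitη η) (λ i j p → F i j (proj₁ p) (proj₂ p))) (sym (boolSum-splitη η _)))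

-- The x-exponent and the θ-exponent are split independently. Once `natSum-boolSum` has moved the
-- sums over Booleans inside, each kind of sum is reassociated by itself.
expSum-assoc : ∀ e (F : Exponent → Exponent → Exponent → ℚ) →
  expSum e (λ p l → expSum p (λ i j → F i j l)) ≡ expSum e (λ i q → expSum q (F i))
expSum-assoc (a , η) F = begin
  expSum (a , η) (λ p l → expSum p (λ i j → F i j l))
    ≡⟨ expSum-natSum a η _ ⟩
  natSum a (λ p l → boolSum η (λ π λ′ → expSum (p , π) (λ i j → F i j (l , λ′))))
    ≡⟨ natSum-cong a (λ p l _ → trans
         (boolSum-cong η (λ π λ′ _ → expSum-natSum p π (λ i j → F i j (l , λ′))))
         (sym (natSum-boolSum p η (λ i j π λ′ → boolSum π (λ ι κ → F (i , ι) (j , κ) (l , λ′)))))) ⟩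
  natSum a (λ p l → natSum p (λ i j →
    boolSum η (λ π λ′ → boolSum π (λ ι κ → F (i , ι) (j , κ) (l , λ′)))))
    ≡⟨ natSum-assoc a (λ i j l → boolSum η (λ π λ′ → boolSum π (λ ι κ → F (i , ι) (j , κ) (l , λ′)))) ⟩
  natSum a (λ i q → natSum q (λ j l →
    boolSum η (λ π λ′ → boolSum π (λ ι κ → F (i , ι) (j , κ) (l , λ′)))))
    ≡⟨ natSum-cong a (λ i q _ → natSum-cong q (λ j l _ →
         boolSum-assoc η (λ ι κ λ′ → F (i , ι) (j , κ) (l , λ′)))) ⟩
  natSum a (λ i q → natSum q (λ j l →
    boolSum η (λ ι κλ → boolSum κλ (λ κ λ′ → F (i , ι) (j , κ) (l , λ′)))))
    ≡⟨ natSum-cong a (λ i q _ → trans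
         (natSum-boolSum q η (λ j l ι κλ → boolSum κλ (λ κ λ′ → F (i , ι) (j , κ) (l , λ′))))
         (sym (boolSum-cong η (λ ι κλ _ → expSum-natSum q κλ (F (i , ι)))))) ⟩
  natSum a (λ i q → boolSum η (λ ι κλ → expSum (q , κλ) (F (i , ι))))
    ≡⟨ expSum-natSum a η _ ⟨
  expSum (a , η) (λ i q → expSum q (F i)) ∎

data Split : (m₁ m₂ m : Monomial) → Set where
  []  : Split [] [] []
  _∷_ : ∀ {e₁ e₂ e m₁ m₂ m} → SplitExponent e₁ e₂ e → Split m₁ m₂ m →
        Split (e₁ ∷ m₁) (e₂ ∷ m₂) (e ∷ m)

opaque
  unfolding expSum

  splitSum : Monomial → (Monomial → Monomial → ℚ) → ℚ
  splitSum m F = ∑ (splits m) (λ p → F (proj₁ p) (proj₂ p))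

  splitSum-splits : ∀ m F → splitSum m F ≡ ∑ (splits m) (λ p → F (proj₁ p) (proj₂ p))
  splitSum-splits m F = refl

  splitSum-[] : ∀ F → splitSum [] F ≡ F [] []
  splitSum-[] F = ℚₚ.+-identityʳ _

  splitSum-∷ : ∀ e m F →
    splitSum (e ∷ m) F ≡ expSum e (λ e₁ e₂ → splitSum m (λ m₁ m₂ → F (e₁ ∷ m₁) (e₂ ∷ m₂)))
  splitSum-∷ e m F = ∑-cartesianProductWith _ (splitExponent e) (splits m) _

  expSum-splitSum : ∀ e m (F : Exponent → Exponent → Monomial → Monomial → ℚ) →
    expSum e (λ i j → splitSum m (F i j)) ≡ splitSum m (λ p q → expSum e (λ i j → F i j p q))
  expSum-splitSum e m F = expSum-∑ e (splits m) (λ i j p → F i j (proj₁ p) (proj₂ p))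

  splitSum-+ : ∀ m F G → splitSum m (λ i j → F i j + G i j) ≡ splitSum m F + splitSum m G
  splitSum-+ m F G = ∑-+ (splits m) (λ p → F (proj₁ p) (proj₂ p)) (λ p → G (proj₁ p) (proj₂ p))

  splitSum-* : ∀ m c F → splitSum m (λ i j → c * F i j) ≡ c * splitSum m F
  splitSum-* m c F = ∑-* (splits m) c (λ p → F (proj₁ p) (proj₂ p))

splitSum-cong : ∀ m {F G} → (∀ m₁ m₂ → Split m₁ m₂ m → F m₁ m₂ ≡ G m₁ m₂) →
                splitSum m F ≡ splitSum m G
splitSum-cong []      {F} {G} h = trans (splitSum-[] F) (trans (h [] [] []) (sym (splitSum-[] G)))
splitSum-cong (e ∷ m) {F} {G} h = trans (splitSum-∷ e m F)
  (trans (expSum-cong e (λ _ _ s → splitSum-cong m (λ _ _ t → h _ _ (s ∷ t)))) (sym (splitSum-∷ e m G)))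

splitSum-zero : ∀ m {F} → (∀ m₁ m₂ → Split m₁ m₂ m → F m₁ m₂ ≡ 0ℚ) → splitSum m F ≡ 0ℚ
splitSum-zero m h = trans (splitSum-cong m h) (trans (splitSum-splits m _) (∑-0 (splits m)))

splitSum-swap : ∀ m F → splitSum m F ≡ splitSum m (flip F)
splitSum-swap []      F = trans (splitSum-[] F) (sym (splitSum-[] (flip F)))
splitSum-swap (e ∷ m) F = trans (splitSum-∷ e m F)
  (trans (expSum-swap e _)
    (trans (expSum-cong e (λ e₁ e₂ _ → splitSum-swap m (λ m₁ m₂ → F (e₂ ∷ m₁) (e₁ ∷ m₂))))
      (sym (splitSum-∷ e m (flip F)))))

-- Both sides run over the decompositions of `m` into three factors. This is the unsigned half of
-- the associativity of the product; the signs are matched by `crossings-splitˡ` and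
-- `crossings-splitʳ`.
splitSum-assoc : ∀ m (F : Monomial → Monomial → Monomial → ℚ) →
  splitSum m (λ p l → splitSum p (λ i j → F i j l)) ≡ splitSum m (λ i q → splitSum q (F i))
splitSum-assoc []      F = trans (splitSum-[] _) (trans (splitSum-[] _)
  (sym (trans (splitSum-[] _) (splitSum-[] _))))
splitSum-assoc (e ∷ m) F = begin
  splitSum (e ∷ m) (λ p l → splitSum p (λ i j → F i j l))
    ≡⟨ splitSum-∷ e m _ ⟩
  expSum e (λ x z → splitSum m (λ p l → splitSum (x ∷ p) (λ i j → F i j (z ∷ l))))
    ≡⟨ expSum-cong e (λ x z _ → trans
         (splitSum-cong m (λ p l _ → splitSum-∷ x p (λ i j → F i j (z ∷ l))))
         (sym (expSum-splitSum x m (λ u v p l → splitSum p (λ i j → F (u ∷ i) (v ∷ j) (z ∷ l)))))) ⟩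
  expSum e (λ x z → expSum x (λ u v → splitSum m (λ p l → splitSum p (λ i j → F (u ∷ i) (v ∷ j) (z ∷ l)))))
    ≡⟨ expSum-assoc e (λ u v z → splitSum m (λ p l → splitSum p (λ i j → F (u ∷ i) (v ∷ j) (z ∷ l)))) ⟩
  expSum e (λ u y → expSum y (λ v z → splitSum m (λ p l → splitSum p (λ i j → F (u ∷ i) (v ∷ j) (z ∷ l)))))
    ≡⟨ expSum-cong e (λ u y _ → trans
         (expSum-cong y (λ v z _ → splitSum-assoc m (λ i j l → F (u ∷ i) (v ∷ j) (z ∷ l))))
         (trans (expSum-splitSum y m (λ v z i q → splitSum q (λ j l → F (u ∷ i) (v ∷ j) (z ∷ l))))
           (sym (splitSum-cong m (λ i q _ → splitSum-∷ y q (F (u ∷ i))))))) ⟩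
  expSum e (λ u y → splitSum m (λ i q → splitSum (y ∷ q) (F (u ∷ i))))
    ≡⟨ splitSum-∷ e m _ ⟨
  splitSum (e ∷ m) (λ i q → splitSum q (F i)) ∎

splitSum-++ : ∀ m n F →
  splitSum (m ++ n) F ≡ splitSum m (λ m₁ m₂ → splitSum n (λ n₁ n₂ → F (m₁ ++ n₁) (m₂ ++ n₂)))
splitSum-++ []      n F = sym (splitSum-[] _)
splitSum-++ (e ∷ m) n F = trans (splitSum-∷ e (m ++ n) F)
  (trans (expSum-cong e (λ e₁ e₂ _ → splitSum-++ m n (λ m₁ m₂ → F (e₁ ∷ m₁) (e₂ ∷ m₂))))
    (sym (splitSum-∷ e m _)))

-- Signs and the product of power series

sign-+ : ∀ a b → sign (a ℕ.+ b) ≡ sign a * sign b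
sign-+ zero    b = sym (ℚₚ.*-identityˡ (sign b))
sign-+ (suc a) b = trans (cong -_ (sign-+ a b)) (ℚₚ.neg-distribˡ-* (sign a) (sign b))

sign-square : ∀ a → sign a * sign a ≡ 1ℚ
sign-square zero    = refl
sign-square (suc a) = trans (solve 1 (λ x → (:- x) :* (:- x) := x :* x) refl (sign a)) (sign-square a)
  where open +-*-Solver

sign-cancel : ∀ a b → sign (a ℕ.+ (b ℕ.+ b)) ≡ sign a
sign-cancel a b = begin
  sign (a ℕ.+ (b ℕ.+ b))   ≡⟨ sign-+ a (b ℕ.+ b) ⟩
  sign a * sign (b ℕ.+ b)  ≡⟨ cong (sign a *_) (trans (sign-+ b b) (sign-square b)) ⟩
  sign a * 1ℚ              ≡⟨ ℚₚ.*-identityʳ (sign a) ⟩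
  sign a                   ∎

xDegree-++ : ∀ m n → xDegree (m ++ n) ≡ xDegree m ℕ.+ xDegree n
xDegree-++ []            n = refl
xDegree-++ ((a , _) ∷ m) n = trans (cong (a ℕ.+_) (xDegree-++ m n)) (sym (ℕₚ.+-assoc a _ _))

θDegree-++ : ∀ m n → θDegree (m ++ n) ≡ θDegree m ℕ.+ θDegree n
θDegree-++ []            n = refl
θDegree-++ ((_ , η) ∷ m) n =
  trans (cong (fermionic η ℕ.+_) (θDegree-++ m n)) (sym (ℕₚ.+-assoc (fermionic η) _ _))

interchange : ∀ a b c d → a ℕ.+ b ℕ.+ (c ℕ.+ d) ≡ a ℕ.+ c ℕ.+ (b ℕ.+ d)
interchange = solve 4 (λ a b c d → a :+ b :+ (c :+ d) := a :+ c :+ (b :+ d)) refl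
  where open ℕSolver.+-*-Solver

degree-++ : ∀ m n → degree (m ++ n) ≡ degree m ℕ.+ degree n
degree-++ m n = trans (cong₂ ℕ._+_ (xDegree-++ m n) (θDegree-++ m n))
  (interchange (xDegree m) (xDegree n) (θDegree m) (θDegree n))

xDegree-split : ∀ {m₁ m₂ m} → Split m₁ m₂ m → xDegree m₁ ℕ.+ xDegree m₂ ≡ xDegree m
xDegree-split []                = refl
xDegree-split (split {a₁} {a₂} p _ ∷ s) =
  trans (interchange a₁ _ a₂ _) (cong₂ ℕ._+_ p (xDegree-split s))

θDegree-split : ∀ {m₁ m₂ m} → Split m₁ m₂ m → θDegree m₁ ℕ.+ θDegree m₂ ≡ θDegree m
θDegree-split []                = refl
θDegree-split (split {η₁ = η₁} {η₂} _ p ∷ s) =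
  trans (interchange (fermionic η₁) _ (fermionic η₂) _) (cong₂ ℕ._+_ p (θDegree-split s))

degree-split : ∀ {m₁ m₂ m} → Split m₁ m₂ m → degree m₁ ℕ.+ degree m₂ ≡ degree m
degree-split {m₁} {m₂} s = trans (interchange (xDegree m₁) (θDegree m₁) (xDegree m₂) (θDegree m₂))
  (cong₂ ℕ._+_ (xDegree-split s) (θDegree-split s))

-- The θ's of `p` are those of `i` and `j` together, so crossings with `l` add up. With the same
-- additivity on the right, both bracketings of a triple product carry the exponent c(i,j) + c(i,l)
-- + c(j,l).
crossings-splitˡ : ∀ {i j p} → Split i j p → ∀ l → crossings p l ≡ crossings i l ℕ.+ crossings j l
crossings-splitˡ []      l  = refl
crossings-splitˡ (_ ∷ s) [] = refl
crossings-splitˡ (_∷_ {m₁ = i} {j} {p} _ s) ((_ , η) ∷ l) = begin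
  fermionic η ℕ.* θDegree p ℕ.+ crossings p l
    ≡⟨ cong₂ (λ x y → fermionic η ℕ.* x ℕ.+ y) (sym (θDegree-split s)) (crossings-splitˡ s l) ⟩
  fermionic η ℕ.* (θDegree i ℕ.+ θDegree j) ℕ.+ (crossings i l ℕ.+ crossings j l)
    ≡⟨ solve 5 (λ h a b c d → h :* (a :+ b) :+ (c :+ d) := h :* a :+ c :+ (h :* b :+ d)) refl
         (fermionic η) (θDegree i) (θDegree j) (crossings i l) (crossings j l) ⟩
  fermionic η ℕ.* θDegree i ℕ.+ crossings i l ℕ.+ (fermionic η ℕ.* θDegree j ℕ.+ crossings j l) ∎
  where open ℕSolver.+-*-Solver

crossings-splitʳ : ∀ {j l q} → Split j l q → ∀ i → crossings i q ≡ crossings i j ℕ.+ crossings i l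
crossings-splitʳ []      []      = refl
crossings-splitʳ []      (_ ∷ _) = refl
crossings-splitʳ (_ ∷ s) []      = refl
crossings-splitʳ (_∷_ {m₁ = j} {l} {q} (split {η₁ = η₁} {η₂} {η} _ p) s) (_ ∷ i) = begin
  fermionic η ℕ.* θDegree i ℕ.+ crossings i q
    ≡⟨ cong₂ (λ x y → x ℕ.* θDegree i ℕ.+ y) (sym p) (crossings-splitʳ s i) ⟩
  (fermionic η₁ ℕ.+ fermionic η₂) ℕ.* θDegree i ℕ.+ (crossings i j ℕ.+ crossings i l)
    ≡⟨ solve 5 (λ h k a c d → (h :+ k) :* a :+ (c :+ d) := h :* a :+ c :+ (k :* a :+ d)) refl
         (fermionic η₁) (fermionic η₂) (θDegree i) (crossings i j) (crossings i l) ⟩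
  fermionic η₁ ℕ.* θDegree i ℕ.+ crossings i j ℕ.+ (fermionic η₂ ℕ.* θDegree i ℕ.+ crossings i l) ∎
  where open ℕSolver.+-*-Solver

-- Every index in `n₁` exceeds every index in `m₂`, so each θ of `m₂` passes all those of `n₁`,
-- while the θ's of `n₂` pass none of `m₁`. The extra term is exactly the sign of the product on the
-- tensor square. The `Split` also guarantees that `m₁` and `m₂` have the same length, so that `n₁`
-- and `n₂` are aligned.
crossings-++ : ∀ {m₁ m₂ m} → Split m₁ m₂ m → ∀ n₁ n₂ →
  crossings (m₁ ++ n₁) (m₂ ++ n₂) ≡
    crossings m₁ m₂ ℕ.+ crossings n₁ n₂ ℕ.+ θDegree m₂ ℕ.* θDegree n₁
crossings-++ [] n₁ n₂ = sym (ℕₚ.+-identityʳ _)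
crossings-++ (_∷_ {m₁ = m₁} {m₂} (split {η₂ = η} _ _) s) n₁ n₂ = begin
  fermionic η ℕ.* θDegree (m₁ ++ n₁) ℕ.+ crossings (m₁ ++ n₁) (m₂ ++ n₂)
    ≡⟨ cong₂ (λ x y → fermionic η ℕ.* x ℕ.+ y) (θDegree-++ m₁ n₁) (crossings-++ s n₁ n₂) ⟩
  fermionic η ℕ.* (θDegree m₁ ℕ.+ θDegree n₁)
    ℕ.+ (crossings m₁ m₂ ℕ.+ crossings n₁ n₂ ℕ.+ θDegree m₂ ℕ.* θDegree n₁)
    ≡⟨ solve 6 (λ h a b c d e → h :* (a :+ b) :+ (c :+ d :+ e :* b) := h :* a :+ c :+ d :+ (h :+ e) :* b) refl
         (fermionic η) (θDegree m₁) (θDegree n₁) (crossings m₁ m₂) (crossings n₁ n₂) (θDegree m₂) ⟩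
  fermionic η ℕ.* θDegree m₁ ℕ.+ crossings m₁ m₂ ℕ.+ crossings n₁ n₂
    ℕ.+ (fermionic η ℕ.+ θDegree m₂) ℕ.* θDegree n₁ ∎
  where open ℕSolver.+-*-Solver

fermionic-disjoint : ∀ {η₁ η₂ η} → fermionic η₁ ℕ.+ fermionic η₂ ≡ fermionic η →
                     fermionic η₁ ℕ.* fermionic η₂ ≡ 0
fermionic-disjoint {false}               _ = refl
fermionic-disjoint {true} {false}        _ = refl
fermionic-disjoint {true} {true} {false} ()
fermionic-disjoint {true} {true} {true}  ()

-- Since `m₁` and `m₂` share no θ, a θ of one and a θ of the other have different indices, and the
-- pair is a crossing in exactly one of the two orders.
crossings-swap : ∀ {m₁ m₂ m} → Split m₁ m₂ m →
  crossings m₁ m₂ ℕ.+ crossings m₂ m₁ ≡ θDegree m₁ ℕ.* θDegree m₂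
crossings-swap [] = refl
crossings-swap (_∷_ {m₁ = m₁} {m₂} (split {η₁ = η₁} {η₂} _ p) s) = begin
  h₂ ℕ.* t₁ ℕ.+ c₁ ℕ.+ (h₁ ℕ.* t₂ ℕ.+ c₂)
    ≡⟨ solve 6 (λ h₁ h₂ t₁ t₂ c₁ c₂ → h₂ :* t₁ :+ c₁ :+ (h₁ :* t₂ :+ c₂) :=
         h₂ :* t₁ :+ h₁ :* t₂ :+ (c₁ :+ c₂)) refl h₁ h₂ t₁ t₂ c₁ c₂ ⟩
  h₂ ℕ.* t₁ ℕ.+ h₁ ℕ.* t₂ ℕ.+ (c₁ ℕ.+ c₂)
    -- The product `h₁ * h₂` is 0; adding it completes the expansion of (h₁ + t₁)(h₂ + t₂).
    ≡⟨ cong₂ ℕ._+_ (cong (ℕ._+ (h₂ ℕ.* t₁ ℕ.+ h₁ ℕ.* t₂)) (sym (fermionic-disjoint {η₁} {η₂} p))) (crossings-swap s) ⟩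
  h₁ ℕ.* h₂ ℕ.+ (h₂ ℕ.* t₁ ℕ.+ h₁ ℕ.* t₂) ℕ.+ t₁ ℕ.* t₂
    ≡⟨ solve 4 (λ h₁ h₂ t₁ t₂ → h₁ :* h₂ :+ (h₂ :* t₁ :+ h₁ :* t₂) :+ t₁ :* t₂ :=
         (h₁ :+ t₁) :* (h₂ :+ t₂)) refl h₁ h₂ t₁ t₂ ⟩
  (h₁ ℕ.+ t₁) ℕ.* (h₂ ℕ.+ t₂) ∎
  where
  open ℕSolver.+-*-Solver
  h₁ = fermionic η₁
  h₂ = fermionic η₂
  t₁ = θDegree m₁
  t₂ = θDegree m₂
  c₁ = crossings m₁ m₂
  c₂ = crossings m₂ m₁

crossings-θ≡0 : ∀ m n → θDegree m ≡ 0 → crossings m n ≡ 0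
crossings-θ≡0 []                  n             p = refl
crossings-θ≡0 (_ ∷ m)             []            p = refl
crossings-θ≡0 ((a , false) ∷ m)   ((_ , η) ∷ n) p =
  cong₂ ℕ._+_ (trans (cong (fermionic η ℕ.*_) p) (ℕₚ.*-zeroʳ (fermionic η))) (crossings-θ≡0 m n p)

crossings-θʳ≡0 : ∀ m n → θDegree n ≡ 0 → crossings m n ≡ 0
crossings-θʳ≡0 []      n                 p = refl
crossings-θʳ≡0 (_ ∷ m) []                p = refl
crossings-θʳ≡0 (_ ∷ m) ((_ , false) ∷ n) p = crossings-θʳ≡0 m n p

opaque
  unfolding splitSum

  product-splitSum : ∀ f g m →
    product f g m ≡ splitSum m (λ m₁ m₂ → sign (crossings m₁ m₂) * (f m₁ * g m₂))
  product-splitSum f g m = refl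

splitSum-sandwichˡ : ∀ m F a b →
  a * (splitSum m F * b) ≡ splitSum m (λ i j → a * (F i j * b))
splitSum-sandwichˡ m F a b = trans
  (trans (cong (a *_) (ℚₚ.*-comm _ b)) (sym (ℚₚ.*-assoc a b _)))
  (trans (sym (splitSum-* m (a * b) F))
    (splitSum-cong m (λ i j _ → trans (ℚₚ.*-assoc a b _) (cong (a *_) (ℚₚ.*-comm b _)))))

splitSum-sandwichʳ : ∀ m F a b →
  a * (b * splitSum m F) ≡ splitSum m (λ i j → a * (b * F i j))
splitSum-sandwichʳ m F a b = trans (sym (ℚₚ.*-assoc a b _))
  (trans (sym (splitSum-* m (a * b) F)) (splitSum-cong m (λ i j _ → ℚₚ.*-assoc a b _)))

product-cong : ∀ {f f′ g g′} → (∀ m → f m ≡ f′ m) → (∀ m → g m ≡ g′ m) →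
               ∀ m → product f g m ≡ product f′ g′ m
product-cong {f} {f′} {g} {g′} p q m = begin
  product f g m    ≡⟨ product-splitSum f g m ⟩
  splitSum m _     ≡⟨ splitSum-cong m (λ m₁ m₂ _ → cong (sign (crossings m₁ m₂) *_) (cong₂ _*_ (p m₁) (q m₂))) ⟩
  splitSum m _     ≡⟨ product-splitSum f′ g′ m ⟨
  product f′ g′ m  ∎

product-assoc : ∀ f g h m → product (product f g) h m ≡ product f (product g h) m
product-assoc f g h m = begin
  product (product f g) h m
    ≡⟨ product-splitSum (product f g) h m ⟩
  splitSum m (λ p l → sign (crossings p l) * (product f g p * h l))
    ≡⟨ splitSum-cong m (λ p l _ → trans
         (cong (λ z → sign (crossings p l) * (z * h l)) (product-splitSum f g p))
         (trans (splitSum-sandwichˡ p (λ i j → c i j * (f i * g j)) (c p l) (h l)) (splitSum-cong p (λ i j s → left i j p l s)))) ⟩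
  splitSum m (λ p l → splitSum p (λ i j → F i j l))
    ≡⟨ splitSum-assoc m F ⟩
  splitSum m (λ i q → splitSum q (λ j l → F i j l))
    ≡⟨ splitSum-cong m (λ i q _ → trans
         (cong (λ z → sign (crossings i q) * (f i * z)) (product-splitSum g h q))
         (trans (splitSum-sandwichʳ q (λ j l → c j l * (g j * h l)) (c i q) (f i)) (splitSum-cong q (λ j l s → right i j l q s)))) ⟨
  splitSum m (λ i q → sign (crossings i q) * (f i * product g h q))
    ≡⟨ product-splitSum f (product g h) m ⟨
  product f (product g h) m ∎
  where
  open +-*-Solver
  c : Monomial → Monomial → ℚ
  c m₁ m₂ = sign (crossings m₁ m₂)
  F : Monomial → Monomial → Monomial → ℚ
  F i j l = (c i j * c i l * c j l) * (f i * g j * h l)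
  left : ∀ i j p l → Split i j p → c p l * (c i j * (f i * g j) * h l) ≡ F i j l
  left i j p l s = trans
    (cong (_* (c i j * (f i * g j) * h l))
      (trans (cong sign (crossings-splitˡ s l)) (sign-+ (crossings i l) (crossings j l))))
    (solve 6 (λ a b d x y z → a :* b :* (d :* (x :* y) :* z) := d :* a :* b :* (x :* y :* z)) refl
      (c i l) (c j l) (c i j) (f i) (g j) (h l))
  right : ∀ i j l q → Split j l q → c i q * (f i * (c j l * (g j * h l))) ≡ F i j l
  right i j l q s = trans
    (cong (_* (f i * (c j l * (g j * h l))))
      (trans (cong sign (crossings-splitʳ s i)) (sign-+ (crossings i j) (crossings i l))))
    (solve 6 (λ a b d x y z → a :* b :* (x :* (d :* (y :* z))) := a :* b :* d :* (x :* y :* z)) refl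
      (c i j) (c i l) (c j l) (f i) (g j) (h l))

module _ where
  open +-*-Solver

  product-+ˡ : ∀ f f′ g m → product (λ n → f n + f′ n) g m ≡ product f g m + product f′ g m
  product-+ˡ f f′ g m = begin
    product (λ n → f n + f′ n) g m   ≡⟨ product-splitSum (λ n → f n + f′ n) g m ⟩
    splitSum m _                     ≡⟨ splitSum-cong m (λ i j _ →
      solve 4 (λ s a b d → s :* ((a :+ b) :* d) := s :* (a :* d) :+ s :* (b :* d)) refl
        (sign (crossings i j)) (f i) (f′ i) (g j)) ⟩
    splitSum m _                     ≡⟨ splitSum-+ m _ _ ⟩
    splitSum m _ + splitSum m _      ≡⟨ cong₂ _+_ (product-splitSum f g m) (product-splitSum f′ g m) ⟨
    product f g m + product f′ g m   ∎

  product-+ʳ : ∀ f g g′ m → product f (λ n → g n + g′ n) m ≡ product f g m + product f g′ m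
  product-+ʳ f g g′ m = begin
    product f (λ n → g n + g′ n) m   ≡⟨ product-splitSum f (λ n → g n + g′ n) m ⟩
    splitSum m _                     ≡⟨ splitSum-cong m (λ i j _ →
      solve 4 (λ s a b d → s :* (d :* (a :+ b)) := s :* (d :* a) :+ s :* (d :* b)) refl
        (sign (crossings i j)) (g j) (g′ j) (f i)) ⟩
    splitSum m _                     ≡⟨ splitSum-+ m _ _ ⟩
    splitSum m _ + splitSum m _      ≡⟨ cong₂ _+_ (product-splitSum f g m) (product-splitSum f g′ m) ⟨
    product f g m + product f g′ m   ∎

  product-*ˡ : ∀ c f g m → product (λ n → c * f n) g m ≡ c * product f g m
  product-*ˡ c f g m = begin
    product (λ n → c * f n) g m   ≡⟨ product-splitSum (λ n → c * f n) g m ⟩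
    splitSum m _                  ≡⟨ splitSum-cong m (λ i j _ →
      solve 4 (λ s a x y → s :* (a :* x :* y) := a :* (s :* (x :* y))) refl
        (sign (crossings i j)) c (f i) (g j)) ⟩
    splitSum m _                  ≡⟨ splitSum-* m c _ ⟩
    c * splitSum m _              ≡⟨ cong (c *_) (product-splitSum f g m) ⟨
    c * product f g m             ∎

  product-*ʳ : ∀ c f g m → product f (λ n → c * g n) m ≡ c * product f g m
  product-*ʳ c f g m = begin
    product f (λ n → c * g n) m   ≡⟨ product-splitSum f (λ n → c * g n) m ⟩
    splitSum m _                  ≡⟨ splitSum-cong m (λ i j _ →
      solve 4 (λ s a x y → s :* (x :* (a :* y)) := a :* (s :* (x :* y))) refl
        (sign (crossings i j)) c (f i) (g j)) ⟩
    splitSum m _                  ≡⟨ splitSum-* m c _ ⟩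
    c * splitSum m _              ≡⟨ cong (c *_) (product-splitSum f g m) ⟨
    c * product f g m             ∎

product-zero : ∀ f g m → (∀ m₁ m₂ → Split m₁ m₂ m → f m₁ ≡ 0ℚ ⊎ g m₂ ≡ 0ℚ) → product f g m ≡ 0ℚ
product-zero f g m h = trans (product-splitSum f g m) (splitSum-zero m (λ m₁ m₂ s →
  trans (cong (sign (crossings m₁ m₂) *_)
      (case h m₁ m₂ s of λ
        { (inj₁ p) → trans (cong (_* g m₂) p) (ℚₚ.*-zeroˡ (g m₂))
        ; (inj₂ p) → trans (cong (f m₁ *_) p) (ℚₚ.*-zeroʳ (f m₁)) }))
    (ℚₚ.*-zeroʳ (sign (crossings m₁ m₂)))))

-- By `crossings-swap` the signs of a decomposition read in the two orders differ by the product of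
-- the two θ-degrees. That product is `j * k` unless one of the two coefficients vanishes, and then
-- both terms are zero.
product-comm : ∀ {j k f g} → (∀ m → θDegree m ≢ j → f m ≡ 0ℚ) → (∀ m → θDegree m ≢ k → g m ≡ 0ℚ) →
               ∀ m → product f g m ≡ sign (j ℕ.* k) * product g f m
product-comm {j} {k} {f} {g} p q m = begin
  product f g m
    ≡⟨ product-splitSum f g m ⟩
  splitSum m (λ m₁ m₂ → sign (crossings m₁ m₂) * (f m₁ * g m₂))
    ≡⟨ splitSum-cong m swapped ⟩
  splitSum m (λ m₁ m₂ → sign (j ℕ.* k) * (sign (crossings m₂ m₁) * (g m₂ * f m₁)))
    ≡⟨ splitSum-* m (sign (j ℕ.* k)) _ ⟩
  sign (j ℕ.* k) * splitSum m (λ m₁ m₂ → sign (crossings m₂ m₁) * (g m₂ * f m₁))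
    ≡⟨ cong (sign (j ℕ.* k) *_) (splitSum-swap m _) ⟩
  sign (j ℕ.* k) * splitSum m (λ m₁ m₂ → sign (crossings m₁ m₂) * (g m₁ * f m₂))
    ≡⟨ cong (sign (j ℕ.* k) *_) (product-splitSum g f m) ⟨
  sign (j ℕ.* k) * product g f m ∎
  where
  open +-*-Solver
  swapped : ∀ m₁ m₂ → Split m₁ m₂ m → sign (crossings m₁ m₂) * (f m₁ * g m₂) ≡
            sign (j ℕ.* k) * (sign (crossings m₂ m₁) * (g m₂ * f m₁))
  swapped m₁ m₂ s with θDegree m₁ ℕₚ.≟ j | θDegree m₂ ℕₚ.≟ k
  ... | no ≢j    | _        = trans (cong (λ z → sign (crossings m₁ m₂) * (z * g m₂)) (p m₁ ≢j))
    (trans (solve 4 (λ a b c d → a :* (con 0ℚ :* b) := c :* (d :* (b :* con 0ℚ))) refl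
        (sign (crossings m₁ m₂)) (g m₂) (sign (j ℕ.* k)) (sign (crossings m₂ m₁)))
      (sym (cong (λ z → sign (j ℕ.* k) * (sign (crossings m₂ m₁) * (g m₂ * z))) (p m₁ ≢j))))
  ... | yes _    | no ≢k    = trans (cong (λ z → sign (crossings m₁ m₂) * (f m₁ * z)) (q m₂ ≢k))
    (trans (solve 4 (λ a b c d → a :* (b :* con 0ℚ) := c :* (d :* (con 0ℚ :* b))) refl
        (sign (crossings m₁ m₂)) (f m₁) (sign (j ℕ.* k)) (sign (crossings m₂ m₁)))
      (sym (cong (λ z → sign (j ℕ.* k) * (sign (crossings m₂ m₁) * (z * f m₁))) (q m₂ ≢k))))
  ... | yes refl | yes refl = begin
    sign c₁ * (f m₁ * g m₂)
      ≡⟨ cong (_* (f m₁ * g m₂)) (sign-cancel c₁ c₂) ⟨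
    sign (c₁ ℕ.+ (c₂ ℕ.+ c₂)) * (f m₁ * g m₂)
      ≡⟨ cong (λ z → sign z * (f m₁ * g m₂)) (ℕₚ.+-assoc c₁ c₂ c₂) ⟨
    sign (c₁ ℕ.+ c₂ ℕ.+ c₂) * (f m₁ * g m₂)
      ≡⟨ cong (λ z → sign (z ℕ.+ c₂) * (f m₁ * g m₂)) (crossings-swap s) ⟩
    sign (j ℕ.* k ℕ.+ c₂) * (f m₁ * g m₂)
      ≡⟨ cong (_* (f m₁ * g m₂)) (sign-+ (j ℕ.* k) c₂) ⟩
    sign (j ℕ.* k) * sign c₂ * (f m₁ * g m₂)
      ≡⟨ solve 4 (λ a b x y → a :* b :* (x :* y) := a :* (b :* (y :* x))) refl
           (sign (j ℕ.* k)) (sign c₂) (f m₁) (g m₂) ⟩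
    sign (j ℕ.* k) * (sign c₂ * (g m₂ * f m₁)) ∎
    where
    c₁ = crossings m₁ m₂
    c₂ = crossings m₂ m₁

one-zero : ∀ m → degree m ≡ 0 → one m ≡ 1ℚ
one-zero m p = cong (λ d → if d ℕ.≡ᵇ 0 then 1ℚ else 0ℚ) p

one-≢0 : ∀ m → degree m ≢ 0 → one m ≡ 0ℚ
one-≢0 m p = go (degree m) p
  where
  go : ∀ d → d ≢ 0 → (if d ℕ.≡ᵇ 0 then 1ℚ else 0ℚ) ≡ 0ℚ
  go zero    p = contradiction refl p
  go (suc d) p = refl

trivials : Monomial → Monomial
trivials = map (λ _ → trivial)

θDegree-trivials : ∀ m → θDegree (trivials m) ≡ 0
θDegree-trivials []      = refl
θDegree-trivials (_ ∷ m) = θDegree-trivials m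

natSum-head : ∀ a (G : ℕ → ℕ → ℚ) → (∀ i j → G (suc i) j ≡ 0ℚ) → natSum a G ≡ G 0 a
natSum-head zero    G h = natSum-zero G
natSum-head (suc a) G h = begin
  natSum (suc a) G                          ≡⟨ natSum-suc a G ⟩
  G 0 (suc a) + natSum a (λ i → G (suc i))  ≡⟨ cong (G 0 (suc a) +_) (natSum-cong a (λ i j _ → h i j)) ⟩
  G 0 (suc a) + natSum a (λ i j → 0ℚ)       ≡⟨ cong (G 0 (suc a) +_) (trans (natSum-upTo a _) (∑-0 _)) ⟩
  G 0 (suc a) + 0ℚ                          ≡⟨ ℚₚ.+-identityʳ _ ⟩
  G 0 (suc a)                               ∎

expSum-head : ∀ e (F : Exponent → Exponent → ℚ) → (∀ e₁ e₂ → e₁ ≢ trivial → F e₁ e₂ ≡ 0ℚ) →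
              expSum e F ≡ F trivial e
expSum-head (a , η) F h = trans (expSum-natSum a η F)
  (trans (natSum-head a _ (λ i j → trans (boolSum-cong η (λ η₁ η₂ _ → h (suc i , η₁) (j , η₂) λ ())) (boolSum-0 η)))
    (head η))
  where
  boolSum-0 : ∀ η → boolSum η (λ _ _ → 0ℚ) ≡ 0ℚ
  boolSum-0 η = trans (boolSum-splitη η _) (∑-0 (splitη η))
  head : ∀ η → boolSum η (λ η₁ η₂ → F (0 , η₁) (a , η₂)) ≡ F trivial (a , η)
  head false = boolSum-false _
  head true  = begin
    boolSum true G                   ≡⟨ boolSum-splitη true G ⟩
    ∑ (splitη true) _                ≡⟨ trans (∑-∷ _ _ _) (cong (G true false +_) (trans (∑-∷ _ _ _) (cong (G false true +_) (∑-[] _)))) ⟩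
    G true false + (G false true + 0ℚ) ≡⟨ cong (_+ (G false true + 0ℚ)) (h (0 , true) (a , false) λ ()) ⟩
    0ℚ + (G false true + 0ℚ)         ≡⟨ ℚₚ.+-identityˡ _ ⟩
    G false true + 0ℚ                ≡⟨ ℚₚ.+-identityʳ _ ⟩
    G false true                     ∎
    where
    G : Bool → Bool → ℚ
    G η₁ η₂ = F (0 , η₁) (a , η₂)

degree-∷≢0 : ∀ {e} m → e ≢ trivial → degree (e ∷ m) ≢ 0
degree-∷≢0 {zero , false}  m p _ = p refl
degree-∷≢0 {zero , true}   m p q with () ← trans (sym (ℕₚ.+-suc (xDegree m) (θDegree m))) q

-- The factors of a decomposition are as long as `m`, so the constant factor that survives appears
-- as `trivials m` and not as the empty list.
splitSum-head : ∀ m (F : Monomial → Monomial → ℚ) →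
  (∀ m₁ m₂ → degree m₁ ≢ 0 → F m₁ m₂ ≡ 0ℚ) → splitSum m F ≡ F (trivials m) m
splitSum-head []      F h = splitSum-[] F
splitSum-head (e ∷ m) F h = begin
  splitSum (e ∷ m) F
    ≡⟨ splitSum-∷ e m F ⟩
  expSum e (λ e₁ e₂ → splitSum m (λ m₁ m₂ → F (e₁ ∷ m₁) (e₂ ∷ m₂)))
    ≡⟨ expSum-head e _ (λ e₁ e₂ p → splitSum-zero m (λ m₁ m₂ _ → h (e₁ ∷ m₁) (e₂ ∷ m₂) (degree-∷≢0 m₁ p))) ⟩
  splitSum m (λ m₁ m₂ → F (trivial ∷ m₁) (e ∷ m₂))
    ≡⟨ splitSum-head m _ (λ m₁ m₂ → h (trivial ∷ m₁) (e ∷ m₂)) ⟩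
  F (trivial ∷ trivials m) (e ∷ m) ∎

degree-trivials : ∀ m → degree (trivials m) ≡ 0
degree-trivials []      = refl
degree-trivials (_ ∷ m) = degree-trivials m

module _ where
  open +-*-Solver

  product-identityˡ : ∀ f m → product one f m ≡ f m
  product-identityˡ f m = begin
    product one f m
      ≡⟨ product-splitSum one f m ⟩
    splitSum m (λ m₁ m₂ → sign (crossings m₁ m₂) * (one m₁ * f m₂))
      ≡⟨ splitSum-head m _ (λ m₁ m₂ p → trans (cong (λ z → sign (crossings m₁ m₂) * (z * f m₂)) (one-≢0 m₁ p))
           (solve 2 (λ a b → a :* (con 0ℚ :* b) := con 0ℚ) refl (sign (crossings m₁ m₂)) (f m₂))) ⟩
    sign (crossings (trivials m) m) * (one (trivials m) * f m)
      ≡⟨ cong₂ (λ x y → sign x * (y * f m)) (crossings-θ≡0 (trivials m) m (θDegree-trivials m))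
           (one-zero (trivials m) (degree-trivials m)) ⟩
    1ℚ * (1ℚ * f m)
      ≡⟨ solve 1 (λ a → con 1ℚ :* (con 1ℚ :* a) := a) refl (f m) ⟩
    f m ∎

  product-identityʳ : ∀ f m → product f one m ≡ f m
  product-identityʳ f m = begin
    product f one m
      ≡⟨ product-splitSum f one m ⟩
    splitSum m (λ m₁ m₂ → sign (crossings m₁ m₂) * (f m₁ * one m₂))
      ≡⟨ splitSum-swap m _ ⟩
    splitSum m (λ m₂ m₁ → sign (crossings m₁ m₂) * (f m₁ * one m₂))
      ≡⟨ splitSum-head m _ (λ m₂ m₁ p → trans (cong (λ z → sign (crossings m₁ m₂) * (f m₁ * z)) (one-≢0 m₂ p))
           (solve 2 (λ a b → a :* (b :* con 0ℚ) := con 0ℚ) refl (sign (crossings m₁ m₂)) (f m₁))) ⟩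
    sign (crossings m (trivials m)) * (f m * one (trivials m))
      ≡⟨ cong₂ (λ x y → sign x * (f m * y)) (crossings-θʳ≡0 m (trivials m) (θDegree-trivials m))
           (one-zero (trivials m) (degree-trivials m)) ⟩
    1ℚ * (f m * 1ℚ)
      ≡⟨ solve 1 (λ a → con 1ℚ :* (a :* con 1ℚ) := a) refl (f m) ⟩
    f m ∎

product-++ : ∀ f g m n → product f g (m ++ n) ≡
  splitSum m (λ m₁ m₂ → splitSum n (λ n₁ n₂ →
    sign (crossings m₁ m₂) * sign (crossings n₁ n₂) * sign (θDegree m₂ ℕ.* θDegree n₁)
      * (f (m₁ ++ n₁) * g (m₂ ++ n₂))))
product-++ f g m n = trans (product-splitSum f g (m ++ n)) (trans (splitSum-++ m n _)
  (splitSum-cong m λ m₁ m₂ s → splitSum-cong n λ n₁ n₂ _ →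
    cong (_* (f (m₁ ++ n₁) * g (m₂ ++ n₂)))
      (trans (cong sign (crossings-++ s n₁ n₂))
        (trans (sign-+ (crossings m₁ m₂ ℕ.+ crossings n₁ n₂) _)
          (cong (_* sign (θDegree m₂ ℕ.* θDegree n₁)) (sign-+ (crossings m₁ m₂) (crossings n₁ n₂)))))))

-- The local form of quasisymmetry, to which it is equivalent; it also implies `WellDefined`.
-- Changing one entry at a time suits sums over decompositions better than comparing compositions.
TrivialInvariant : Coefficients → Set
TrivialInvariant f = ∀ m n → f (m ++ trivial ∷ n) ≡ f (m ++ n)

-- A trivial entry splits only into two trivial entries. These carry no θ, so they leave the signs
-- unchanged and can be deleted in both factors.
product-trivialInvariant : ∀ {f g} → TrivialInvariant f → TrivialInvariant g →
                           TrivialInvariant (product f g)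
product-trivialInvariant {f} {g} p q m n = begin
  product f g (m ++ trivial ∷ n)
    ≡⟨ product-++ f g m (trivial ∷ n) ⟩
  splitSum m (λ m₁ m₂ → splitSum (trivial ∷ n) (λ n₁ n₂ → F m₁ m₂ n₁ n₂ (n₁ , n₂)))
    ≡⟨ splitSum-cong m (λ m₁ m₂ _ → trans (splitSum-∷ trivial n _) (trans (expSum-trivial _)
         (splitSum-cong n λ n₁ n₂ _ →
           cong (sign (crossings m₁ m₂) * sign (crossings n₁ n₂) * sign (θDegree m₂ ℕ.* θDegree n₁) *_)
             (cong₂ _*_ (p m₁ n₁) (q m₂ n₂))))) ⟩
  splitSum m (λ m₁ m₂ → splitSum n (λ n₁ n₂ → F m₁ m₂ n₁ n₂ (n₁ , n₂)))
    ≡⟨ product-++ f g m n ⟨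
  product f g (m ++ n) ∎
  where
  F : (m₁ m₂ n₁ n₂ : Monomial) → Monomial × Monomial → ℚ
  F m₁ m₂ n₁ n₂ (k₁ , k₂) =
    sign (crossings m₁ m₂) * sign (crossings n₁ n₂) * sign (θDegree m₂ ℕ.* θDegree n₁)
      * (f (m₁ ++ k₁) * g (m₂ ++ k₂))

product-bounded : ∀ {f g M N} → (∀ m → M ℕ.< degree m → f m ≡ 0ℚ) → (∀ m → N ℕ.< degree m → g m ≡ 0ℚ) →
                  ∀ m → M ℕ.+ N ℕ.< degree m → product f g m ≡ 0ℚ
product-bounded {f} {g} {M} {N} p q m M+N<d = product-zero f g m go
  where
  go : ∀ m₁ m₂ → Split m₁ m₂ m → f m₁ ≡ 0ℚ ⊎ g m₂ ≡ 0ℚ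
  go m₁ m₂ s with M ℕₚ.<? degree m₁ | N ℕₚ.<? degree m₂
  ... | yes l | _     = inj₁ (p m₁ l)
  ... | no _  | yes l = inj₂ (q m₂ l)
  ... | no k  | no l  = contradiction (ℕₚ.<-≤-trans M+N<d (subst (ℕ._≤ M ℕ.+ N) (degree-split s)
    (ℕₚ.+-mono-≤ (ℕₚ.≮⇒≥ k) (ℕₚ.≮⇒≥ l)))) (ℕₚ.<-irrefl refl)

product-graded : (d : Monomial → ℕ) → (∀ {m₁ m₂ m} → Split m₁ m₂ m → d m₁ ℕ.+ d m₂ ≡ d m) →
  ∀ {f g j k} → (∀ m → d m ≢ j → f m ≡ 0ℚ) → (∀ m → d m ≢ k → g m ≡ 0ℚ) →
  ∀ m → d m ≢ j ℕ.+ k → product f g m ≡ 0ℚ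
product-graded d d-split {f} {g} {j} {k} p q m ≢j+k = product-zero f g m go
  where
  go : ∀ m₁ m₂ → Split m₁ m₂ m → f m₁ ≡ 0ℚ ⊎ g m₂ ≡ 0ℚ
  go m₁ m₂ s with d m₁ ℕₚ.≟ j | d m₂ ℕₚ.≟ k
  ... | no ≢j | _     = inj₁ (p m₁ ≢j)
  ... | yes _ | no ≢k = inj₂ (q m₂ ≢k)
  ... | yes refl | yes refl = contradiction (sym (d-split s)) ≢j+k

-- Linear maps and tensor products

-- IsLinear, wrapped in a record so that the two spaces can be inferred from it.

record Linear (U V : VectorSpace) (φ : ∣ U ∣ → ∣ V ∣) : Set where
  private
    module U = LeftModule U
    module V = LeftModule V
  open LeftModuleMorphisms U.rawLeftModule V.rawLeftModule
  field isLinear : IsLinear U V φ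
  open IsLeftModuleHomomorphism isLinear public
    using () renaming (⟦⟧-cong to φ-cong; +ᴹ-homo to φ-+; *ₗ-homo to φ-*; 0ᴹ-homo to φ-0)

open Linear public using (isLinear)

module _ {U V : VectorSpace} where
  private
    module U = LeftModule U
    module V = LeftModule V

  -- The laws for zero and negation come for free: scaling by 0 gives the first, and uniqueness of
  -- inverses then gives the second.
  mkLinear : {φ : ∣ U ∣ → ∣ V ∣} →
    (∀ {x y} → x U.≈ᴹ y → φ x V.≈ᴹ φ y) →
    (∀ x y → φ (x U.+ᴹ y) V.≈ᴹ (φ x V.+ᴹ φ y)) →
    (∀ c x → φ (c U.*ₗ x) V.≈ᴹ (c V.*ₗ φ x)) →
    Linear U V φ
  mkLinear {φ} φ-cong φ-+ φ-* = record { isLinear = record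
    { +ᴹ-isGroupHomomorphism = record
      { isMonoidHomomorphism = record
        { isMagmaHomomorphism = record
          { isRelHomomorphism = record { cong = φ-cong }
          ; homo = φ-+
          }
        ; ε-homo = φ-0
        }
      ; ⁻¹-homo = λ x → inverseˡ-unique (φ (U.-ᴹ x)) (φ x)
          (V.≈ᴹ-trans (V.≈ᴹ-sym (φ-+ (U.-ᴹ x) x)) (V.≈ᴹ-trans (φ-cong (U.-ᴹ‿inverseˡ x)) φ-0))
      }
    ; *ₗ-homo = φ-*
    } }
    where
    open AbelianGroupProperties V.+ᴹ-abelianGroup using (inverseˡ-unique)
    φ-0 : φ U.0ᴹ V.≈ᴹ V.0ᴹ
    φ-0 = V.≈ᴹ-trans (φ-cong (U.≈ᴹ-sym (U.*ₗ-zeroˡ U.0ᴹ)))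
            (V.≈ᴹ-trans (φ-* 0ℚ U.0ᴹ) (V.*ₗ-zeroˡ (φ U.0ᴹ)))

linear-id : ∀ {V} → Linear V V id
linear-id {V} = mkLinear id (λ _ _ → V.≈ᴹ-refl) (λ _ _ → V.≈ᴹ-refl)
  where module V = LeftModule V

linear-∘ : ∀ {U V W φ ψ} → Linear V W ψ → Linear U V φ → Linear U W (λ x → ψ (φ x))
linear-∘ {U} {V} {W} l k = mkLinear
  (λ p → ψ.φ-cong (φ.φ-cong p))
  (λ x y → W.≈ᴹ-trans (ψ.φ-cong (φ.φ-+ x y)) (ψ.φ-+ _ _))
  (λ c x → W.≈ᴹ-trans (ψ.φ-cong (φ.φ-* c x)) (ψ.φ-* c _))
  where
  module W = LeftModule W
  module ψ = Linear l
  module φ = Linear k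

record Bilinear (U V W : VectorSpace) (b : ∣ U ∣ → ∣ V ∣ → ∣ W ∣) : Set where
  field
    linearˡ : ∀ v → Linear U W (λ u → b u v)
    linearʳ : ∀ u → Linear V W (b u)

module _ {U V W : VectorSpace} {b : ∣ U ∣ → ∣ V ∣ → ∣ W ∣} (bilinear : Bilinear U V W b) where
  private
    module U = LeftModule U
    module V = LeftModule V
    module W = LeftModule W
    module L v = Linear (Bilinear.linearˡ bilinear v)
    module R u = Linear (Bilinear.linearʳ bilinear u)

  -- Only the five generators that mention `⊗` call on bilinearity; every other one is a module law
  -- of `W`.
  extend-cong : ∀ {s t} → Tensor._≈_ U V s t → extend U V W b s W.≈ᴹ extend U V W b t
  extend-cong Tensor.≈-refl              = W.≈ᴹ-refl
  extend-cong (Tensor.≈-sym p)           = W.≈ᴹ-sym (extend-cong p)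
  extend-cong (Tensor.≈-trans p q)       = W.≈ᴹ-trans (extend-cong p) (extend-cong q)
  extend-cong (Tensor.+-cong p q)        = W.+ᴹ-cong (extend-cong p) (extend-cong q)
  extend-cong (Tensor.+-assoc r s t)     = W.+ᴹ-assoc _ _ _
  extend-cong (Tensor.+-comm s t)        = W.+ᴹ-comm _ _
  extend-cong (Tensor.+-identityˡ t)     = W.+ᴹ-identityˡ _
  extend-cong (Tensor.·-cong p)          = W.*ₗ-cong refl (extend-cong p)
  extend-cong (Tensor.·-assoc c d t)     = W.*ₗ-assoc c d _
  extend-cong (Tensor.·-identity t)      = W.*ₗ-identityˡ _
  extend-cong (Tensor.·-zeroˡ t)         = W.*ₗ-zeroˡ _
  extend-cong (Tensor.·-zeroʳ c)         = W.*ₗ-zeroʳ c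
  extend-cong (Tensor.·-distribˡ c s t)  = W.*ₗ-distribˡ c _ _
  extend-cong (Tensor.·-distribʳ t c d)  = W.*ₗ-distribʳ _ c d
  extend-cong (Tensor.⊗-cong {u′ = u′} {v} p q) = W.≈ᴹ-trans (L.φ-cong v p) (R.φ-cong u′ q)
  extend-cong (Tensor.⊗-distribˡ u v v′) = R.φ-+ u v v′
  extend-cong (Tensor.⊗-distribʳ v u u′) = L.φ-+ v u u′
  extend-cong (Tensor.⊗-scaleˡ c u v)    = L.φ-* v c u
  extend-cong (Tensor.⊗-scaleʳ c u v)    = R.φ-* u c v

  extend-linear : Linear (U ⊠ V) W (extend U V W b)
  extend-linear = mkLinear extend-cong (λ _ _ → W.≈ᴹ-refl) (λ _ _ → W.≈ᴹ-refl)

⊗-bilinear : ∀ {U V} → Bilinear U V (U ⊠ V) _⊗_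
⊗-bilinear {U} {V} = record
  { linearˡ = λ v → mkLinear (λ p → Tensor.⊗-cong p V.≈ᴹ-refl) (λ u u′ → Tensor.⊗-distribʳ v u u′) (λ c u → Tensor.⊗-scaleˡ c u v)
  ; linearʳ = λ u → mkLinear (λ p → Tensor.⊗-cong U.≈ᴹ-refl p) (λ v v′ → Tensor.⊗-distribˡ u v v′) (λ c v → Tensor.⊗-scaleʳ c u v)
  }
  where
  module U = LeftModule U
  module V = LeftModule V

*ₗ-linear : ∀ {V} c → Linear V V (LeftModule._*ₗ_ V c)
*ₗ-linear {V} c = mkLinear (V.*ₗ-cong refl) (V.*ₗ-distribˡ c)
  (λ d x → V.≈ᴹ-trans (V.≈ᴹ-sym (V.*ₗ-assoc c d x))
    (V.≈ᴹ-trans (V.*ₗ-cong (ℚₚ.*-comm c d) V.≈ᴹ-refl) (V.*ₗ-assoc d c x)))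
  where module V = LeftModule V

*ₗ-linearˡ : ∀ {V} v → Linear ℚ¹ V (λ c → LeftModule._*ₗ_ V c v)
*ₗ-linearˡ {V} v = mkLinear (λ p → V.*ₗ-cong p V.≈ᴹ-refl) (λ c d → V.*ₗ-distribʳ v c d) (λ c d → V.*ₗ-assoc c d v)
  where module V = LeftModule V

0-linear : ∀ {U V} → Linear U V (λ _ → LeftModule.0ᴹ V)
0-linear {U} {V} = mkLinear (λ _ → V.≈ᴹ-refl) (λ _ _ → V.≈ᴹ-sym (V.+ᴹ-identityˡ V.0ᴹ)) (λ c _ → V.≈ᴹ-sym (V.*ₗ-zeroʳ c))
  where module V = LeftModule V

+ᴹ-linear : ∀ {U V φ ψ} → Linear U V φ → Linear U V ψ → Linear U V (λ x → LeftModule._+ᴹ_ V (φ x) (ψ x))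
+ᴹ-linear {U} {V} {φ} {ψ} l k = mkLinear
  (λ p → V.+ᴹ-cong (φ.φ-cong p) (ψ.φ-cong p))
  (λ x y → V.≈ᴹ-trans (V.+ᴹ-cong (φ.φ-+ x y) (ψ.φ-+ x y)) (+ᴹ-interchange (φ x) (φ y) (ψ x) (ψ y)))
  (λ c x → V.≈ᴹ-trans (V.+ᴹ-cong (φ.φ-* c x) (ψ.φ-* c x)) (V.≈ᴹ-sym (V.*ₗ-distribˡ c (φ x) (ψ x))))
  where
  module V = LeftModule V
  module φ = Linear l
  module ψ = Linear k
  open CommutativeSemigroupProperties (CommutativeMonoid.commutativeSemigroup V.+ᴹ-commutativeMonoid)
    using () renaming (interchange to +ᴹ-interchange)

bilinear-∘ : ∀ {U V U′ V′ W b φ ψ} → Bilinear U′ V′ W b → Linear U U′ φ → Linear V V′ ψ →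
             Bilinear U V W (λ u v → b (φ u) (ψ v))
bilinear-∘ {φ = φ} {ψ} β l k = record
  { linearˡ = λ v → linear-∘ (Bilinear.linearˡ β (ψ v)) l
  ; linearʳ = λ u → linear-∘ (Bilinear.linearʳ β (φ u)) k
  }

linear-bilinear : ∀ {U V W W′ b φ} → Linear W W′ φ → Bilinear U V W b →
                  Bilinear U V W′ (λ u v → φ (b u v))
linear-bilinear l β = record
  { linearˡ = λ v → linear-∘ l (Bilinear.linearˡ β v)
  ; linearʳ = λ u → linear-∘ l (Bilinear.linearʳ β u)
  }

bilinear-flip : ∀ {U V W b} → Bilinear U V W b → Bilinear V U W (flip b)
bilinear-flip β = record { linearˡ = Bilinear.linearʳ β ; linearʳ = Bilinear.linearˡ β }

bilinear-+ : ∀ {U V W b c} → Bilinear U V W b → Bilinear U V W c →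
             Bilinear U V W (λ u v → LeftModule._+ᴹ_ W (b u v) (c u v))
bilinear-+ β γ = record
  { linearˡ = λ v → +ᴹ-linear (Bilinear.linearˡ β v) (Bilinear.linearˡ γ v)
  ; linearʳ = λ u → +ᴹ-linear (Bilinear.linearʳ β u) (Bilinear.linearʳ γ u)
  }

*ₗ-bilinear : ∀ {V} → Bilinear ℚ¹ V V (LeftModule._*ₗ_ V)
*ₗ-bilinear = record { linearˡ = *ₗ-linearˡ ; linearʳ = *ₗ-linear }

tensorMap-linear : ∀ {U V U′ V′ φ ψ} → Linear U U′ φ → Linear V V′ ψ →
                   Linear (U ⊠ V) (U′ ⊠ V′) (tensorMap U V U′ V′ φ ψ)
tensorMap-linear l k = extend-linear (bilinear-∘ ⊗-bilinear l k)

-- Linearity in a parameter of the bilinear map, the tensor being fixed. It is what makes nested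
-- extensions, such as `associate` and `weighted`, linear in the outer argument.
extend-family-linear : ∀ {U V W X} (b : ∣ X ∣ → ∣ U ∣ → ∣ V ∣ → ∣ W ∣) →
  (∀ u v → Linear X W (λ x → b x u v)) → ∀ t → Linear X W (λ x → extend U V W (b x) t)
extend-family-linear b l (u ⊗ v) = l u v
extend-family-linear b l 0#      = 0-linear
extend-family-linear b l (s ⊕ t) = +ᴹ-linear (extend-family-linear b l s) (extend-family-linear b l t)
extend-family-linear b l (c · t) = linear-∘ (*ₗ-linear c) (extend-family-linear b l t)

associate-linear : ∀ {U V W} → Linear ((U ⊠ V) ⊠ W) (U ⊠ (V ⊠ W)) (associate U V W)
associate-linear {U} {V} {W} = extend-linear record
  { linearˡ = λ w → extend-linear (bilinear w)
  ; linearʳ = extend-family-linear (λ w u v → u ⊗ (v ⊗ w)) (λ u v →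
      linear-∘ (Bilinear.linearʳ ⊗-bilinear u) (Bilinear.linearʳ ⊗-bilinear v))
  }
  where
  bilinear : ∀ w → Bilinear U V (U ⊠ (V ⊠ W)) (λ u v → u ⊗ (v ⊗ w))
  bilinear w = bilinear-∘ ⊗-bilinear linear-id (Bilinear.linearˡ ⊗-bilinear w)

module _ {U V W : VectorSpace} where
  private module W = LeftModule W

  tensor-ext : ∀ {φ ψ} → Linear (U ⊠ V) W φ → Linear (U ⊠ V) W ψ →
               (∀ u v → φ (u ⊗ v) W.≈ᴹ ψ (u ⊗ v)) → ∀ t → φ t W.≈ᴹ ψ t
  tensor-ext {φ} {ψ} l k h = go
    where
    module φ = Linear l
    module ψ = Linear k
    go : ∀ t → φ t W.≈ᴹ ψ t
    go (u ⊗ v) = h u v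
    go 0#      = W.≈ᴹ-trans φ.φ-0 (W.≈ᴹ-sym ψ.φ-0)
    go (s ⊕ t) = W.≈ᴹ-trans (φ.φ-+ s t) (W.≈ᴹ-trans (W.+ᴹ-cong (go s) (go t)) (W.≈ᴹ-sym (ψ.φ-+ s t)))
    go (c · t) = W.≈ᴹ-trans (φ.φ-* c t) (W.≈ᴹ-trans (W.*ₗ-cong refl (go t)) (W.≈ᴹ-sym (ψ.φ-* c t)))

  extend-pointwise : ∀ {b c} → (∀ u v → b u v W.≈ᴹ c u v) → ∀ t → extend U V W b t W.≈ᴹ extend U V W c t
  extend-pointwise h (u ⊗ v) = h u v
  extend-pointwise h 0#      = W.≈ᴹ-refl
  extend-pointwise h (s ⊕ t) = W.+ᴹ-cong (extend-pointwise h s) (extend-pointwise h t)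
  extend-pointwise h (c · t) = W.*ₗ-cong refl (extend-pointwise h t)

linear-extend : ∀ {U V W X φ b} → Linear W X φ → ∀ t →
  LeftModule._≈ᴹ_ X (φ (extend U V W b t)) (extend U V X (λ u v → φ (b u v)) t)
linear-extend {X = X} l = go
  where
  module X = LeftModule X
  module φ = Linear l
  go : ∀ t → _
  go (u ⊗ v) = X.≈ᴹ-refl
  go 0#      = φ.φ-0
  go (s ⊕ t) = X.≈ᴹ-trans (φ.φ-+ _ _) (X.+ᴹ-cong (go s) (go t))
  go (c · t) = X.≈ᴹ-trans (φ.φ-* c _) (X.*ₗ-cong refl (go t))

extend-tensorMap : ∀ {U V U′ V′ W φ ψ} (b : ∣ U′ ∣ → ∣ V′ ∣ → ∣ W ∣) t →
  LeftModule._≈ᴹ_ W (extend U′ V′ W b (tensorMap U V U′ V′ φ ψ t)) (extend U V W (λ u v → b (φ u) (ψ v)) t)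
extend-tensorMap {W = W} b = go
  where
  module W = LeftModule W
  go : ∀ t → _
  go (u ⊗ v) = W.≈ᴹ-refl
  go 0#      = W.≈ᴹ-refl
  go (s ⊕ t) = W.+ᴹ-cong (go s) (go t)
  go (c · t) = W.*ₗ-cong refl (go t)

module _ (V : VectorSpace) where
  open LeftModule V

  ∑ᴹ : {A : Set} → List A → (A → ∣ V ∣) → ∣ V ∣
  ∑ᴹ xs F = foldr _+ᴹ_ 0ᴹ (map F xs)

module _ {V : VectorSpace} {A : Set} where
  open LeftModule V

  ∑ᴹ-cong : ∀ (xs : List A) {F G : A → ∣ V ∣} → (∀ x → F x ≈ᴹ G x) → ∑ᴹ V xs F ≈ᴹ ∑ᴹ V xs G
  ∑ᴹ-cong []       h = ≈ᴹ-refl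
  ∑ᴹ-cong (x ∷ xs) h = +ᴹ-cong (h x) (∑ᴹ-cong xs h)

  ∑ᴹ-zero : ∀ (xs : List A) {F : A → ∣ V ∣} → (∀ x → F x ≈ᴹ 0ᴹ) → ∑ᴹ V xs F ≈ᴹ 0ᴹ
  ∑ᴹ-zero []       h = ≈ᴹ-refl
  ∑ᴹ-zero (x ∷ xs) h = ≈ᴹ-trans (+ᴹ-cong (h x) (∑ᴹ-zero xs h)) (+ᴹ-identityˡ 0ᴹ)

∑ᴹ-linear : ∀ {V W : VectorSpace} {A : Set} (xs : List A) {F : A → ∣ V ∣ → ∣ W ∣} →
            (∀ x → Linear V W (F x)) → Linear V W (λ v → ∑ᴹ W xs (λ x → F x v))
∑ᴹ-linear []       l = 0-linear
∑ᴹ-linear (x ∷ xs) l = +ᴹ-linear (l x) (∑ᴹ-linear xs l)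

linear-∑ᴹ : ∀ {V W : VectorSpace} {A : Set} {φ} → Linear V W φ → ∀ (xs : List A) F →
            LeftModule._≈ᴹ_ W (φ (∑ᴹ V xs F)) (∑ᴹ W xs (λ x → φ (F x)))
linear-∑ᴹ {V} {W} l []       F = Linear.φ-0 l
linear-∑ᴹ {V} {W} l (x ∷ xs) F =
  W.≈ᴹ-trans (Linear.φ-+ l _ _) (W.+ᴹ-cong W.≈ᴹ-refl (linear-∑ᴹ l xs F))
  where module W = LeftModule W

-- The bialgebra structure on an admissible subspace

kronecker : ℕ → ℕ → ℚ
kronecker i j = if i ℕ.≡ᵇ j then 1ℚ else 0ℚ

kronecker-≡ : ∀ i → kronecker i i ≡ 1ℚ
kronecker-≡ zero    = refl
kronecker-≡ (suc i) = kronecker-≡ i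

kronecker-≢ : ∀ i j → i ≢ j → kronecker i j ≡ 0ℚ
kronecker-≢ zero    zero    p = contradiction refl p
kronecker-≢ zero    (suc j) p = refl
kronecker-≢ (suc i) zero    p = refl
kronecker-≢ (suc i) (suc j) p = kronecker-≢ i j (p ∘ cong suc)

sumTo : ℕ → (ℕ → ℚ) → ℚ
sumTo zero    h = 0ℚ
sumTo (suc n) h = h 0 + sumTo n (h ∘ suc)

sumTo-zero : ∀ n h → (∀ i → h i ≡ 0ℚ) → sumTo n h ≡ 0ℚ
sumTo-zero zero    h p = refl
sumTo-zero (suc n) h p = trans (cong₂ _+_ (p 0) (sumTo-zero n (h ∘ suc) (p ∘ suc))) (ℚₚ.+-identityˡ 0ℚ)

sumTo-single : ∀ n h k → k < n → (∀ i → i ≢ k → h i ≡ 0ℚ) → sumTo n h ≡ h k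
sumTo-single (suc n) h zero    _         p =
  trans (cong (h 0 +_) (sumTo-zero n (h ∘ suc) (λ i → p (suc i) λ ()))) (ℚₚ.+-identityʳ (h 0))
sumTo-single (suc n) h (suc k) (s≤s k<n) p =
  trans (cong₂ _+_ (p 0 λ ()) (sumTo-single n (h ∘ suc) k k<n (λ i q → p (suc i) (q ∘ ℕₚ.suc-injective))))
    (ℚₚ.+-identityˡ (h (suc k)))

-- For s, t = ±1 the polynomial ½(1 + s + t - st) is -1 exactly when s = t = -1. Each of its
-- monomials separates `j` from `k`.
sign-* : ∀ j k → sign (j ℕ.* k) ≡ ½ * (1ℚ + sign j + (sign k + - 1ℚ * (sign j * sign k)))
sign-* zero    k = solve 1 (λ s → con 1ℚ := con ½ :* (con 1ℚ :+ con 1ℚ :+ (s :+ con (- 1ℚ) :* (con 1ℚ :* s)))) refl (sign k)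
  where open +-*-Solver
sign-* (suc j) k = begin
  sign (k ℕ.+ j ℕ.* k)
    ≡⟨ sign-+ k (j ℕ.* k) ⟩
  t * sign (j ℕ.* k)
    ≡⟨ cong (t *_) (sign-* j k) ⟩
  t * (½ * (1ℚ + s + (t + - 1ℚ * (s * t))))
    -- The square `t * t` is isolated so that it can be replaced by 1, which the solver cannot know.
    ≡⟨ solve 2 (λ s t → t :* (con ½ :* (con 1ℚ :+ s :+ (t :+ con (- 1ℚ) :* (s :* t)))) :=
         con ½ :* (t :* t :* (con 1ℚ :+ (:- s)) :+ (t :+ s :* t))) refl s t ⟩
  ½ * (t * t * (1ℚ + - s) + (t + s * t))
    ≡⟨ cong (λ z → ½ * (z * (1ℚ + - s) + (t + s * t))) (sign-square k) ⟩
  ½ * (1ℚ * (1ℚ + - s) + (t + s * t))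
    ≡⟨ solve 2 (λ s t → con ½ :* (con 1ℚ :* (con 1ℚ :+ (:- s)) :+ (t :+ s :* t)) :=
         con ½ :* (con 1ℚ :+ (:- s) :+ (t :+ con (- 1ℚ) :* ((:- s) :* t)))) refl s t ⟩
  ½ * (1ℚ + - s + (t + - 1ℚ * (- s * t))) ∎
  where
  open +-*-Solver
  s = sign j
  t = sign k

trivialInvariant-degree0 : ∀ {f} → TrivialInvariant f → ∀ m → degree m ≡ 0 → f m ≡ f []
trivialInvariant-degree0 h []      p = refl
trivialInvariant-degree0 h ((zero , false) ∷ m) p = trans (h [] m) (trivialInvariant-degree0 h m p)
trivialInvariant-degree0 h ((zero , true)  ∷ m) p = contradiction p (degree-∷≢0 {0 , true} m λ ())

splitSum-linear : ∀ {V} m {F : Monomial → Monomial → ∣ V ∣ → ℚ} → (∀ i j → Linear V ℚ¹ (F i j)) →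
                  Linear V ℚ¹ (λ v → splitSum m (λ i j → F i j v))
splitSum-linear m {F} l = mkLinear
  (λ p → splitSum-cong m λ i j _ → Linear.φ-cong (l i j) p)
  (λ x y → trans (splitSum-cong m λ i j _ → Linear.φ-+ (l i j) x y) (splitSum-+ m (λ i j → F i j x) (λ i j → F i j y)))
  (λ c x → trans (splitSum-cong m λ i j _ → Linear.φ-* (l i j) c x) (splitSum-* m c (λ i j → F i j x)))

splitSum-*-splitSum : ∀ m n F G →
  splitSum m F * splitSum n G ≡ splitSum m (λ m₁ m₂ → splitSum n (λ n₁ n₂ → F m₁ m₂ * G n₁ n₂))
splitSum-*-splitSum m n F G = begin
  splitSum m F * splitSum n G                     ≡⟨ ℚₚ.*-comm (splitSum m F) (splitSum n G) ⟩
  splitSum n G * splitSum m F                     ≡⟨ splitSum-* m (splitSum n G) F ⟨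
  splitSum m (λ m₁ m₂ → splitSum n G * F m₁ m₂)   ≡⟨ splitSum-cong m (λ m₁ m₂ _ → trans
    (ℚₚ.*-comm (splitSum n G) (F m₁ m₂)) (sym (splitSum-* n (F m₁ m₂) G))) ⟩
  splitSum m (λ m₁ m₂ → splitSum n (λ n₁ n₂ → F m₁ m₂ * G n₁ n₂)) ∎

*-linearʳ : ∀ c → Linear ℚ¹ ℚ¹ (c *_)
*-linearʳ c = *ₗ-linear {ℚ¹} c

*-linearˡ : ∀ c → Linear ℚ¹ ℚ¹ (_* c)
*-linearˡ c = *ₗ-linearˡ {ℚ¹} c

-- By expansion, the coordinates of f in the basis are its own coefficients, so
-- that an equality of tensors can be tested on pairs of coefficients.

record Admissible (P : Subspace) : Set₁ where
  open Subspace P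
  field
    bounded-member          : ∀ {f} → Member f → Bounded f
    trivialInvariant-member : ∀ {f} → Member f → TrivialInvariant f
    one-member     : Member one
    product-member : ∀ {f g} → Member f → Member g → Member (product f g)
    weight-member  : ∀ {f} (w : ℕ → ℕ → ℚ) → Member f → Member (λ m → w (xDegree m) (θDegree m) * f m)
    prefix-member  : ∀ {f} n → Member f → Member (λ m → f (m ++ n))
    suffix-member  : ∀ {f} m → Member f → Member (λ n → f (m ++ n))
    words : ℕ → List Monomial
    basis : Monomial → Series P
    basis-degree : ∀ p m → degree m ≢ degree p → coeff (basis p) m ≡ 0ℚ
    expansion : ∀ {f} → Member f → ∀ N → (∀ m → N < degree m → f m ≡ 0ℚ) →
                ∀ m → f m ≡ ∑ (words N) (λ p → f p * coeff (basis p) m)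

module Coalgebra {P : Subspace} (A : Admissible P) where
  open Admissible A
  open Series using (member)

  V : VectorSpace
  V = space P

  V² : VectorSpace
  V² = V ⊠ V

  module V = LeftModule V
  module V² = LeftModule V²

  bound : ∣ V ∣ → ℕ
  bound f = proj₁ (bounded-member (member f))

  vanishing : ∀ f m → bound f < degree m → coeff f m ≡ 0ℚ
  vanishing f = proj₂ (bounded-member (member f))

  coeff-linear : ∀ m → Linear V ℚ¹ (λ f → coeff f m)
  coeff-linear m = mkLinear (λ p → p m) (λ _ _ → refl) (λ _ _ → refl)

  coeff-∑ᴹ : ∀ {A : Set} (xs : List A) F m → coeff (∑ᴹ V xs F) m ≡ ∑ xs (λ x → coeff (F x) m)
  coeff-∑ᴹ xs F m = trans (linear-∑ᴹ (coeff-linear m) xs F) (sym (∑-foldr xs _))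

  series-expansion : ∀ f N → bound f ≤ N → f V.≈ᴹ ∑ᴹ V (words N) (λ p → coeff f p V.*ₗ basis p)
  series-expansion f N b≤N m = trans
    (expansion (member f) N (λ k N<d → vanishing f k (ℕₚ.≤-<-trans b≤N N<d)) m)
    (sym (coeff-∑ᴹ (words N) _ m))

  -- Contraction of the first tensor factor with the functional "coefficient of `p`". The second
  -- factor is an arbitrary space so that slices can be iterated on `V ⊠ (V ⊠ V)`.
  slice : ∀ W → Monomial → ∣ V ⊠ W ∣ → ∣ W ∣
  slice W p = extend V W W (λ u w → LeftModule._*ₗ_ W (coeff u p) w)

  slice-linear : ∀ {W} p → Linear (V ⊠ W) W (slice W p)
  slice-linear p = extend-linear (bilinear-∘ *ₗ-bilinear (coeff-linear p) linear-id)

  module _ {W : VectorSpace} where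
    private
      module W = LeftModule W
      module V⊠W = LeftModule (V ⊠ W)

    slices : ℕ → ∣ V ⊠ W ∣ → ∣ V ⊠ W ∣
    slices N t = ∑ᴹ (V ⊠ W) (words N) (λ p → basis p ⊗ slice W p t)

    slices-linear : ∀ N → Linear (V ⊠ W) (V ⊠ W) (slices N)
    slices-linear N = ∑ᴹ-linear (words N) (λ p →
      linear-∘ (Bilinear.linearʳ ⊗-bilinear (basis p)) (slice-linear p))

    -- Each pure tensor has its own threshold, and the parts of a sum must be expanded over the same
    -- words. Hence the expansion is claimed for all `M` from some `N` on.
    tensor-expansion : ∀ t → Σ[ N ∈ ℕ ] ∀ M → N ≤ M → t V⊠W.≈ᴹ slices M t
    tensor-expansion (u ⊗ w) = bound u , λ M b≤M →
      V⊠W.≈ᴹ-trans (Tensor.⊗-cong (series-expansion u M b≤M) W.≈ᴹ-refl)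
        (V⊠W.≈ᴹ-trans (linear-∑ᴹ (Bilinear.linearˡ ⊗-bilinear w) (words M) _)
          (∑ᴹ-cong {V ⊠ W} (words M) λ p → V⊠W.≈ᴹ-trans (Tensor.⊗-scaleˡ (coeff u p) (basis p) w)
            (V⊠W.≈ᴹ-sym (Tensor.⊗-scaleʳ (coeff u p) (basis p) w))))
    tensor-expansion 0#      = 0 , λ M _ → V⊠W.≈ᴹ-sym (Linear.φ-0 (slices-linear M))
    tensor-expansion (s ⊕ t) with tensor-expansion s | tensor-expansion t
    ... | N , p | N′ , p′ = N ⊔ N′ , λ M N≤M → V⊠W.≈ᴹ-trans
      (Tensor.+-cong (p M (ℕₚ.m⊔n≤o⇒m≤o N N′ N≤M)) (p′ M (ℕₚ.m⊔n≤o⇒n≤o N N′ N≤M)))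
      (V⊠W.≈ᴹ-sym (Linear.φ-+ (slices-linear M) s t))
    tensor-expansion (c · t) with tensor-expansion t
    ... | N , p = N , λ M N≤M → V⊠W.≈ᴹ-trans (Tensor.·-cong (p M N≤M))
      (V⊠W.≈ᴹ-sym (Linear.φ-* (slices-linear M) c t))

    slice-injective : ∀ s t → (∀ p → slice W p s W.≈ᴹ slice W p t) → s V⊠W.≈ᴹ t
    slice-injective s t h with tensor-expansion s | tensor-expansion t
    ... | N , p | N′ , p′ =
      V⊠W.≈ᴹ-trans (p (N ⊔ N′) (ℕₚ.m≤m⊔n N N′))
        (V⊠W.≈ᴹ-trans (∑ᴹ-cong {V ⊠ W} (words (N ⊔ N′)) (λ q → Tensor.⊗-cong (V.≈ᴹ-refl {basis q}) (h q)))
          (V⊠W.≈ᴹ-sym (p′ (N ⊔ N′) (ℕₚ.m≤n⊔m N N′))))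

  twoSets-slice : ∀ t m n → twoSets t m n ≡ coeff (slice V m t) n
  twoSets-slice (f ⊗ g) m n = refl
  twoSets-slice 0#      m n = refl
  twoSets-slice (s ⊕ t) m n = cong₂ _+_ (twoSets-slice s m n) (twoSets-slice t m n)
  twoSets-slice (c · t) m n = cong (c *_) (twoSets-slice t m n)

  twoSets-injective : ∀ s t → (∀ m n → twoSets s m n ≡ twoSets t m n) → s V².≈ᴹ t
  twoSets-injective s t h = slice-injective s t λ m n →
    trans (sym (twoSets-slice s m n)) (trans (h m n) (twoSets-slice t m n))

  twoSets-linear : ∀ m n → Linear V² ℚ¹ (λ t → twoSets t m n)
  twoSets-linear m n = mkLinear
    (λ {s} {t} p → trans (twoSets-slice s m n)
      (trans (Linear.φ-cong (slice-linear m) p n) (sym (twoSets-slice t m n))))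
    (λ _ _ → refl) (λ _ _ → refl)

  suffix : ∣ V ∣ → Monomial → ∣ V ∣
  suffix f m = (λ n → coeff f (m ++ n)) , suffix-member m (member f)

  opaque

    Δ : ∣ V ∣ → ∣ V² ∣
    Δ f = ∑ᴹ V² (words (bound f)) (λ p → basis p ⊗ suffix f p)

    Δ-suffix : ∀ f → Δ f ≡ ∑ᴹ V² (words (bound f)) (λ p → basis p ⊗ suffix f p)
    Δ-suffix f = refl

    Δ-union : ∀ f m n → twoSets (Δ f) m n ≡ coeff f (m ++ n)
    Δ-union f m n = begin
      twoSets (Δ f) m n
        ≡⟨ linear-∑ᴹ (twoSets-linear m n) (words (bound f)) _ ⟩
      ∑ᴹ ℚ¹ (words (bound f)) (λ p → coeff (basis p) m * coeff f (p ++ n))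
        ≡⟨ ∑-foldr (words (bound f)) _ ⟨
      ∑ (words (bound f)) (λ p → coeff (basis p) m * coeff f (p ++ n))
        ≡⟨ ∑-cong (words (bound f)) (λ p → ℚₚ.*-comm (coeff (basis p) m) (coeff f (p ++ n))) ⟩
      ∑ (words (bound f)) (λ p → coeff f (p ++ n) * coeff (basis p) m)
        -- The expansion is applied to the series m ↦ f(m n) with `n` fixed. It vanishes beyond the
        -- bound of `f`, since appending `n` never lowers the degree.
        ≡⟨ expansion (prefix-member n (member f)) (bound f) (λ k b<d → vanishing f (k ++ n)
             (ℕₚ.<-≤-trans b<d (subst (degree k ≤_) (sym (degree-++ k n)) (ℕₚ.m≤m+n _ _)))) m ⟨
      coeff f (m ++ n) ∎

  Δ-linear : Linear V V² Δ
  Δ-linear = mkLinear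
    (λ {f} {g} p → twoSets-injective (Δ f) (Δ g) λ m n →
      trans (Δ-union f m n) (trans (p (m ++ n)) (sym (Δ-union g m n))))
    (λ f g → twoSets-injective (Δ (f V.+ᴹ g)) (Δ f ⊕ Δ g) λ m n →
      trans (Δ-union (f V.+ᴹ g) m n) (sym (cong₂ _+_ (Δ-union f m n) (Δ-union g m n))))
    (λ c f → twoSets-injective (Δ (c V.*ₗ f)) (c · Δ f) λ m n →
      trans (Δ-union (c V.*ₗ f) m n) (sym (cong (c *_) (Δ-union f m n))))

  slice-Δ : ∀ f p → slice V p (Δ f) V.≈ᴹ suffix f p
  slice-Δ f p n = trans (sym (twoSets-slice (Δ f) p n)) (Δ-union f p n)

  ε : ∣ V ∣ → ℚ
  ε f = coeff f []

  -- As `ε` is the coefficient of the empty monomial, the map on the left is the slice at `[]`, and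
  -- `[] ++ n` reduces to `n`.
  counitˡ : ∀ f → extend V V V (λ g h → ε g V.*ₗ h) (Δ f) V.≈ᴹ f
  counitˡ f = slice-Δ f []

  counitʳ : ∀ f → extend V V V (λ g h → ε h V.*ₗ g) (Δ f) V.≈ᴹ f
  counitʳ f m = begin
    coeff (extend V V V (λ g h → ε h V.*ₗ g) (Δ f)) m
      ≡⟨ tensor-ext (linear-∘ (coeff-linear m) (extend-linear
           (bilinear-flip (bilinear-∘ *ₗ-bilinear (coeff-linear []) linear-id))))
           (twoSets-linear m []) (λ g h → ℚₚ.*-comm (ε h) (coeff g m)) (Δ f) ⟩
    twoSets (Δ f) m []
      ≡⟨ Δ-union f m [] ⟩
    coeff f (m ++ [])
      ≡⟨ cong (coeff f) (++-identityʳ m) ⟩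
    coeff f m ∎

  coassociative : ∀ f → LeftModule._≈ᴹ_ (V ⊠ V²)
    (associate V V V (tensorMap V V V² V Δ id (Δ f))) (tensorMap V V V V² id Δ (Δ f))
  coassociative f = slice-injective {V²} _ _ λ p → slice-injective {V} _ _ λ n k → begin
    coeff (slice V n (slice V² p (associate V V V (tensorMap V V V² V Δ id (Δ f))))) k
      ≡⟨ left n p (Δ f) k ⟩
    coeff (slice V (p ++ n) (Δ f)) k
      ≡⟨ slice-Δ f (p ++ n) k ⟩
    coeff f ((p ++ n) ++ k)
      ≡⟨ cong (coeff f) (++-assoc p n k) ⟩
    coeff f (p ++ (n ++ k))
      ≡⟨ slice-Δ f p (n ++ k) ⟨
    coeff (slice V p (Δ f)) (n ++ k)
      ≡⟨ slice-Δ (slice V p (Δ f)) n k ⟨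
    coeff (slice V n (Δ (slice V p (Δ f)))) k
      ≡⟨ Linear.φ-cong (slice-linear n) (right p (Δ f)) k ⟨
    coeff (slice V n (slice V² p (tensorMap V V V V² id Δ (Δ f)))) k ∎
    where
    assoc-slices : ∀ n p w s →
      slice V n (slice V² p (extend V V (V ⊠ V²) (λ u v → u ⊗ (v ⊗ w)) s)) V.≈ᴹ (twoSets s p n V.*ₗ w)
    assoc-slices n p w = tensor-ext {W = V}
      (linear-∘ (slice-linear n) (linear-∘ (slice-linear p) (extend-linear
        (bilinear-∘ ⊗-bilinear linear-id (Bilinear.linearˡ ⊗-bilinear w)))))
      (linear-∘ (*ₗ-linearˡ {V} w) (twoSets-linear p n))
      (λ u v k → sym (ℚₚ.*-assoc (coeff u p) (coeff v n) (coeff w k)))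
    left : ∀ n p t →
      slice V n (slice V² p (associate V V V (tensorMap V V V² V Δ id t))) V.≈ᴹ slice V (p ++ n) t
    left n p = tensor-ext
      (linear-∘ (slice-linear n) (linear-∘ (slice-linear p)
        (linear-∘ associate-linear (tensorMap-linear Δ-linear linear-id))))
      (slice-linear (p ++ n))
      (λ u w k → trans (assoc-slices n p w (Δ u) k) (cong (_* coeff w k) (Δ-union u p n)))
    right : ∀ p t → slice V² p (tensorMap V V V V² id Δ t) V².≈ᴹ Δ (slice V p t)
    right p = tensor-ext
      (linear-∘ (slice-linear p) (tensorMap-linear linear-id Δ-linear))
      (linear-∘ Δ-linear (slice-linear p))
      (λ u w → V².≈ᴹ-sym (Linear.φ-* Δ-linear (coeff u p) w))

  -- The product and the signed product of tensors

  infixl 7 _∙_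

  _∙_ : ∣ V ∣ → ∣ V ∣ → ∣ V ∣
  f ∙ g = product (coeff f) (coeff g) , product-member (member f) (member g)

  ∙-bilinear : Bilinear V V V _∙_
  ∙-bilinear = record
    { linearˡ = λ g → mkLinear (λ p → product-cong p (λ _ → refl))
        (λ f f′ → product-+ˡ (coeff f) (coeff f′) (coeff g)) (λ c f → product-*ˡ c (coeff f) (coeff g))
    ; linearʳ = λ f → mkLinear (λ p → product-cong {coeff f} (λ _ → refl) p)
        (λ g g′ → product-+ʳ (coeff f) (coeff g) (coeff g′)) (λ c g → product-*ʳ c (coeff f) (coeff g))
    }

  1# : ∣ V ∣
  1# = one , one-member

  isRing : IsRing V._≈ᴹ_ V._+ᴹ_ _∙_ V.-ᴹ_ V.0ᴹ 1#
  isRing = record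
    { +-isAbelianGroup = V.+ᴹ-isAbelianGroup
    ; *-cong = λ p q → product-cong p q
    ; *-assoc = λ f g h → product-assoc (coeff f) (coeff g) (coeff h)
    ; *-identity = (λ f → product-identityˡ (coeff f)) , (λ f → product-identityʳ (coeff f))
    ; distrib = (λ f → Linear.φ-+ (Bilinear.linearʳ ∙-bilinear f))
              , (λ f → Linear.φ-+ (Bilinear.linearˡ ∙-bilinear f))
    }

  -- For `a = sign` this is the parity involution f ↦ (-1)^deg(f) f, for the constant 1 the
  -- identity.
  weight : (ℕ → ℚ) → ∣ V ∣ → ∣ V ∣
  weight a f = (λ m → a (θDegree m) * coeff f m) , weight-member (λ _ → a) (member f)

  weight-linear : ∀ a → Linear V V (weight a)
  weight-linear a = mkLinear
    (λ p m → cong (a (θDegree m) *_) (p m))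
    (λ f g m → ℚₚ.*-distribˡ-+ (a (θDegree m)) (coeff f m) (coeff g m))
    (λ c f m → solve 3 (λ a c x → a :* (c :* x) := c :* (a :* x)) refl (a (θDegree m)) c (coeff f m))
    where open +-*-Solver

  -- On homogeneous `f₂` and `g₁` of fermionic degrees k and j, this multiplies the unsigned product
  -- of pure tensors by a(k) b(j). Rescaling the factors instead makes it meaningful, and bilinear,
  -- for inhomogeneous ones too.
  weighted : (a b : ℕ → ℚ) → ∣ V² ∣ → ∣ V² ∣ → ∣ V² ∣
  weighted a b s t = extend V V V² (λ f₁ g₁ →
    extend V V V² (λ f₂ g₂ → (f₁ ∙ weight a f₂) ⊗ (weight b g₁ ∙ g₂)) t) s

  weighted-bilinear : ∀ a b → Bilinear V² V² V² (weighted a b)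
  weighted-bilinear a b = record
    { linearˡ = λ t → extend-linear record
      { linearˡ = λ g₁ → extend-family-linear _ (λ f₂ g₂ →
          linear-∘ (Bilinear.linearˡ ⊗-bilinear _) (Bilinear.linearˡ ∙-bilinear (weight a f₂))) t
      ; linearʳ = λ f₁ → extend-family-linear _ (λ f₂ g₂ →
          linear-∘ (Bilinear.linearʳ ⊗-bilinear _)
            (linear-∘ (Bilinear.linearˡ ∙-bilinear g₂) (weight-linear b))) t
      }
    ; linearʳ = extend-family-linear _ (λ f₁ g₁ → extend-linear (bilinear-∘ ⊗-bilinear
        (linear-∘ (Bilinear.linearʳ ∙-bilinear f₁) (weight-linear a))
        (Bilinear.linearʳ ∙-bilinear (weight b g₁))))
    }

  crossingSigns : (m₁ m₂ n₁ n₂ : Monomial) → ℚ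
  crossingSigns m₁ m₂ n₁ n₂ = sign (crossings m₁ m₂) * sign (crossings n₁ n₂)

  -- Both sides are linear in `s` and in `t`, so pure tensors suffice. For them the coefficient is a
  -- product of two product formulas, multiplied out.
  twoSets-weighted : ∀ a b s t m n → twoSets (weighted a b s t) m n ≡
    splitSum m (λ m₁ m₂ → splitSum n (λ n₁ n₂ →
      crossingSigns m₁ m₂ n₁ n₂ * (a (θDegree m₂) * b (θDegree n₁)) * (twoSets s m₁ n₁ * twoSets t m₂ n₂)))
  twoSets-weighted a b s t m n = tensor-ext
    (linear-∘ (twoSets-linear m n) (Bilinear.linearˡ (weighted-bilinear a b) t))
    (splitSum-linear m λ m₁ m₂ → splitSum-linear n λ n₁ n₂ →
      linear-∘ (*-linearʳ (crossingSigns m₁ m₂ n₁ n₂ * (a (θDegree m₂) * b (θDegree n₁))))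
        (linear-∘ (*-linearˡ (twoSets t m₂ n₂)) (twoSets-linear m₁ n₁)))
    (λ f₁ g₁ → tensor-ext
      (linear-∘ (twoSets-linear m n) (Bilinear.linearʳ (weighted-bilinear a b) (f₁ ⊗ g₁)))
      (splitSum-linear m λ m₁ m₂ → splitSum-linear n λ n₁ n₂ →
        linear-∘ (*-linearʳ (crossingSigns m₁ m₂ n₁ n₂ * (a (θDegree m₂) * b (θDegree n₁))))
          (linear-∘ (*-linearʳ (coeff f₁ m₁ * coeff g₁ n₁)) (twoSets-linear m₂ n₂)))
      (pureTensors f₁ g₁) t)
    s
    where
    open +-*-Solver
    pureTensors : ∀ f₁ g₁ f₂ g₂ → twoSets (weighted a b (f₁ ⊗ g₁) (f₂ ⊗ g₂)) m n ≡
      splitSum m (λ m₁ m₂ → splitSum n (λ n₁ n₂ →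
        crossingSigns m₁ m₂ n₁ n₂ * (a (θDegree m₂) * b (θDegree n₁))
          * (coeff f₁ m₁ * coeff g₁ n₁ * (coeff f₂ m₂ * coeff g₂ n₂))))
    pureTensors f₁ g₁ f₂ g₂ = trans
      (cong₂ _*_ (product-splitSum (coeff f₁) (coeff (weight a f₂)) m)
                 (product-splitSum (coeff (weight b g₁)) (coeff g₂) n))
      (trans (splitSum-*-splitSum m n _ _) (splitSum-cong m λ m₁ m₂ _ → splitSum-cong n λ n₁ n₂ _ →
        solve 8 (λ s t a b p q r w →
            s :* (p :* (a :* q)) :* (t :* (b :* r :* w)) := s :* t :* (a :* b) :* (p :* r :* (q :* w))) refl
          (sign (crossings m₁ m₂)) (sign (crossings n₁ n₂)) (a (θDegree m₂)) (b (θDegree n₁))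
          (coeff f₁ m₁) (coeff f₂ m₂) (coeff g₁ n₁) (coeff g₂ n₂)))

  infixl 7 _⊛_

  -- The signed product, by (-1)^(jk) = ½ (1 + (-1)^j + (-1)^k − (-1)^j (-1)^k).
  _⊛_ : ∣ V² ∣ → ∣ V² ∣ → ∣ V² ∣
  s ⊛ t = ½ · ((weighted (λ _ → 1ℚ) (λ _ → 1ℚ) s t ⊕ weighted sign (λ _ → 1ℚ) s t)
             ⊕ (weighted (λ _ → 1ℚ) sign s t ⊕ (- 1ℚ) · weighted sign sign s t))

  ⊛-bilinear : Bilinear V² V² V² _⊛_
  ⊛-bilinear = linear-bilinear (*ₗ-linear ½) (bilinear-+
    (bilinear-+ (weighted-bilinear _ _) (weighted-bilinear _ _))
    (bilinear-+ (weighted-bilinear _ _) (linear-bilinear (*ₗ-linear (- 1ℚ)) (weighted-bilinear _ _))))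

  twoSets-⊛ : ∀ s t m n → twoSets (s ⊛ t) m n ≡
    splitSum m (λ m₁ m₂ → splitSum n (λ n₁ n₂ →
      crossingSigns m₁ m₂ n₁ n₂ * sign (θDegree m₂ ℕ.* θDegree n₁) * (twoSets s m₁ n₁ * twoSets t m₂ n₂)))
  twoSets-⊛ s t m n = begin
    ½ * (T u u + T sign u + (T u sign + - 1ℚ * T sign sign))
      ≡⟨ cong (½ *_) (cong₂ _+_ (cong₂ _+_ (w u u) (w sign u))
           (cong₂ _+_ (w u sign) (cong (- 1ℚ *_) (w sign sign)))) ⟩
    ½ * (S u u + S sign u + (S u sign + - 1ℚ * S sign sign))
      ≡⟨ cong (½ *_) (cong₂ _+_ (sym (double-+ (F u u) (F sign u)))
           (trans (cong (S u sign +_) (sym (double-* (- 1ℚ) (F sign sign)))) (sym (double-+ (F u sign) _)))) ⟩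
    ½ * (double (λ m₁ m₂ n₁ n₂ → F u u m₁ m₂ n₁ n₂ + F sign u m₁ m₂ n₁ n₂)
      + double (λ m₁ m₂ n₁ n₂ → F u sign m₁ m₂ n₁ n₂ + - 1ℚ * F sign sign m₁ m₂ n₁ n₂))
      ≡⟨ trans (cong (½ *_) (sym (double-+ _ _))) (sym (double-* ½ _)) ⟩
    double (λ m₁ m₂ n₁ n₂ → ½ * (F u u m₁ m₂ n₁ n₂ + F sign u m₁ m₂ n₁ n₂
      + (F u sign m₁ m₂ n₁ n₂ + - 1ℚ * F sign sign m₁ m₂ n₁ n₂)))
      ≡⟨ splitSum-cong m (λ m₁ m₂ _ → splitSum-cong n λ n₁ n₂ _ → trans
           (solve 4 (λ c a b x → con ½ :* (c :* (con 1ℚ :* con 1ℚ) :* x :+ c :* (a :* con 1ℚ) :* x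
               :+ (c :* (con 1ℚ :* b) :* x :+ con (- 1ℚ) :* (c :* (a :* b) :* x)))
             := c :* (con ½ :* (con 1ℚ :+ a :+ (b :+ con (- 1ℚ) :* (a :* b)))) :* x) refl
             (crossingSigns m₁ m₂ n₁ n₂) (sign (θDegree m₂)) (sign (θDegree n₁))
             (twoSets s m₁ n₁ * twoSets t m₂ n₂))
           (cong (λ z → crossingSigns m₁ m₂ n₁ n₂ * z * (twoSets s m₁ n₁ * twoSets t m₂ n₂))
             (sym (sign-* (θDegree m₂) (θDegree n₁))))) ⟩
    splitSum m (λ m₁ m₂ → splitSum n (λ n₁ n₂ →
      crossingSigns m₁ m₂ n₁ n₂ * sign (θDegree m₂ ℕ.* θDegree n₁) * (twoSets s m₁ n₁ * twoSets t m₂ n₂))) ∎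
    where
    open +-*-Solver
    u : ℕ → ℚ
    u _ = 1ℚ
    double : (Monomial → Monomial → Monomial → Monomial → ℚ) → ℚ
    double F = splitSum m (λ m₁ m₂ → splitSum n (F m₁ m₂))
    double-+ : ∀ F G → double (λ m₁ m₂ n₁ n₂ → F m₁ m₂ n₁ n₂ + G m₁ m₂ n₁ n₂) ≡ double F + double G
    double-+ F G = trans (splitSum-cong m λ m₁ m₂ _ → splitSum-+ n (F m₁ m₂) (G m₁ m₂))
      (splitSum-+ m (λ m₁ m₂ → splitSum n (F m₁ m₂)) (λ m₁ m₂ → splitSum n (G m₁ m₂)))
    double-* : ∀ c F → double (λ m₁ m₂ n₁ n₂ → c * F m₁ m₂ n₁ n₂) ≡ c * double F
    double-* c F = trans (splitSum-cong m λ m₁ m₂ _ → splitSum-* n c (F m₁ m₂))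
      (splitSum-* m c (λ m₁ m₂ → splitSum n (F m₁ m₂)))
    F : (a b : ℕ → ℚ) → Monomial → Monomial → Monomial → Monomial → ℚ
    F a b m₁ m₂ n₁ n₂ = crossingSigns m₁ m₂ n₁ n₂ * (a (θDegree m₂) * b (θDegree n₁))
      * (twoSets s m₁ n₁ * twoSets t m₂ n₂)
    T S : (a b : ℕ → ℚ) → ℚ
    T a b = twoSets (weighted a b s t) m n
    S a b = double (F a b)
    w : ∀ a b → T a b ≡ S a b
    w a b = twoSets-weighted a b s t m n

  Δ-∙ : ∀ f g → Δ (f ∙ g) V².≈ᴹ (Δ f ⊛ Δ g)
  Δ-∙ f g = twoSets-injective (Δ (f ∙ g)) (Δ f ⊛ Δ g) λ m n → begin
    twoSets (Δ (f ∙ g)) m n                        ≡⟨ Δ-union (f ∙ g) m n ⟩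
    product (coeff f) (coeff g) (m ++ n)           ≡⟨ product-++ (coeff f) (coeff g) m n ⟩
    splitSum m _                                   ≡⟨ splitSum-cong m (λ m₁ m₂ _ → splitSum-cong n λ n₁ n₂ _ →
      cong (crossingSigns m₁ m₂ n₁ n₂ * sign (θDegree m₂ ℕ.* θDegree n₁) *_)
        (cong₂ _*_ (sym (Δ-union f m₁ n₁)) (sym (Δ-union g m₂ n₂)))) ⟩
    splitSum m _                                   ≡⟨ twoSets-⊛ (Δ f) (Δ g) m n ⟨
    twoSets (Δ f ⊛ Δ g) m n                        ∎

  Δ-1 : Δ 1# V².≈ᴹ (1# ⊗ 1#)
  Δ-1 = twoSets-injective (Δ 1#) (1# ⊗ 1#) λ m n → trans (Δ-union 1# m n) (one-++ m n)
    where
    one-++ : ∀ m n → one (m ++ n) ≡ one m * one n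
    one-++ m n = trans (cong (λ d → kronecker d 0) (degree-++ m n)) (kronecker-+ (degree m) (degree n))
      where
      kronecker-+ : ∀ i j → kronecker (i ℕ.+ j) 0 ≡ kronecker i 0 * kronecker j 0
      kronecker-+ zero    j = sym (ℚₚ.*-identityˡ (kronecker j 0))
      kronecker-+ (suc i) j = sym (ℚₚ.*-zeroˡ (kronecker j 0))

  -- Where `n₁` has θ-degree j and `m₂` has θ-degree k, the sign in `twoSets-⊛` is the constant
  -- (-1)^(jk). Elsewhere a coefficient of `g₁` or of `f₂` vanishes, and both sides are zero.
  ⊛-sign : ∀ {j k} f₁ {g₁ f₂} g₂ → FermionicDegree j g₁ → FermionicDegree k f₂ →
    ((f₁ ⊗ g₁) ⊛ (f₂ ⊗ g₂)) V².≈ᴹ (sign (j ℕ.* k) · ((f₁ ∙ f₂) ⊗ (g₁ ∙ g₂)))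
  ⊛-sign {j} {k} f₁ {g₁} {f₂} g₂ p q = twoSets-injective _ _ λ m n → begin
    twoSets ((f₁ ⊗ g₁) ⊛ (f₂ ⊗ g₂)) m n
      ≡⟨ twoSets-⊛ (f₁ ⊗ g₁) (f₂ ⊗ g₂) m n ⟩
    splitSum m _
      ≡⟨ splitSum-cong m (λ m₁ m₂ _ → splitSum-cong n λ n₁ n₂ _ → entry m₁ m₂ n₁ n₂) ⟩
    splitSum m (λ m₁ m₂ → splitSum n (λ n₁ n₂ → sign (j ℕ.* k) * E m₁ m₂ n₁ n₂))
      ≡⟨ trans (splitSum-cong m (λ m₁ m₂ _ → splitSum-* n (sign (j ℕ.* k)) (E m₁ m₂)))
           (splitSum-* m (sign (j ℕ.* k)) (λ m₁ m₂ → splitSum n (E m₁ m₂))) ⟩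
    sign (j ℕ.* k) * splitSum m (λ m₁ m₂ → splitSum n (E m₁ m₂))
      ≡⟨ cong (sign (j ℕ.* k) *_) (splitSum-*-splitSum m n _ _) ⟨
    sign (j ℕ.* k) * (splitSum m _ * splitSum n _)
      ≡⟨ cong (sign (j ℕ.* k) *_) (cong₂ _*_ (product-splitSum (coeff f₁) (coeff f₂) m)
           (product-splitSum (coeff g₁) (coeff g₂) n)) ⟨
    sign (j ℕ.* k) * (product (coeff f₁) (coeff f₂) m * product (coeff g₁) (coeff g₂) n) ∎
    where
    open +-*-Solver
    E : (m₁ m₂ n₁ n₂ : Monomial) → ℚ
    E m₁ m₂ n₁ n₂ = sign (crossings m₁ m₂) * (coeff f₁ m₁ * coeff f₂ m₂)
      * (sign (crossings n₁ n₂) * (coeff g₁ n₁ * coeff g₂ n₂))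
    regroup : ∀ s t w a b c d →
      s * t * w * (a * b * (c * d)) ≡ w * (s * (a * c) * (t * (b * d)))
    regroup = solve 7 (λ s t w a b c d →
      s :* t :* w :* (a :* b :* (c :* d)) := w :* (s :* (a :* c) :* (t :* (b :* d)))) refl
    entry : ∀ m₁ m₂ n₁ n₂ →
      crossingSigns m₁ m₂ n₁ n₂ * sign (θDegree m₂ ℕ.* θDegree n₁)
        * (coeff f₁ m₁ * coeff g₁ n₁ * (coeff f₂ m₂ * coeff g₂ n₂))
      ≡ sign (j ℕ.* k) * E m₁ m₂ n₁ n₂
    entry m₁ m₂ n₁ n₂ with θDegree n₁ ℕₚ.≟ j | θDegree m₂ ℕₚ.≟ k
    ... | yes refl | yes refl = trans (cong (λ z → crossingSigns m₁ m₂ n₁ n₂ * sign z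
        * (coeff f₁ m₁ * coeff g₁ n₁ * (coeff f₂ m₂ * coeff g₂ n₂))) (ℕₚ.*-comm (θDegree m₂) (θDegree n₁)))
      (regroup (sign (crossings m₁ m₂)) (sign (crossings n₁ n₂)) (sign (j ℕ.* k))
        (coeff f₁ m₁) (coeff g₁ n₁) (coeff f₂ m₂) (coeff g₂ n₂))
    ... | no ≢j    | _        = vanish (coeff g₁ n₁) (coeff f₂ m₂) (inj₁ (p n₁ ≢j))
      where
      -- The two coefficients are generalized to variables, so that the vanishing one can be
      -- replaced by 0 by matching on `refl`.
      vanish : ∀ x y → x ≡ 0ℚ ⊎ y ≡ 0ℚ →
        crossingSigns m₁ m₂ n₁ n₂ * sign (θDegree m₂ ℕ.* θDegree n₁) * (coeff f₁ m₁ * x * (y * coeff g₂ n₂))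
        ≡ sign (j ℕ.* k) * (sign (crossings m₁ m₂) * (coeff f₁ m₁ * y) * (sign (crossings n₁ n₂) * (x * coeff g₂ n₂)))
      vanish x y (inj₁ refl) = solve 7 (λ s t w v a c d →
        s :* t :* w :* (a :* con 0ℚ :* (c :* d)) := v :* (s :* (a :* c) :* (t :* (con 0ℚ :* d)))) refl
        (sign (crossings m₁ m₂)) (sign (crossings n₁ n₂)) (sign (θDegree m₂ ℕ.* θDegree n₁)) (sign (j ℕ.* k))
        (coeff f₁ m₁) y (coeff g₂ n₂)
      vanish x y (inj₂ refl) = solve 7 (λ s t w v a b d →
        s :* t :* w :* (a :* b :* (con 0ℚ :* d)) := v :* (s :* (a :* con 0ℚ) :* (t :* (b :* d)))) refl
        (sign (crossings m₁ m₂)) (sign (crossings n₁ n₂)) (sign (θDegree m₂ ℕ.* θDegree n₁)) (sign (j ℕ.* k))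
        (coeff f₁ m₁) x (coeff g₂ n₂)
    ... | yes _    | no ≢k    = vanish (coeff f₂ m₂) (q m₂ ≢k)
      where
      vanish : ∀ y → y ≡ 0ℚ →
        crossingSigns m₁ m₂ n₁ n₂ * sign (θDegree m₂ ℕ.* θDegree n₁) * (coeff f₁ m₁ * coeff g₁ n₁ * (y * coeff g₂ n₂))
        ≡ sign (j ℕ.* k) * (sign (crossings m₁ m₂) * (coeff f₁ m₁ * y) * (sign (crossings n₁ n₂) * (coeff g₁ n₁ * coeff g₂ n₂)))
      vanish y refl = solve 7 (λ s t w v a b d →
        s :* t :* w :* (a :* b :* (con 0ℚ :* d)) := v :* (s :* (a :* con 0ℚ) :* (t :* (b :* d)))) refl
        (sign (crossings m₁ m₂)) (sign (crossings n₁ n₂)) (sign (θDegree m₂ ℕ.* θDegree n₁)) (sign (j ℕ.* k))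
        (coeff f₁ m₁) (coeff g₁ n₁) (coeff g₂ n₂)

  -- Gradings and connectedness

  Homogeneous : (Monomial → ℕ) → ℕ → Pred ∣ V ∣ 0ℓ
  Homogeneous d n f = ∀ m → d m ≢ n → coeff f m ≡ 0ℚ

  -- One argument serves both the fermionic grading, φ(x,t) = t, and the total one, φ(x,t) = x + t.
  -- The inequality makes the components beyond the bound of a series vanish.
  module _ (φ : ℕ → ℕ → ℕ) (φ≤ : ∀ x t → φ x t ≤ x ℕ.+ t) where
    open CMSum V.+ᴹ-commutativeMonoid using () renaming (sum to sumᴹ)

    private
      d : Monomial → ℕ
      d m = φ (xDegree m) (θDegree m)

    coeff-sum : ∀ N (h : ℕ → ∣ V ∣) m →
      coeff (sumᴹ {N} (λ i → h (toℕ i))) m ≡ sumTo N (λ i → coeff (h i) m)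
    coeff-sum zero    h m = refl
    coeff-sum (suc N) h m = cong (coeff (h 0) m +_) (coeff-sum N (h ∘ suc) m)

    component : ℕ → ∣ V ∣ → ∣ V ∣
    component n f = (λ m → kronecker (d m) n * coeff f m) ,
      weight-member (λ x t → kronecker (φ x t) n) (member f)

    grading : IsGrading V (Homogeneous d)
    grading = record
      { resp        = λ f≈g p m ≢n → trans (sym (f≈g m)) (p m ≢n)
      ; 0-closed    = λ _ _ → refl
      ; +-closed    = λ p q m ≢n → trans (cong₂ _+_ (p m ≢n) (q m ≢n)) (ℚₚ.+-identityˡ 0ℚ)
      ; *ₗ-closed   = λ c p m ≢n → trans (cong (c *_) (p m ≢n)) (ℚₚ.*-zeroʳ c)
      -- The components of degrees 0 up to and including `bound f`, hence the successor.
      ; spanning    = λ f → suc (bound f) , (λ n → component n f) ,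
          (λ n m ≢n → trans (cong (_* coeff f m) (kronecker-≢ (d m) n ≢n)) (ℚₚ.*-zeroˡ (coeff f m))) ,
          (λ m → trans (spanned f m) (sym (coeff-sum (suc (bound f)) (λ n → component n f) m)))
      -- At a monomial of degree `n` every other `h i` has coefficient 0, so the vanishing sum is
      -- the coefficient of `h n` alone.
      ; independent = λ N h homogeneous sum≈0 n n<N m → case d m ℕₚ.≟ n of λ
          { (no ≢n)    → homogeneous n m ≢n
          ; (yes refl) → trans
              (sym (sumTo-single N (λ i → coeff (h i) m) (d m) n<N (λ i i≢ → homogeneous i m (i≢ ∘ sym))))
              (trans (sym (coeff-sum N h m)) (sum≈0 m)) }
      }
      where
      spanned : ∀ f m → coeff f m ≡ sumTo (suc (bound f)) (λ n → kronecker (d m) n * coeff f m)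
      spanned f m with d m ℕₚ.≤? bound f
      ... | yes d≤b = sym (trans
        (sumTo-single (suc (bound f)) _ (d m) (s≤s d≤b) (λ i i≢ →
          trans (cong (_* coeff f m) (kronecker-≢ (d m) i (i≢ ∘ sym))) (ℚₚ.*-zeroˡ (coeff f m))))
        (trans (cong (_* coeff f m) (kronecker-≡ (d m))) (ℚₚ.*-identityˡ (coeff f m))))
      ... | no d≰b = trans f≡0 (sym (sumTo-zero (suc (bound f)) _ (λ i →
        trans (cong (kronecker (d m) i *_) f≡0) (ℚₚ.*-zeroʳ (kronecker (d m) i)))))
        where
        f≡0 : coeff f m ≡ 0ℚ
        f≡0 = vanishing f m (ℕₚ.<-≤-trans (ℕₚ.≰⇒> d≰b) (φ≤ (xDegree m) (θDegree m)))

  -- As `f` has degree `n`, the summand of `p` has degrees `degree p` and `n − degree p`. If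
  -- `degree p` exceeds `n`, the suffix is zero and so is the summand.
  degree≤⇒TensorDegree : ∀ {n f} → Degree n f → ∀ ps →
    TensorDegree V Degree n (∑ᴹ V² ps (λ p → basis p ⊗ suffix f p))
  degree≤⇒TensorDegree h [] = zero
  degree≤⇒TensorDegree {n} {f} h (p ∷ ps) = plus summand (degree≤⇒TensorDegree h ps)
    where
    summand : TensorDegree V Degree n (basis p ⊗ suffix f p)
    summand with degree p ℕₚ.≤? n
    ... | yes p≤n = pure (basis-degree p)
      (λ m ≢ → h (p ++ m) (λ e → ≢ (ℕₚ.+-cancelˡ-≡ (degree p) _ _
        (trans (sym (degree-++ p m)) (trans e (sym (ℕₚ.m+[n∸m]≡n p≤n)))))))
      (ℕₚ.m+[n∸m]≡n p≤n)
    ... | no p≰n = resp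
      (V².≈ᴹ-sym (V².≈ᴹ-trans (Tensor.⊗-cong (V.≈ᴹ-refl {basis p}) suffix≈0)
        (Linear.φ-0 (Bilinear.linearʳ ⊗-bilinear (basis p)))))
      zero
      where
      suffix≈0 : suffix f p V.≈ᴹ V.0ᴹ
      suffix≈0 m = h (p ++ m) (λ e → p≰n (subst (degree p ≤_) (trans (sym (degree-++ p m)) e) (ℕₚ.m≤m+n _ _)))

  Δ-graded : ∀ {n f} → Degree n f → TensorDegree V Degree n (Δ f)
  Δ-graded {n} {f} h = subst (TensorDegree V Degree n) (sym (Δ-suffix f))
    (degree≤⇒TensorDegree h (words (bound f)))

  connected : Connected V Degree
  connected = 1# , one-≢0 , (λ p → case p [] of λ ()) , λ f h → ε f , λ m →
    case degree m ℕₚ.≟ 0 of λ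
      { (yes p) → trans (trivialInvariant-degree0 (trivialInvariant-member (member f)) m p)
          (sym (trans (cong (ε f *_) (one-zero m p)) (ℚₚ.*-identityʳ (ε f))))
      ; (no p)  → trans (h m p) (sym (trans (cong (ε f *_) (one-≢0 m p)) (ℚₚ.*-zeroʳ (ε f)))) }

-- The antipode

-- The antipode agrees with a partial sum whose index depends on the argument. A tensor involves
-- finitely many pure tensors, so a single index serves them all.
extend-eventually : ∀ {U V W} {b : ∣ U ∣ → ∣ V ∣ → ∣ W ∣} {c : ℕ → ∣ U ∣ → ∣ V ∣ → ∣ W ∣} →
  let open LeftModule W in
  (∀ u v → Σ[ N ∈ ℕ ] ∀ M → N ≤ M → b u v ≈ᴹ c M u v) →
  ∀ t → Σ[ N ∈ ℕ ] ∀ M → N ≤ M → extend U V W b t ≈ᴹ extend U V W (c M) t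
extend-eventually {U} {V} {W} {b} {c} h = go
  where
  module W = LeftModule W
  go : ∀ t → Σ[ N ∈ ℕ ] ∀ M → N ≤ M → extend U V W b t W.≈ᴹ extend U V W (c M) t
  go (u ⊗ v) = h u v
  go 0#      = 0 , λ _ _ → W.≈ᴹ-refl
  go (s ⊕ t) with go s | go t
  ... | N , p | N′ , p′ = N ⊔ N′ , λ M N≤M →
    W.+ᴹ-cong (p M (ℕₚ.m⊔n≤o⇒m≤o N N′ N≤M)) (p′ M (ℕₚ.m⊔n≤o⇒n≤o N N′ N≤M))
  go (c · t) with go t
  ... | N , p = N , λ M N≤M → W.*ₗ-cong refl (p M N≤M)

-- With J = id − uε, the antipode Σᵢ (-1)ⁱ J^⋆ⁱ is a finite sum on each series,
-- since J^⋆ᵏ vanishes in degrees below k.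

module Antipode {P : Subspace} (A : Admissible P) where
  open Admissible A
  open Coalgebra A
  open Series using (member)

  Endo : (∣ V ∣ → ∣ V ∣) → Set
  Endo = Linear V V

  infixl 7 _⋆_

  _⋆_ : (∣ V ∣ → ∣ V ∣) → (∣ V ∣ → ∣ V ∣) → ∣ V ∣ → ∣ V ∣
  (φ ⋆ ψ) f = extend V V V (λ u v → φ u ∙ ψ v) (Δ f)

  ⋆-linear : ∀ {φ ψ} → Endo φ → Endo ψ → Endo (φ ⋆ ψ)
  ⋆-linear l k = linear-∘ (extend-linear (bilinear-∘ ∙-bilinear l k)) Δ-linear

  ⋆-cong : ∀ {φ φ′ ψ ψ′} → (∀ f → φ f V.≈ᴹ φ′ f) → (∀ f → ψ f V.≈ᴹ ψ′ f) → ∀ f → (φ ⋆ ψ) f V.≈ᴹ (φ′ ⋆ ψ′) f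
  ⋆-cong p q f = extend-pointwise {W = V} (λ u v → product-cong (p u) (q v)) (Δ f)

  -- Sum and multiple are treated together because `partial (suc k)` and the decomposition of `id`
  -- into `J` and `uε` both have the shape φ + c φ′.
  ⋆-+ˡ : ∀ {φ φ′ ψ} c f → ((λ u → φ u V.+ᴹ c V.*ₗ φ′ u) ⋆ ψ) f V.≈ᴹ ((φ ⋆ ψ) f V.+ᴹ c V.*ₗ (φ′ ⋆ ψ) f)
  ⋆-+ˡ {φ} {φ′} {ψ} c f = go (Δ f)
    where
    open +-*-Solver
    go : ∀ t → extend V V V (λ u v → (φ u V.+ᴹ c V.*ₗ φ′ u) ∙ ψ v) t V.≈ᴹ
               (extend V V V (λ u v → φ u ∙ ψ v) t V.+ᴹ c V.*ₗ extend V V V (λ u v → φ′ u ∙ ψ v) t)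
    go (u ⊗ v) m = trans (product-+ˡ (coeff (φ u)) (coeff (c V.*ₗ φ′ u)) (coeff (ψ v)) m)
      (cong (product (coeff (φ u)) (coeff (ψ v)) m +_) (product-*ˡ c (coeff (φ′ u)) (coeff (ψ v)) m))
    go 0#      m = solve 1 (λ c → con 0ℚ := con 0ℚ :+ c :* con 0ℚ) refl c
    go (s ⊕ t) m = trans (cong₂ _+_ (go s m) (go t m))
      (solve 5 (λ a b c x y → a :+ c :* x :+ (b :+ c :* y) := a :+ b :+ c :* (x :+ y)) refl
        (coeff (extend V V V (λ u v → φ u ∙ ψ v) s) m) (coeff (extend V V V (λ u v → φ u ∙ ψ v) t) m) c
        (coeff (extend V V V (λ u v → φ′ u ∙ ψ v) s) m) (coeff (extend V V V (λ u v → φ′ u ∙ ψ v) t) m))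
    go (d · t) m = trans (cong (d *_) (go t m))
      (solve 4 (λ a c d x → d :* (a :+ c :* x) := d :* a :+ c :* (d :* x)) refl
        (coeff (extend V V V (λ u v → φ u ∙ ψ v) t) m) c d (coeff (extend V V V (λ u v → φ′ u ∙ ψ v) t) m))

  ⋆-+ʳ : ∀ {φ ψ ψ′} c f → (φ ⋆ (λ u → ψ u V.+ᴹ c V.*ₗ ψ′ u)) f V.≈ᴹ ((φ ⋆ ψ) f V.+ᴹ c V.*ₗ (φ ⋆ ψ′) f)
  ⋆-+ʳ {φ} {ψ} {ψ′} c f = go (Δ f)
    where
    open +-*-Solver
    go : ∀ t → extend V V V (λ u v → φ u ∙ (ψ v V.+ᴹ c V.*ₗ ψ′ v)) t V.≈ᴹ
               (extend V V V (λ u v → φ u ∙ ψ v) t V.+ᴹ c V.*ₗ extend V V V (λ u v → φ u ∙ ψ′ v) t)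
    go (u ⊗ v) m = trans (product-+ʳ (coeff (φ u)) (coeff (ψ v)) (coeff (c V.*ₗ ψ′ v)) m)
      (cong (product (coeff (φ u)) (coeff (ψ v)) m +_) (product-*ʳ c (coeff (φ u)) (coeff (ψ′ v)) m))
    go 0#      m = solve 1 (λ c → con 0ℚ := con 0ℚ :+ c :* con 0ℚ) refl c
    go (s ⊕ t) m = trans (cong₂ _+_ (go s m) (go t m))
      (solve 5 (λ a b c x y → a :+ c :* x :+ (b :+ c :* y) := a :+ b :+ c :* (x :+ y)) refl
        (coeff (extend V V V (λ u v → φ u ∙ ψ v) s) m) (coeff (extend V V V (λ u v → φ u ∙ ψ v) t) m) c
        (coeff (extend V V V (λ u v → φ u ∙ ψ′ v) s) m) (coeff (extend V V V (λ u v → φ u ∙ ψ′ v) t) m))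
    go (d · t) m = trans (cong (d *_) (go t m))
      (solve 4 (λ a c d x → d :* (a :+ c :* x) := d :* a :+ c :* (d :* x)) refl
        (coeff (extend V V V (λ u v → φ u ∙ ψ v) t) m) c d (coeff (extend V V V (λ u v → φ u ∙ ψ′ v) t) m))

  -- Each side is `triple` applied to one of the two iterated coproducts, up to `associate`;
  -- coassociativity identifies these, and associativity of the product does the rest.
  ⋆-assoc : ∀ {φ ψ χ} → Endo φ → Endo ψ → Endo χ → ∀ f → ((φ ⋆ ψ) ⋆ χ) f V.≈ᴹ (φ ⋆ (ψ ⋆ χ)) f
  ⋆-assoc {φ} {ψ} {χ} lφ lψ lχ f =
    V.≈ᴹ-trans {((φ ⋆ ψ) ⋆ χ) f} {triple (associate V V V (tensorMap V V V² V Δ id (Δ f)))} {(φ ⋆ (ψ ⋆ χ)) f}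
      (V.≈ᴹ-sym {triple (associate V V V (tensorMap V V V² V Δ id (Δ f)))} {((φ ⋆ ψ) ⋆ χ) f} (left (Δ f)))
      (V.≈ᴹ-trans {triple (associate V V V (tensorMap V V V² V Δ id (Δ f)))}
          {triple (tensorMap V V V V² id Δ (Δ f))} {(φ ⋆ (ψ ⋆ χ)) f}
        (Linear.φ-cong triple-linear (coassociative f)) (right (Δ f)))
    where
    inner : ∣ V² ∣ → ∣ V ∣
    inner = extend V V V (λ v w → ψ v ∙ χ w)
    triple : ∣ V ⊠ V² ∣ → ∣ V ∣
    triple = extend V V² V (λ u t → φ u ∙ inner t)
    triple-linear : Linear (V ⊠ V²) V triple
    triple-linear = extend-linear (bilinear-∘ ∙-bilinear lφ (extend-linear (bilinear-∘ ∙-bilinear lψ lχ)))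
    right : ∀ t → triple (tensorMap V V V V² id Δ t) V.≈ᴹ extend V V V (λ u w → φ u ∙ (ψ ⋆ χ) w) t
    right = extend-tensorMap {W = V} (λ u t → φ u ∙ inner t)
    pulled : ∀ w s → triple (extend V V (V ⊠ V²) (λ u v → u ⊗ (v ⊗ w)) s) V.≈ᴹ
                     (extend V V V (λ u v → φ u ∙ ψ v) s ∙ χ w)
    pulled w = tensor-ext {W = V}
      (linear-∘ triple-linear (extend-linear
        (bilinear-∘ ⊗-bilinear linear-id (Bilinear.linearˡ ⊗-bilinear w))))
      (linear-∘ (Bilinear.linearˡ ∙-bilinear (χ w)) (extend-linear (bilinear-∘ ∙-bilinear lφ lψ)))
      (λ u v m → sym (product-assoc (coeff (φ u)) (coeff (ψ v)) (coeff (χ w)) m))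
    left : ∀ t → triple (associate V V V (tensorMap V V V² V Δ id t)) V.≈ᴹ
                 extend V V V (λ u w → (φ ⋆ ψ) u ∙ χ w) t
    left = tensor-ext {W = V}
      (linear-∘ triple-linear (linear-∘ associate-linear (tensorMap-linear Δ-linear linear-id)))
      (extend-linear (bilinear-∘ ∙-bilinear (⋆-linear lφ lψ) lχ))
      (λ u w → pulled w (Δ u))

  uε : ∣ V ∣ → ∣ V ∣
  uε f = ε f V.*ₗ 1#

  uε-linear : Endo uε
  uε-linear = linear-∘ (*ₗ-linearˡ {V} 1#) (coeff-linear [])

  uε-⋆ : ∀ {φ} → Endo φ → ∀ f → (uε ⋆ φ) f V.≈ᴹ φ f
  uε-⋆ {φ} l f m = begin
    coeff ((uε ⋆ φ) f) m
      ≡⟨ extend-pointwise {W = V} (λ u v k → trans (product-*ˡ (ε u) one (coeff (φ v)) k)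
           (trans (cong (ε u *_) (product-identityˡ (coeff (φ v)) k)) (sym (Linear.φ-* l (ε u) v k)))) (Δ f) m ⟩
    coeff (extend V V V (λ u v → φ (ε u V.*ₗ v)) (Δ f)) m
      ≡⟨ linear-extend l (Δ f) m ⟨
    coeff (φ (extend V V V (λ u v → ε u V.*ₗ v) (Δ f))) m
      ≡⟨ Linear.φ-cong l (counitˡ f) m ⟩
    coeff (φ f) m ∎

  ⋆-uε : ∀ {φ} → Endo φ → ∀ f → (φ ⋆ uε) f V.≈ᴹ φ f
  ⋆-uε {φ} l f m = begin
    coeff ((φ ⋆ uε) f) m
      ≡⟨ extend-pointwise {W = V} (λ u v k → trans (product-*ʳ (ε v) (coeff (φ u)) one k)
           (trans (cong (ε v *_) (product-identityʳ (coeff (φ u)) k)) (sym (Linear.φ-* l (ε v) u k)))) (Δ f) m ⟩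
    coeff (extend V V V (λ u v → φ (ε v V.*ₗ u)) (Δ f)) m
      ≡⟨ linear-extend l (Δ f) m ⟨
    coeff (φ (extend V V V (λ u v → ε v V.*ₗ u) (Δ f))) m
      ≡⟨ Linear.φ-cong l (counitʳ f) m ⟩
    coeff (φ f) m ∎

  J : ∣ V ∣ → ∣ V ∣
  J f = f V.+ᴹ (- 1ℚ) V.*ₗ uε f

  J-linear : Endo J
  J-linear = +ᴹ-linear linear-id (linear-∘ (*ₗ-linear (- 1ℚ)) uε-linear)

  J-constant : ∀ f → Degree 0 f → J f V.≈ᴹ V.0ᴹ
  J-constant f h m = begin
    coeff f m + - 1ℚ * (ε f * one m)
      -- The scalar that `connected` supplies is `ε f`: a series of degree 0 is ε f times the unit.
      ≡⟨ cong (λ z → z + - 1ℚ * (ε f * one m)) (proj₂ (proj₂ (proj₂ (proj₂ connected)) f h) m) ⟩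
    ε f * one m + - 1ℚ * (ε f * one m)
      ≡⟨ solve 1 (λ x → x :+ con (- 1ℚ) :* x := con 0ℚ) refl (ε f * one m) ⟩
    0ℚ ∎
    where open +-*-Solver

  J-power : ℕ → ∣ V ∣ → ∣ V ∣
  J-power zero    = uε
  J-power (suc k) = J-power k ⋆ J

  J-power-linear : ∀ k → Endo (J-power k)
  J-power-linear zero    = uε-linear
  J-power-linear (suc k) = ⋆-linear (J-power-linear k) J-linear

  -- `J-power` multiplies by `J` on the right, while the right antipode law needs `J` on the left.
  -- By associativity a power commutes with its base.
  J-⋆-power : ∀ k f → (J ⋆ J-power k) f V.≈ᴹ J-power (suc k) f
  J-⋆-power zero    f m = trans (⋆-uε J-linear f m) (sym (uε-⋆ J-linear f m))
  J-⋆-power (suc k) f m = trans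
    (sym (⋆-assoc J-linear (J-power-linear k) J-linear f m))
    (⋆-cong {J ⋆ J-power k} {J-power (suc k)} {J} {J} (J-⋆-power k) (λ _ _ → refl) f m)

  -- In the summand `basis p ⊗ suffix f p`, either `degree p < k` and the induction hypothesis kills
  -- `basis p`, which is supported in degree `degree p`. Or `degree p ≥ k`, and then the suffix is
  -- at most a constant, which `J` kills.
  J-power-vanishes : ∀ k f → (∀ m → k ≤ degree m → coeff f m ≡ 0ℚ) → J-power k f V.≈ᴹ V.0ᴹ
  J-power-vanishes zero    f h m = trans (cong (_* one m) (h [] z≤n)) (ℚₚ.*-zeroˡ (one m))
  J-power-vanishes (suc k) f h m = begin
    coeff (extend V V V (λ u v → J-power k u ∙ J v) (Δ f)) m
      ≡⟨ cong (λ t → coeff (extend V V V (λ u v → J-power k u ∙ J v) t) m) (Δ-suffix f) ⟩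
    coeff (extend V V V (λ u v → J-power k u ∙ J v) (∑ᴹ V² (words (bound f)) (λ p → basis p ⊗ suffix f p))) m
      ≡⟨ linear-∑ᴹ (linear-∘ (coeff-linear m)
           (extend-linear (bilinear-∘ ∙-bilinear (J-power-linear k) J-linear))) (words (bound f)) _ ⟩
    ∑ᴹ ℚ¹ (words (bound f)) (λ p → product (coeff (J-power k (basis p))) (coeff (J (suffix f p))) m)
      ≡⟨ ∑ᴹ-zero {ℚ¹} (words (bound f)) summand ⟩
    0ℚ ∎
    where
    summand : ∀ p → product (coeff (J-power k (basis p))) (coeff (J (suffix f p))) m ≡ 0ℚ
    summand p with degree p ℕₚ.<? k
    ... | yes p<k = product-zero (coeff (J-power k (basis p))) (coeff (J (suffix f p))) m λ m₁ _ _ → inj₁ (J-power-vanishes k (basis p)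
      (λ n k≤n → basis-degree p n (ℕₚ.>⇒≢ (ℕₚ.<-≤-trans p<k k≤n))) m₁)
    ... | no  p≮k = product-zero (coeff (J-power k (basis p))) (coeff (J (suffix f p))) m λ _ m₂ _ → inj₂ (J-constant (suffix f p)
      (λ n n≢0 → h (p ++ n) (subst (suc k ≤_) (sym (degree-++ p n))
        (subst (_≤ degree p ℕ.+ degree n) (ℕₚ.+-comm k 1)
          (ℕₚ.+-mono-≤ (ℕₚ.≮⇒≥ p≮k) (ℕₚ.n≢0⇒n>0 n≢0))))) m₂)

  partial : ℕ → ∣ V ∣ → ∣ V ∣
  partial zero    f = uε f
  partial (suc k) f = partial k f V.+ᴹ sign (suc k) V.*ₗ J-power (suc k) f

  partial-linear : ∀ k → Endo (partial k)
  partial-linear zero    = uε-linear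
  partial-linear (suc k) = +ᴹ-linear (partial-linear k)
    (linear-∘ (*ₗ-linear (sign (suc k))) (J-power-linear (suc k)))

  -- Write `id` as `J + uε`; convolution with `uε` changes nothing.
  ⋆-id : ∀ {φ} → Endo φ → ∀ f m → coeff ((φ ⋆ id) f) m ≡ coeff (φ f) m + coeff ((φ ⋆ J) f) m
  ⋆-id {φ} l f m = begin
    coeff ((φ ⋆ id) f) m
      ≡⟨ ⋆-cong {φ} {φ} {id} {λ u → J u V.+ᴹ 1ℚ V.*ₗ uε u} (λ _ _ → refl) split-id f m ⟩
    coeff ((φ ⋆ (λ u → J u V.+ᴹ 1ℚ V.*ₗ uε u)) f) m
      ≡⟨ ⋆-+ʳ {φ} {J} {uε} 1ℚ f m ⟩
    coeff ((φ ⋆ J) f) m + 1ℚ * coeff ((φ ⋆ uε) f) m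
      ≡⟨ cong (λ z → coeff ((φ ⋆ J) f) m + 1ℚ * z) (⋆-uε l f m) ⟩
    coeff ((φ ⋆ J) f) m + 1ℚ * coeff (φ f) m
      ≡⟨ solve 2 (λ x y → x :+ con 1ℚ :* y := y :+ x) refl (coeff ((φ ⋆ J) f) m) (coeff (φ f) m) ⟩
    coeff (φ f) m + coeff ((φ ⋆ J) f) m ∎
    where
    open +-*-Solver
    split-id : ∀ u → u V.≈ᴹ (J u V.+ᴹ 1ℚ V.*ₗ uε u)
    split-id u k = solve 2 (λ x y → x := x :+ con (- 1ℚ) :* y :+ con 1ℚ :* y) refl (coeff u k) (coeff (uε u) k)

  id-⋆ : ∀ {φ} → Endo φ → ∀ f m → coeff ((id ⋆ φ) f) m ≡ coeff (φ f) m + coeff ((J ⋆ φ) f) m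
  id-⋆ {φ} l f m = begin
    coeff ((id ⋆ φ) f) m
      ≡⟨ ⋆-cong {id} {λ u → J u V.+ᴹ 1ℚ V.*ₗ uε u} {φ} {φ} split-id (λ _ _ → refl) f m ⟩
    coeff (((λ u → J u V.+ᴹ 1ℚ V.*ₗ uε u) ⋆ φ) f) m
      ≡⟨ ⋆-+ˡ {J} {uε} {φ} 1ℚ f m ⟩
    coeff ((J ⋆ φ) f) m + 1ℚ * coeff ((uε ⋆ φ) f) m
      ≡⟨ cong (λ z → coeff ((J ⋆ φ) f) m + 1ℚ * z) (uε-⋆ l f m) ⟩
    coeff ((J ⋆ φ) f) m + 1ℚ * coeff (φ f) m
      ≡⟨ solve 2 (λ x y → x :+ con 1ℚ :* y := y :+ x) refl (coeff ((J ⋆ φ) f) m) (coeff (φ f) m) ⟩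
    coeff (φ f) m + coeff ((J ⋆ φ) f) m ∎
    where
    open +-*-Solver
    split-id : ∀ u → u V.≈ᴹ (J u V.+ᴹ 1ℚ V.*ₗ uε u)
    split-id u k = solve 2 (λ x y → x := x :+ con (- 1ℚ) :* y :+ con 1ℚ :* y) refl (coeff u k) (coeff (uε u) k)

  telescope : ∀ x y z s → x + s * y + - s * (y + z) ≡ x + - s * z
  telescope = solve 4 (λ x y z s → x :+ s :* y :+ (:- s) :* (y :+ z) := x :+ (:- s) :* z) refl
    where open +-*-Solver

  -- The finite geometric series: since `id` is `uε + J`, consecutive terms cancel and only the last
  -- power of `J` remains.
  partial-⋆-id : ∀ k f m →
    coeff ((partial k ⋆ id) f) m ≡ coeff (uε f) m + sign k * coeff (J-power (suc k) f) m
  partial-⋆-id zero    f m = trans (⋆-id uε-linear f m)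
    (cong (coeff (uε f) m +_) (sym (ℚₚ.*-identityˡ _)))
  partial-⋆-id (suc k) f m = begin
    coeff ((partial (suc k) ⋆ id) f) m
      ≡⟨ ⋆-+ˡ {partial k} {J-power (suc k)} {id} (sign (suc k)) f m ⟩
    coeff ((partial k ⋆ id) f) m + sign (suc k) * coeff ((J-power (suc k) ⋆ id) f) m
      ≡⟨ cong₂ (λ x y → x + sign (suc k) * y) (partial-⋆-id k f m) (⋆-id (J-power-linear (suc k)) f m) ⟩
    coeff (uε f) m + sign k * coeff (J-power (suc k) f) m
      + sign (suc k) * (coeff (J-power (suc k) f) m + coeff (J-power (suc (suc k)) f) m)
      ≡⟨ telescope (coeff (uε f) m) (coeff (J-power (suc k) f) m) (coeff (J-power (suc (suc k)) f) m) (sign k) ⟩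
    coeff (uε f) m + sign (suc k) * coeff (J-power (suc (suc k)) f) m ∎

  id-⋆-partial : ∀ k f m →
    coeff ((id ⋆ partial k) f) m ≡ coeff (uε f) m + sign k * coeff (J-power (suc k) f) m
  id-⋆-partial zero    f m = trans (id-⋆ uε-linear f m)
    (cong (coeff (uε f) m +_) (trans (J-⋆-power 0 f m) (sym (ℚₚ.*-identityˡ _))))
  id-⋆-partial (suc k) f m = begin
    coeff ((id ⋆ partial (suc k)) f) m
      ≡⟨ ⋆-+ʳ {id} {partial k} {J-power (suc k)} (sign (suc k)) f m ⟩
    coeff ((id ⋆ partial k) f) m + sign (suc k) * coeff ((id ⋆ J-power (suc k)) f) m
      ≡⟨ cong₂ (λ x y → x + sign (suc k) * y) (id-⋆-partial k f m)
           (trans (id-⋆ (J-power-linear (suc k)) f m) (cong (coeff (J-power (suc k) f) m +_) (J-⋆-power (suc k) f m))) ⟩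
    coeff (uε f) m + sign k * coeff (J-power (suc k) f) m
      + sign (suc k) * (coeff (J-power (suc k) f) m + coeff (J-power (suc (suc k)) f) m)
      ≡⟨ telescope (coeff (uε f) m) (coeff (J-power (suc k) f) m) (coeff (J-power (suc (suc k)) f) m) (sign k) ⟩
    coeff (uε f) m + sign (suc k) * coeff (J-power (suc (suc k)) f) m ∎

  S : ∣ V ∣ → ∣ V ∣
  S f = partial (bound f) f

  J-power-bound : ∀ f k → bound f ≤ k → J-power (suc k) f V.≈ᴹ V.0ᴹ
  J-power-bound f k b≤k = J-power-vanishes (suc k) f
    (λ m k<d → vanishing f m (ℕₚ.≤-<-trans b≤k k<d))

  -- The bound is read off the proof of membership, so equal series, or a sum and its summands, may
  -- be truncated differently. Every comparison of values of `S` therefore goes through a common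
  -- larger index.
  S-stable : ∀ f k → bound f ≤ k → S f V.≈ᴹ partial k f
  S-stable f k b≤k m = subst (λ n → coeff (S f) m ≡ coeff (partial n f) m) (ℕₚ.m∸n+n≡m b≤k) (go (k ∸ bound f))
    where
    go : ∀ j → coeff (S f) m ≡ coeff (partial (j ℕ.+ bound f) f) m
    go zero    = refl
    go (suc j) = begin
      coeff (S f) m                            ≡⟨ go j ⟩
      x                                        ≡⟨ ℚₚ.+-identityʳ x ⟨
      x + 0ℚ                                   ≡⟨ cong (x +_) (ℚₚ.*-zeroʳ s) ⟨
      x + s * 0ℚ                               ≡⟨ cong (λ z → x + s * z)
        (J-power-bound f (j ℕ.+ bound f) (ℕₚ.m≤n+m (bound f) j) m) ⟨
      coeff (partial (suc j ℕ.+ bound f) f) m  ∎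
      where
      x = coeff (partial (j ℕ.+ bound f) f) m
      s = sign (suc (j ℕ.+ bound f))

  S-linear : Linear V V S
  S-linear = mkLinear
    (λ {f} {g} f≈g m → let N = bound f ⊔ bound g in
      trans (S-stable f N (ℕₚ.m≤m⊔n _ _) m)
        (trans (Linear.φ-cong (partial-linear N) f≈g m) (sym (S-stable g N (ℕₚ.m≤n⊔m (bound f) _) m))))
    (λ f g m → let N = bound f ⊔ bound g ⊔ bound (f V.+ᴹ g) in
      trans (S-stable (f V.+ᴹ g) N (ℕₚ.m≤n⊔m (bound f ⊔ bound g) _) m)
        (trans (Linear.φ-+ (partial-linear N) f g m)
          (sym (cong₂ _+_ (S-stable f N (ℕₚ.≤-trans (ℕₚ.m≤m⊔n (bound f) (bound g)) (ℕₚ.m≤m⊔n _ _)) m)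
                          (S-stable g N (ℕₚ.≤-trans (ℕₚ.m≤n⊔m (bound f) (bound g)) (ℕₚ.m≤m⊔n _ _)) m)))))
    (λ c f m → let N = bound f ⊔ bound (c V.*ₗ f) in
      trans (S-stable (c V.*ₗ f) N (ℕₚ.m≤n⊔m (bound f) _) m)
        (trans (Linear.φ-* (partial-linear N) c f m)
          (sym (cong (c *_) (S-stable f N (ℕₚ.m≤m⊔n _ _) m)))))

  antipodeˡ : ∀ f → extend V V V _∙_ (tensorMap V V V V S id (Δ f)) V.≈ᴹ (ε f V.*ₗ 1#)
  antipodeˡ f m = begin
    coeff (extend V V V _∙_ (tensorMap V V V V S id (Δ f))) m
      ≡⟨ extend-tensorMap {W = V} {φ = S} {id} _∙_ (Δ f) m ⟩
    coeff (extend V V V (λ u v → S u ∙ v) (Δ f)) m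
      ≡⟨ proj₂ eventually N (ℕₚ.m≤m⊔n (proj₁ eventually) (bound f)) m ⟩
    coeff ((partial N ⋆ id) f) m
      ≡⟨ partial-⋆-id N f m ⟩
    coeff (uε f) m + sign N * coeff (J-power (suc N) f) m
      ≡⟨ cong (λ z → coeff (uε f) m + sign N * z) (J-power-bound f N (ℕₚ.m≤n⊔m (proj₁ eventually) _) m) ⟩
    coeff (uε f) m + sign N * 0ℚ
      ≡⟨ trans (cong (coeff (uε f) m +_) (ℚₚ.*-zeroʳ (sign N))) (ℚₚ.+-identityʳ _) ⟩
    coeff (uε f) m ∎
    where
    eventually = extend-eventually {V} {V} {V} {λ u v → S u ∙ v} {λ M u v → partial M u ∙ v}
      (λ u v → bound u , λ M b≤M → product-cong {g = coeff v} (S-stable u M b≤M) (λ _ → refl)) (Δ f)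
    -- The first threshold lets `partial N` replace `S` on all left factors occurring in `Δ f`; the
    -- second makes the remainder `J-power (suc N) f` vanish.
    N = proj₁ eventually ⊔ bound f

  antipodeʳ : ∀ f → extend V V V _∙_ (tensorMap V V V V id S (Δ f)) V.≈ᴹ (ε f V.*ₗ 1#)
  antipodeʳ f m = begin
    coeff (extend V V V _∙_ (tensorMap V V V V id S (Δ f))) m
      ≡⟨ extend-tensorMap {W = V} {φ = id} {S} _∙_ (Δ f) m ⟩
    coeff (extend V V V (λ u v → u ∙ S v) (Δ f)) m
      ≡⟨ proj₂ eventually N (ℕₚ.m≤m⊔n (proj₁ eventually) (bound f)) m ⟩
    coeff ((id ⋆ partial N) f) m
      ≡⟨ id-⋆-partial N f m ⟩
    coeff (uε f) m + sign N * coeff (J-power (suc N) f) m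
      ≡⟨ cong (λ z → coeff (uε f) m + sign N * z) (J-power-bound f N (ℕₚ.m≤n⊔m (proj₁ eventually) _) m) ⟩
    coeff (uε f) m + sign N * 0ℚ
      ≡⟨ trans (cong (coeff (uε f) m +_) (ℚₚ.*-zeroʳ (sign N))) (ℚₚ.+-identityʳ _) ⟩
    coeff (uε f) m ∎
    where
    eventually = extend-eventually {V} {V} {V} {λ u v → u ∙ S v} {λ M u v → u ∙ partial M v}
      (λ u v → bound v , λ M b≤M → product-cong {f = coeff u} (λ _ → refl) (S-stable v M b≤M)) (Δ f)
    N = proj₁ eventually ⊔ bound f

  hopf : HopfAlgebra V FermionicDegree
  hopf = record
    { _∙_ = _∙_
    ; 1#  = 1#
    ; Δ   = Δ
    ; ε   = ε
    ; S   = S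
    ; isGrading = grading (λ x t → t) (λ x t → ℕₚ.m≤n+m t x)
    ; isRing = isRing
    ; scaleˡ = λ c f g → product-*ˡ c (coeff f) (coeff g)
    ; scaleʳ = λ c f g → product-*ʳ c (coeff f) (coeff g)
    ; Δ-linear = isLinear Δ-linear
    ; ε-linear = isLinear (coeff-linear [])
    ; coassociative = coassociative
    ; counitˡ = counitˡ
    ; counitʳ = counitʳ
    ; _⊛_ = _⊛_
    ; ⊛-linearˡ = λ t → isLinear (Bilinear.linearˡ ⊛-bilinear t)
    ; ⊛-linearʳ = λ s → isLinear (Bilinear.linearʳ ⊛-bilinear s)
    ; ⊛-sign = ⊛-sign
    ; Δ-∙ = Δ-∙
    ; Δ-1 = Δ-1
    ; ε-∙ = λ f g → trans (product-splitSum (coeff f) (coeff g) []) (trans (splitSum-[] _) (ℚₚ.*-identityˡ _))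
    ; ε-1 = refl
    ; S-linear = isLinear S-linear
    ; antipodeˡ = antipodeˡ
    ; antipodeʳ = antipodeʳ
    }

  isSuperspaceHopf : IsSuperspaceHopf hopf
  isSuperspaceHopf = record
    { ∙-series = λ _ _ _ → refl
    ; 1-series = λ _ → refl
    ; twoSets-injective = twoSets-injective
    ; Δ-union = Δ-union
    ; ε-const = λ _ → refl
    }

  signedCommutative : SignedCommutative hopf
  signedCommutative p q = product-comm p q

  gradedByDegree : IsGradedBy hopf Degree
  gradedByDegree = record
    { direct-sum = grading ℕ._+_ (λ _ _ → ℕₚ.≤-refl)
    ; ∙-graded   = λ p q → product-graded degree degree-split p q
    ; 1-graded   = one-≢0
    ; Δ-graded   = Δ-graded
    ; ε-graded   = λ 0<n p → p [] (ℕₚ.<⇒≢ 0<n)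
    }

-- Quasisymmetric series

module Inclusion {P Q : Subspace} (A : Admissible P) (B : Admissible Q)
                 (P⊆Q : ∀ {f} → Subspace.Member P f → Subspace.Member Q f) where
  private
    module P where
      open Coalgebra A public
      open Antipode A public
    module Q where
      open Coalgebra B public
      open Antipode B public

  ι : ∣ P.V ∣ → ∣ Q.V ∣
  ι f = coeff f , P⊆Q (Series.member f)

  ι-linear : Linear P.V Q.V ι
  ι-linear = mkLinear (λ p → p) (λ _ _ _ → refl) (λ _ _ _ → refl)

  twoSets-ι : ∀ t m n → twoSets (tensorMap P.V P.V Q.V Q.V ι ι t) m n ≡ twoSets t m n
  twoSets-ι (f ⊗ g) m n = refl
  twoSets-ι 0#      m n = refl
  twoSets-ι (s ⊕ t) m n = cong₂ _+_ (twoSets-ι s m n) (twoSets-ι t m n)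
  twoSets-ι (c · t) m n = cong (c *_) (twoSets-ι t m n)

  -- The two coproducts are sums over different families, so they are compared only through their
  -- coefficients, inside the tensor square of the larger space.
  ι-Δ : ∀ f → tensorMap P.V P.V Q.V Q.V ι ι (P.Δ f) Q.V².≈ᴹ Q.Δ (ι f)
  ι-Δ f = Q.twoSets-injective (tensorMap P.V P.V Q.V Q.V ι ι (P.Δ f)) (Q.Δ (ι f)) λ m n →
    trans (twoSets-ι (P.Δ f) m n) (trans (P.Δ-union f m n) (sym (Q.Δ-union (ι f) m n)))

  -- `ι` keeps coefficients, hence preserves products and `J`; with `ι-Δ` it carries one convolution
  -- to the other.
  ι-J-power : ∀ k f m → coeff (P.J-power k f) m ≡ coeff (Q.J-power k (ι f)) m
  ι-J-power zero    f m = refl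
  ι-J-power (suc k) f m = begin
    coeff (extend P.V P.V P.V (λ u v → P.J-power k u P.∙ P.J v) (P.Δ f)) m
      ≡⟨ linear-extend ι-linear (P.Δ f) m ⟩
    coeff (extend P.V P.V Q.V (λ u v → ι (P.J-power k u P.∙ P.J v)) (P.Δ f)) m
      ≡⟨ extend-pointwise {W = Q.V} (λ u v → product-cong (ι-J-power k u) (λ _ → refl)) (P.Δ f) m ⟩
    coeff (extend P.V P.V Q.V (λ u v → Q.J-power k (ι u) Q.∙ Q.J (ι v)) (P.Δ f)) m
      ≡⟨ extend-tensorMap {W = Q.V} {φ = ι} {ι} (λ u v → Q.J-power k u Q.∙ Q.J v) (P.Δ f) m ⟨
    coeff (extend Q.V Q.V Q.V (λ u v → Q.J-power k u Q.∙ Q.J v) (tensorMap P.V P.V Q.V Q.V ι ι (P.Δ f))) m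
      ≡⟨ extend-cong (bilinear-∘ Q.∙-bilinear (Q.J-power-linear k) Q.J-linear) (ι-Δ f) m ⟩
    coeff (extend Q.V Q.V Q.V (λ u v → Q.J-power k u Q.∙ Q.J v) (Q.Δ (ι f))) m ∎

  ι-partial : ∀ k f m → coeff (P.partial k f) m ≡ coeff (Q.partial k (ι f)) m
  ι-partial zero    f m = refl
  ι-partial (suc k) f m = cong₂ _+_ (ι-partial k f m) (cong (sign (suc k) *_) (ι-J-power (suc k) f m))

  ι-S : ∀ f → ι (P.S f) Q.V.≈ᴹ Q.S (ι f)
  ι-S f m = begin
    coeff (P.S f) m             ≡⟨ P.S-stable f N (ℕₚ.m≤m⊔n (P.bound f) _) m ⟩
    coeff (P.partial N f) m     ≡⟨ ι-partial N f m ⟩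
    coeff (Q.partial N (ι f)) m ≡⟨ Q.S-stable (ι f) N (ℕₚ.m≤n⊔m (P.bound f) _) m ⟨
    coeff (Q.S (ι f)) m         ∎
    where N = P.bound f ⊔ Q.bound (ι f)

  isHopfSubalgebra : IsHopfSubalgebra P.hopf Q.hopf ι
  isHopfSubalgebra = record
    { ι-linear    = isLinear ι-linear
    ; ι-injective = λ p → p
    ; ι-Deg       = λ p → p
    ; ι-∙ = λ _ _ _ → refl
    ; ι-1 = λ _ → refl
    ; ι-Δ = ι-Δ
    ; ι-ε = λ _ → refl
    ; ι-S = ι-S
    }

-- Reduced monomials and the monomial quasisymmetric functions

trivial? : ∀ e → e ≡ trivial ⊎ e ≢ trivial
trivial? (zero  , false) = inj₁ refl
trivial? (suc a , false) = inj₂ λ ()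
trivial? (a     , true)  = inj₂ λ ()

exponent : Part → Exponent
exponent (undotted a) = a , false
exponent (dotted a)   = a , true

-- A normal form: the shortest monomial with the same dotted composition. A trivial-invariant series
-- is determined by its values on these.
reduced : Monomial → Monomial
reduced m = map exponent (composition m)

reduced-∷ : ∀ e m → e ≢ trivial → reduced (e ∷ m) ≡ e ∷ reduced m
reduced-∷ (zero  , false) m p = contradiction refl p
reduced-∷ (suc a , false) m p = refl
reduced-∷ (zero  , true)  m p = refl
reduced-∷ (suc a , true)  m p = refl

reduced-++ : ∀ m n → reduced (m ++ n) ≡ reduced m ++ reduced n
reduced-++ m n = trans (cong (map exponent) (mapMaybe-++ part m n))
  (map-++ exponent (composition m) (composition n))

composition-trivial : ∀ m n → composition (m ++ trivial ∷ n) ≡ composition (m ++ n)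
composition-trivial m n = trans (mapMaybe-++ part m (trivial ∷ n)) (sym (mapMaybe-++ part m n))

degree-∷ : ∀ e m → degree (e ∷ m) ≡ degree [ e ] ℕ.+ degree m
degree-∷ e m = degree-++ [ e ] m

degree-reduced : ∀ m → degree (reduced m) ≡ degree m
degree-reduced []      = refl
degree-reduced (e ∷ m) with trivial? e
... | inj₁ refl = degree-reduced m
... | inj₂ p    = begin
  degree (reduced (e ∷ m))              ≡⟨ cong degree (reduced-∷ e m p) ⟩
  degree (e ∷ reduced m)                ≡⟨ degree-∷ e (reduced m) ⟩
  degree [ e ] ℕ.+ degree (reduced m)   ≡⟨ cong (degree [ e ] ℕ.+_) (degree-reduced m) ⟩
  degree [ e ] ℕ.+ degree m             ≡⟨ degree-∷ e m ⟨
  degree (e ∷ m)                        ∎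

trivialInvariant-reduced : ∀ {f} → TrivialInvariant f → ∀ m → f m ≡ f (reduced m)
trivialInvariant-reduced h []      = refl
trivialInvariant-reduced {f} h (e ∷ m) with trivial? e
... | inj₁ refl = trans (h [] m) (trivialInvariant-reduced h m)
... | inj₂ p    = trans (trivialInvariant-reduced (λ k n → h (e ∷ k) n) m)
  (cong f (sym (reduced-∷ e m p)))

quasisymmetric⇒trivialInvariant : ∀ {f} → Quasisymmetric f → TrivialInvariant f
quasisymmetric⇒trivialInvariant h m n =
  h (composition (m ++ n)) (m ++ trivial ∷ n) (m ++ n) (composition-trivial m n) refl

trivialInvariant⇒quasisymmetric : ∀ {f} → TrivialInvariant f → Quasisymmetric f
trivialInvariant⇒quasisymmetric {f} h α m m′ p q = trans (trivialInvariant-reduced h m)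
  (trans (cong (λ c → f (map exponent c)) (trans p (sym q))) (sym (trivialInvariant-reduced h m′)))

trivialInvariant⇒wellDefined : ∀ {f} → TrivialInvariant f → WellDefined f
trivialInvariant⇒wellDefined {f} h m = trans (h m []) (cong f (++-identityʳ m))

_≟ₘ_ : DecidableEquality Monomial
_≟ₘ_ = ≡-dec (×ₚ.≡-dec ℕₚ._≟_ 𝔹ₚ._≟_)

-- A word `p` with a trivial entry is no `reduced m` and gives the zero series, so lists of words
-- need not be restricted to reduced ones.
monomialQuasisymmetric : Monomial → Coefficients
monomialQuasisymmetric p m with p ≟ₘ reduced m
... | yes _ = 1ℚ
... | no _  = 0ℚ

monomialQuasisymmetric-≡ : ∀ m → monomialQuasisymmetric (reduced m) m ≡ 1ℚ
monomialQuasisymmetric-≡ m with reduced m ≟ₘ reduced m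
... | yes _ = refl
... | no p  = contradiction refl p

monomialQuasisymmetric-≢ : ∀ p m → p ≢ reduced m → monomialQuasisymmetric p m ≡ 0ℚ
monomialQuasisymmetric-≢ p m q with p ≟ₘ reduced m
... | yes e = contradiction e q
... | no _  = refl

monomialQuasisymmetric-trivialInvariant : ∀ p → TrivialInvariant (monomialQuasisymmetric p)
monomialQuasisymmetric-trivialInvariant p m n with p ≟ₘ reduced (m ++ trivial ∷ n) | p ≟ₘ reduced (m ++ n)
... | yes _ | yes _ = refl
... | no _  | no _  = refl
... | yes q | no r  = contradiction (trans q (cong (map exponent) (composition-trivial m n))) r
... | no q  | yes r = contradiction (trans r (cong (map exponent) (sym (composition-trivial m n)))) q

monomialQuasisymmetric-degree : ∀ p m → degree m ≢ degree p → monomialQuasisymmetric p m ≡ 0ℚ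
monomialQuasisymmetric-degree p m q =
  monomialQuasisymmetric-≢ p m (λ { refl → q (sym (degree-reduced m)) })

∑-single : ∀ {A : Set} {xs : List A} {x} (F : A → ℚ) → Unique xs → x ∈ xs →
           (∀ y → y ≢ x → F y ≡ 0ℚ) → ∑ xs F ≡ F x
∑-single {xs = y ∷ xs} {x} F (p ∷ u) (here refl) h = begin
  ∑ (x ∷ xs) F    ≡⟨ ∑-∷ x xs F ⟩
  F x + ∑ xs F    ≡⟨ cong (F x +_) (rest p) ⟩
  F x + 0ℚ        ≡⟨ ℚₚ.+-identityʳ (F x) ⟩
  F x             ∎
  where
  rest : ∀ {ys} → All (x ≢_) ys → ∑ ys F ≡ 0ℚ
  rest []       = ∑-[] F
  rest (q ∷ qs) = trans (∑-∷ _ _ F) (trans (cong₂ _+_ (h _ (q ∘ sym)) (rest qs)) (ℚₚ.+-identityˡ 0ℚ))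
∑-single {xs = y ∷ xs} {x} F (p ∷ u) (there x∈xs) h = begin
  ∑ (y ∷ xs) F    ≡⟨ ∑-∷ y xs F ⟩
  F y + ∑ xs F    ≡⟨ cong₂ _+_ (h y (All.lookup p x∈xs)) (∑-single F u x∈xs h) ⟩
  0ℚ + F x        ≡⟨ ℚₚ.+-identityˡ (F x) ⟩
  F x             ∎

exponentsUpTo : ℕ → List Exponent
exponentsUpTo N = cartesianProduct (upTo (suc N)) (false ∷ true ∷ [])

-- Length at most `k` and x-exponents at most `N`. This overshoots the words of degree at most `N`,
-- but stays finite and is easily seen to be free of repetitions.
wordsUpTo : ℕ → ℕ → List Monomial
wordsUpTo zero    N = [ [] ]
wordsUpTo (suc k) N = [] ∷ cartesianProductWith _∷_ (exponentsUpTo N) (wordsUpTo k N)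

wordsUpTo-unique : ∀ k N → Unique (wordsUpTo k N)
wordsUpTo-unique zero    N = [] ∷ []
wordsUpTo-unique (suc k) N = All.tabulate []≢ ∷
  Unique.cartesianProductWith⁺ _∷_ ∷-injective
    (Unique.cartesianProduct⁺ (Unique.upTo⁺ (suc N)) (((λ ()) ∷ []) ∷ [] ∷ []))
    (wordsUpTo-unique k N)
  where
  []≢ : ∀ {p} → p ∈ cartesianProductWith _∷_ (exponentsUpTo N) (wordsUpTo k N) → [] ≢ p
  []≢ p∈ refl with ∈-cartesianProductWith⁻ _∷_ (exponentsUpTo N) (wordsUpTo k N) p∈
  ... | _ , _ , _ , _ , ()

degree-exponent>0 : ∀ α → 1 ≤ degree [ exponent α ]
degree-exponent>0 (undotted a) = ℕₚ.≤-trans (ℕ.>-nonZero⁻¹ a) (ℕₚ.≤-trans (ℕₚ.m≤m+n a 0) (ℕₚ.m≤m+n (a ℕ.+ 0) 0))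
degree-exponent>0 (dotted a)   = ℕₚ.m≤n+m 1 (a ℕ.+ 0)

exponent∈ : ∀ {N} α → degree [ exponent α ] ≤ N → exponent α ∈ exponentsUpTo N
exponent∈ (undotted a) p = ∈-cartesianProduct⁺
  (∈-upTo⁺ (s≤s (ℕₚ.≤-trans (ℕₚ.m≤m+n a 0) (ℕₚ.≤-trans (ℕₚ.m≤m+n (a ℕ.+ 0) 0) p)))) (here refl)
exponent∈ (dotted a)   p = ∈-cartesianProduct⁺
  (∈-upTo⁺ (s≤s (ℕₚ.≤-trans (ℕₚ.m≤m+n a 0) (ℕₚ.≤-trans (ℕₚ.m≤m+n (a ℕ.+ 0) 1) p)))) (there (here refl))

-- Every entry coming from a part has degree at least 1, so the degree bounds the length. The bounds
-- on the length and on the entries are kept apart because only the former drops in the recursion.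
exponents∈ : ∀ k N α → degree (map exponent α) ≤ k → degree (map exponent α) ≤ N →
             map exponent α ∈ wordsUpTo k N
exponents∈ zero    N []      p q = here refl
exponents∈ (suc k) N []      p q = here refl
exponents∈ zero    N (a ∷ α) p q with () ← ℕₚ.≤-trans (degree-exponent>0 a)
  (ℕₚ.≤-trans (ℕₚ.m≤m+n _ (degree (map exponent α)))
    (subst (_≤ 0) (degree-∷ (exponent a) (map exponent α)) p))
exponents∈ (suc k) N (a ∷ α) p q = there (∈-cartesianProductWith⁺ _∷_
  (exponent∈ a (ℕₚ.≤-trans (ℕₚ.m≤m+n _ (degree (map exponent α))) q′))
  (exponents∈ k N α
    (ℕₚ.+-cancelˡ-≤ 1 _ _ (ℕₚ.≤-trans (ℕₚ.+-monoˡ-≤ (degree (map exponent α)) (degree-exponent>0 a))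
      (subst (_≤ suc k) (degree-∷ (exponent a) (map exponent α)) p)))
    (ℕₚ.≤-trans (ℕₚ.m≤n+m (degree (map exponent α)) (degree [ exponent a ])) q′)))
  where q′ = subst (_≤ N) (degree-∷ (exponent a) (map exponent α)) q

monomialQuasisymmetric-expansion : ∀ {f} → TrivialInvariant f → ∀ N → (∀ m → N < degree m → f m ≡ 0ℚ) →
  ∀ m → f m ≡ ∑ (wordsUpTo N N) (λ p → f p * monomialQuasisymmetric p m)
monomialQuasisymmetric-expansion {f} h N vanish m with degree m ℕₚ.≤? N
... | yes d≤N = begin
  f m                                                          ≡⟨ trivialInvariant-reduced h m ⟩
  f (reduced m)                                                ≡⟨ ℚₚ.*-identityʳ _ ⟨
  f (reduced m) * 1ℚ                                           ≡⟨ cong (f (reduced m) *_) (monomialQuasisymmetric-≡ m) ⟨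
  f (reduced m) * monomialQuasisymmetric (reduced m) m         ≡⟨ ∑-single _ (wordsUpTo-unique N N)
    (exponents∈ N N (composition m) d′≤N d′≤N)
    (λ p p≢ → trans (cong (f p *_) (monomialQuasisymmetric-≢ p m p≢)) (ℚₚ.*-zeroʳ (f p))) ⟨
  ∑ (wordsUpTo N N) (λ p → f p * monomialQuasisymmetric p m)   ∎
  where
  d′≤N : degree (reduced m) ≤ N
  d′≤N = subst (_≤ N) (sym (degree-reduced m)) d≤N
-- Beyond the bound both sides vanish: a word whose basis series is nonzero at `m` equals
-- `reduced m`, which has the degree of `m`, and there `f` is 0.
... | no d≰N = trans (vanish m (ℕₚ.≰⇒> d≰N)) (sym (∑-zero (wordsUpTo N N) summand))
  where
  summand : ∀ p → f p * monomialQuasisymmetric p m ≡ 0ℚ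
  summand p with p ≟ₘ reduced m
  ... | yes refl = trans (ℚₚ.*-identityʳ _)
    (vanish (reduced m) (subst (N <_) (sym (degree-reduced m)) (ℕₚ.≰⇒> d≰N)))
  ... | no _     = ℚₚ.*-zeroʳ (f p)

-- Closure properties of quasisymmetric series

bounded-one : Bounded one
bounded-one = 0 , λ m 0<d → one-≢0 m (ℕₚ.>⇒≢ 0<d)

bounded-product : ∀ {f g} → Bounded f → Bounded g → Bounded (product f g)
bounded-product (M , p) (N , q) = M ℕ.+ N , product-bounded p q

bounded-weight : ∀ {f} (w : Monomial → ℚ) → Bounded f → Bounded (λ m → w m * f m)
bounded-weight w (N , p) = N , λ m N<d → trans (cong (w m *_) (p m N<d)) (ℚₚ.*-zeroʳ (w m))

bounded-prefix : ∀ {f} n → Bounded f → Bounded (λ m → f (m ++ n))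
bounded-prefix n (N , p) = N , λ m N<d → p (m ++ n)
  (ℕₚ.<-≤-trans N<d (subst (degree m ≤_) (sym (degree-++ m n)) (ℕₚ.m≤m+n _ _)))

bounded-suffix : ∀ {f} m → Bounded f → Bounded (λ n → f (m ++ n))
bounded-suffix m (N , p) = N , λ n N<d → p (m ++ n)
  (ℕₚ.<-≤-trans N<d (subst (degree n ≤_) (sym (degree-++ m n)) (ℕₚ.m≤n+m (degree n) (degree m))))

bounded-degree : ∀ {f} d → (∀ m → degree m ≢ d → f m ≡ 0ℚ) → Bounded f
bounded-degree d p = d , λ m d<m → p m (ℕₚ.>⇒≢ d<m)

one-trivialInvariant : TrivialInvariant one
one-trivialInvariant m n = cong (λ d → kronecker d 0) (trans (degree-++ m (trivial ∷ n)) (sym (degree-++ m n)))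

weight-trivialInvariant : ∀ {f} (w : ℕ → ℕ → ℚ) → TrivialInvariant f →
  TrivialInvariant (λ m → w (xDegree m) (θDegree m) * f m)
weight-trivialInvariant w h m n = cong₂ _*_
  (cong₂ w (trans (xDegree-++ m (trivial ∷ n)) (sym (xDegree-++ m n)))
           (trans (θDegree-++ m (trivial ∷ n)) (sym (θDegree-++ m n))))
  (h m n)

prefix-trivialInvariant : ∀ {f} n → TrivialInvariant f → TrivialInvariant (λ m → f (m ++ n))
prefix-trivialInvariant {f} n h k l = begin
  f ((k ++ trivial ∷ l) ++ n)  ≡⟨ cong f (++-assoc k (trivial ∷ l) n) ⟩
  f (k ++ trivial ∷ (l ++ n))  ≡⟨ h k (l ++ n) ⟩
  f (k ++ (l ++ n))            ≡⟨ cong f (++-assoc k l n) ⟨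
  f ((k ++ l) ++ n)            ∎

suffix-trivialInvariant : ∀ {f} m → TrivialInvariant f → TrivialInvariant (λ n → f (m ++ n))
suffix-trivialInvariant {f} m h k l = begin
  f (m ++ (k ++ trivial ∷ l))  ≡⟨ cong f (++-assoc m k (trivial ∷ l)) ⟨
  f ((m ++ k) ++ trivial ∷ l)  ≡⟨ h (m ++ k) l ⟩
  f ((m ++ k) ++ l)            ≡⟨ cong f (++-assoc m k l) ⟩
  f (m ++ (k ++ l))            ∎

sQSym-member : ∀ {f} → Bounded f → TrivialInvariant f → Subspace.Member sQSymSubspace f
sQSym-member b h = trivialInvariant⇒wellDefined h , b , trivialInvariant⇒quasisymmetric h

sQSym-trivialInvariant : ∀ {f} → Subspace.Member sQSymSubspace f → TrivialInvariant f
sQSym-trivialInvariant (_ , _ , h) = quasisymmetric⇒trivialInvariant h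

sQSym-admissible : Admissible sQSymSubspace
sQSym-admissible = record
  { bounded-member          = λ (_ , b , _) → b
  ; trivialInvariant-member = sQSym-trivialInvariant
  ; one-member     = sQSym-member bounded-one one-trivialInvariant
  ; product-member = λ {f} {g} p@(_ , b , _) q@(_ , c , _) → sQSym-member (bounded-product {f} {g} b c)
      (product-trivialInvariant {f} {g} (sQSym-trivialInvariant p) (sQSym-trivialInvariant q))
  ; weight-member  = λ {f} w p@(_ , b , _) → sQSym-member (bounded-weight (λ m → w (xDegree m) (θDegree m)) b)
      (weight-trivialInvariant {f} w (sQSym-trivialInvariant p))
  ; prefix-member  = λ {f} n p@(_ , b , _) → sQSym-member (bounded-prefix {f} n b)
      (prefix-trivialInvariant {f} n (sQSym-trivialInvariant p))
  ; suffix-member  = λ {f} m p@(_ , b , _) → sQSym-member (bounded-suffix {f} m b)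
      (suffix-trivialInvariant {f} m (sQSym-trivialInvariant p))
  ; words = λ N → wordsUpTo N N
  ; basis = λ p → monomialQuasisymmetric p ,
      sQSym-member (bounded-degree (degree p) (monomialQuasisymmetric-degree p))
        (monomialQuasisymmetric-trivialInvariant p)
  ; basis-degree = monomialQuasisymmetric-degree
  ; expansion = λ p N vanish → monomialQuasisymmetric-expansion (sQSym-trivialInvariant p) N vanish
  }

-- Symmetrization

opaque
  unfolding expSum

  expSum-splitExponent : ∀ e F → expSum e F ≡ ∑ (splitExponent e) (λ p → F (proj₁ p) (proj₂ p))
  expSum-splitExponent e F = refl

  expSum-* : ∀ e c F → expSum e (λ i j → c * F i j) ≡ c * expSum e F
  expSum-* e c F = ∑-* (splitExponent e) c (λ p → F (proj₁ p) (proj₂ p))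

expSum-comm : ∀ x y (F : Exponent → Exponent → Exponent → Exponent → ℚ) →
  expSum x (λ x₁ x₂ → expSum y (F x₁ x₂)) ≡ expSum y (λ y₁ y₂ → expSum x (λ x₁ x₂ → F x₁ x₂ y₁ y₂))
expSum-comm x y F = trans
  (expSum-cong x (λ x₁ x₂ _ → expSum-splitExponent y (F x₁ x₂)))
  (trans (expSum-∑ x (splitExponent y) (λ x₁ x₂ p → F x₁ x₂ (proj₁ p) (proj₂ p)))
    (sym (expSum-splitExponent y (λ y₁ y₂ → expSum x (λ x₁ x₂ → F x₁ x₂ y₁ y₂)))))

splitSum-∷-∷ : ∀ x y n F → splitSum (x ∷ y ∷ n) F ≡
  expSum x (λ x₁ x₂ → expSum y (λ y₁ y₂ → splitSum n (λ n₁ n₂ → F (x₁ ∷ y₁ ∷ n₁) (x₂ ∷ y₂ ∷ n₂))))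
splitSum-∷-∷ x y n F = trans (splitSum-∷ x (y ∷ n) F)
  (expSum-cong x (λ x₁ x₂ _ → splitSum-∷ y n (λ n₁ n₂ → F (x₁ ∷ n₁) (x₂ ∷ n₂))))

swapSign : Exponent → Exponent → ℚ
swapSign (_ , η) (_ , η′) = sign (fermionic η ℕ.* fermionic η′)

swapSign-sym : ∀ x y → swapSign x y ≡ swapSign y x
swapSign-sym (_ , η) (_ , η′) = cong sign (ℕₚ.*-comm (fermionic η) (fermionic η′))

swapSign-square : ∀ x y → swapSign x y * swapSign x y ≡ 1ℚ
swapSign-square (_ , η) (_ , η′) = sign-square (fermionic η ℕ.* fermionic η′)

-- The quantified prefix lets the property pass to n ↦ f(z ∷ n), which is what drives the recursions
-- on monomials.
AdjacentSymmetric : Coefficients → Set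
AdjacentSymmetric f = ∀ m x y n → f (m ++ x ∷ y ∷ n) ≡ swapSign x y * f (m ++ y ∷ x ∷ n)

xDegree-swap : ∀ m x y n → xDegree (m ++ x ∷ y ∷ n) ≡ xDegree (m ++ y ∷ x ∷ n)
xDegree-swap m x y n = trans (xDegree-++ m (x ∷ y ∷ n))
  (trans (cong (xDegree m ℕ.+_)
      (solve 3 (λ a b c → a :+ (b :+ c) := b :+ (a :+ c)) refl (proj₁ x) (proj₁ y) (xDegree n)))
    (sym (xDegree-++ m (y ∷ x ∷ n))))
  where open ℕSolver.+-*-Solver

θDegree-swap : ∀ m x y n → θDegree (m ++ x ∷ y ∷ n) ≡ θDegree (m ++ y ∷ x ∷ n)
θDegree-swap m x y n = trans (θDegree-++ m (x ∷ y ∷ n))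
  (trans (cong (θDegree m ℕ.+_)
      (solve 3 (λ a b c → a :+ (b :+ c) := b :+ (a :+ c)) refl
        (fermionic (proj₂ x)) (fermionic (proj₂ y)) (θDegree n)))
    (sym (θDegree-++ m (y ∷ x ∷ n))))
  where open ℕSolver.+-*-Solver

-- The sign is -1 only if both entries carry a θ, and then both monomials have positive degree and
-- coefficient 0.
one-adjacentSymmetric : AdjacentSymmetric one
one-adjacentSymmetric m x@(a , true) y@(b , true) n = begin
  one (m ++ x ∷ y ∷ n)          ≡⟨ one-≢0 (m ++ x ∷ y ∷ n) (≢0 x y) ⟩
  0ℚ                            ≡⟨ ℚₚ.*-zeroʳ (- 1ℚ) ⟨
  - 1ℚ * 0ℚ                     ≡⟨ cong (- 1ℚ *_) (one-≢0 (m ++ y ∷ x ∷ n) (≢0 y x)) ⟨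
  - 1ℚ * one (m ++ y ∷ x ∷ n)   ∎
  where
  ≢0 : ∀ x y → degree (m ++ (proj₁ x , true) ∷ y ∷ n) ≢ 0
  ≢0 x y p = degree-∷≢0 {proj₁ x , true} (y ∷ n) (λ ())
    (ℕₚ.m+n≡0⇒n≡0 (degree m) (trans (sym (degree-++ m ((proj₁ x , true) ∷ y ∷ n))) p))
one-adjacentSymmetric m x@(a , true)  y@(b , false) n = trans
  (cong (λ d → kronecker d 0) (cong₂ ℕ._+_ (xDegree-swap m x y n) (θDegree-swap m x y n))) (sym (ℚₚ.*-identityˡ _))
one-adjacentSymmetric m x@(a , false) y             n = trans
  (cong (λ d → kronecker d 0) (cong₂ ℕ._+_ (xDegree-swap m x y n) (θDegree-swap m x y n))) (sym (ℚₚ.*-identityˡ _))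

weight-adjacentSymmetric : ∀ {f} (w : ℕ → ℕ → ℚ) → AdjacentSymmetric f →
  AdjacentSymmetric (λ m → w (xDegree m) (θDegree m) * f m)
weight-adjacentSymmetric {f} w h m x y n = trans
  (cong₂ _*_ (cong₂ w (xDegree-swap m x y n) (θDegree-swap m x y n)) (h m x y n))
  (solve 3 (λ w s z → w :* (s :* z) := s :* (w :* z)) refl
    (w (xDegree (m ++ y ∷ x ∷ n)) (θDegree (m ++ y ∷ x ∷ n))) (swapSign x y) (f (m ++ y ∷ x ∷ n)))
  where open +-*-Solver

prefix-adjacentSymmetric : ∀ {f} n → AdjacentSymmetric f → AdjacentSymmetric (λ m → f (m ++ n))
prefix-adjacentSymmetric {f} n h k x y l = begin
  f ((k ++ x ∷ y ∷ l) ++ n)                 ≡⟨ cong f (++-assoc k (x ∷ y ∷ l) n) ⟩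
  f (k ++ x ∷ y ∷ (l ++ n))                 ≡⟨ h k x y (l ++ n) ⟩
  swapSign x y * f (k ++ y ∷ x ∷ (l ++ n))  ≡⟨ cong (λ z → swapSign x y * f z) (++-assoc k (y ∷ x ∷ l) n) ⟨
  swapSign x y * f ((k ++ y ∷ x ∷ l) ++ n)  ∎

suffix-adjacentSymmetric : ∀ {f} m → AdjacentSymmetric f → AdjacentSymmetric (λ n → f (m ++ n))
suffix-adjacentSymmetric {f} m h k x y l = begin
  f (m ++ (k ++ x ∷ y ∷ l))                 ≡⟨ cong f (++-assoc m k (x ∷ y ∷ l)) ⟨
  f ((m ++ k) ++ x ∷ y ∷ l)                 ≡⟨ h (m ++ k) x y l ⟩
  swapSign x y * f ((m ++ k) ++ y ∷ x ∷ l)  ≡⟨ cong (λ z → swapSign x y * f z) (++-assoc m k (y ∷ x ∷ l)) ⟩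
  swapSign x y * f (m ++ (k ++ y ∷ x ∷ l))  ∎

-- Exchanging `x` and `y` exchanges their parts in both factors of every decomposition. The prefix
-- and the total θ-degrees are unaffected, so only the crossings of the two entries and the two
-- exchange signs have to be balanced, in `signs`.
product-adjacentSymmetric : ∀ {f g} → AdjacentSymmetric f → AdjacentSymmetric g →
                            AdjacentSymmetric (product f g)
product-adjacentSymmetric {f} {g} p q m x y n = begin
  product f g (m ++ x ∷ y ∷ n)
    ≡⟨ product-++ f g m (x ∷ y ∷ n) ⟩
  splitSum m (λ m₁ m₂ → splitSum (x ∷ y ∷ n) (G m₁ m₂))
    ≡⟨ splitSum-cong m (λ m₁ m₂ _ → swapped m₁ m₂) ⟩
  splitSum m (λ m₁ m₂ → swapSign x y * splitSum (y ∷ x ∷ n) (G m₁ m₂))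
    ≡⟨ splitSum-* m (swapSign x y) (λ m₁ m₂ → splitSum (y ∷ x ∷ n) (G m₁ m₂)) ⟩
  swapSign x y * splitSum m (λ m₁ m₂ → splitSum (y ∷ x ∷ n) (G m₁ m₂))
    ≡⟨ cong (swapSign x y *_) (product-++ f g m (y ∷ x ∷ n)) ⟨
  swapSign x y * product f g (m ++ y ∷ x ∷ n) ∎
  where
  G : (m₁ m₂ n₁ n₂ : Monomial) → ℚ
  G m₁ m₂ n₁ n₂ = sign (crossings m₁ m₂) * sign (crossings n₁ n₂) * sign (θDegree m₂ ℕ.* θDegree n₁)
    * (f (m₁ ++ n₁) * g (m₂ ++ n₂))

  signs : ∀ {x₁ x₂ y₁ y₂} → SplitExponent x₁ x₂ x → SplitExponent y₁ y₂ y → ∀ n₁ n₂ →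
    sign (crossings (x₁ ∷ y₁ ∷ n₁) (x₂ ∷ y₂ ∷ n₂)) * swapSign x₁ y₁ * swapSign x₂ y₂ ≡
    swapSign x y * sign (crossings (y₁ ∷ x₁ ∷ n₁) (y₂ ∷ x₂ ∷ n₂))
  signs (split {η₁ = ξ₁} {ξ₂} {ξ} _ u) (split {η₁ = υ₁} {υ₂} {υ} _ v) n₁ n₂ = begin
    sign c * sign (X₁ ℕ.* Y₁) * sign (X₂ ℕ.* Y₂)
      ≡⟨ trans (sign-+ (c ℕ.+ X₁ ℕ.* Y₁) (X₂ ℕ.* Y₂)) (cong (_* sign (X₂ ℕ.* Y₂)) (sign-+ c (X₁ ℕ.* Y₁))) ⟨
    sign (c ℕ.+ X₁ ℕ.* Y₁ ℕ.+ X₂ ℕ.* Y₂)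
      -- An even term is added: one copy of X₁Y₂ completes the product (X₁ + X₂)(Y₁ + Y₂), the other
      -- is the crossing present in `c′` but not in `c`.
      ≡⟨ sign-cancel (c ℕ.+ X₁ ℕ.* Y₁ ℕ.+ X₂ ℕ.* Y₂) (X₁ ℕ.* Y₂) ⟨
    sign (c ℕ.+ X₁ ℕ.* Y₁ ℕ.+ X₂ ℕ.* Y₂ ℕ.+ (X₁ ℕ.* Y₂ ℕ.+ X₁ ℕ.* Y₂))
      ≡⟨ cong sign (solve 6 (λ X₁ X₂ Y₁ Y₂ t C →
           X₂ :* (Y₁ :+ t) :+ (Y₂ :* t :+ C) :+ X₁ :* Y₁ :+ X₂ :* Y₂ :+ (X₁ :* Y₂ :+ X₁ :* Y₂) :=
           (X₁ :+ X₂) :* (Y₁ :+ Y₂) :+ (Y₂ :* (X₁ :+ t) :+ (X₂ :* t :+ C))) refl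
           X₁ X₂ Y₁ Y₂ (θDegree n₁) (crossings n₁ n₂)) ⟩
    sign ((X₁ ℕ.+ X₂) ℕ.* (Y₁ ℕ.+ Y₂) ℕ.+ c′)
      ≡⟨ cong₂ (λ a b → sign (a ℕ.* b ℕ.+ c′)) u v ⟩
    sign (fermionic ξ ℕ.* fermionic υ ℕ.+ c′)
      ≡⟨ sign-+ (fermionic ξ ℕ.* fermionic υ) c′ ⟩
    sign (fermionic ξ ℕ.* fermionic υ) * sign c′ ∎
    where
    open ℕSolver.+-*-Solver
    X₁ = fermionic ξ₁
    X₂ = fermionic ξ₂
    Y₁ = fermionic υ₁
    Y₂ = fermionic υ₂
    c = X₂ ℕ.* (Y₁ ℕ.+ θDegree n₁) ℕ.+ (Y₂ ℕ.* θDegree n₁ ℕ.+ crossings n₁ n₂)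
    c′ = Y₂ ℕ.* (X₁ ℕ.+ θDegree n₁) ℕ.+ (X₂ ℕ.* θDegree n₁ ℕ.+ crossings n₁ n₂)

  entry : ∀ m₁ m₂ x₁ x₂ y₁ y₂ n₁ n₂ → SplitExponent x₁ x₂ x → SplitExponent y₁ y₂ y →
    G m₁ m₂ (x₁ ∷ y₁ ∷ n₁) (x₂ ∷ y₂ ∷ n₂) ≡ swapSign x y * G m₁ m₂ (y₁ ∷ x₁ ∷ n₁) (y₂ ∷ x₂ ∷ n₂)
  entry m₁ m₂ x₁ x₂ y₁ y₂ n₁ n₂ s t = begin
    a * c * sign (θDegree m₂ ℕ.* θDegree (x₁ ∷ y₁ ∷ n₁)) * (f (m₁ ++ x₁ ∷ y₁ ∷ n₁) * g (m₂ ++ x₂ ∷ y₂ ∷ n₂))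
      ≡⟨ cong₂ (λ u v → a * c * sign (θDegree m₂ ℕ.* u) * v) (θDegree-swap [] x₁ y₁ n₁)
           (cong₂ _*_ (p m₁ x₁ y₁ n₁) (q m₂ x₂ y₂ n₂)) ⟩
    a * c * b * (swapSign x₁ y₁ * f′ * (swapSign x₂ y₂ * g′))
      ≡⟨ solve 7 (λ a c b s t f g → a :* c :* b :* (s :* f :* (t :* g)) := (c :* s :* t) :* (a :* b :* (f :* g))) refl
           a c b (swapSign x₁ y₁) (swapSign x₂ y₂) f′ g′ ⟩
    (c * swapSign x₁ y₁ * swapSign x₂ y₂) * (a * b * (f′ * g′))
      ≡⟨ cong (_* (a * b * (f′ * g′))) (signs s t n₁ n₂) ⟩
    (swapSign x y * c′) * (a * b * (f′ * g′))
      ≡⟨ solve 6 (λ s a c b f g → (s :* c) :* (a :* b :* (f :* g)) := s :* (a :* c :* b :* (f :* g))) refl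
           (swapSign x y) a c′ b f′ g′ ⟩
    swapSign x y * (a * c′ * b * (f′ * g′)) ∎
    where
    open +-*-Solver
    a = sign (crossings m₁ m₂)
    b = sign (θDegree m₂ ℕ.* θDegree (y₁ ∷ x₁ ∷ n₁))
    c = sign (crossings (x₁ ∷ y₁ ∷ n₁) (x₂ ∷ y₂ ∷ n₂))
    c′ = sign (crossings (y₁ ∷ x₁ ∷ n₁) (y₂ ∷ x₂ ∷ n₂))
    f′ = f (m₁ ++ y₁ ∷ x₁ ∷ n₁)
    g′ = g (m₂ ++ y₂ ∷ x₂ ∷ n₂)

  swapped : ∀ m₁ m₂ → splitSum (x ∷ y ∷ n) (G m₁ m₂) ≡ swapSign x y * splitSum (y ∷ x ∷ n) (G m₁ m₂)
  swapped m₁ m₂ = begin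
    splitSum (x ∷ y ∷ n) (G m₁ m₂)
      ≡⟨ splitSum-∷-∷ x y n (G m₁ m₂) ⟩
    expSum x (λ x₁ x₂ → expSum y (λ y₁ y₂ → splitSum n (λ n₁ n₂ → G m₁ m₂ (x₁ ∷ y₁ ∷ n₁) (x₂ ∷ y₂ ∷ n₂))))
      ≡⟨ expSum-cong x (λ x₁ x₂ s → expSum-cong y λ y₁ y₂ t → trans
           (splitSum-cong n λ n₁ n₂ _ → entry m₁ m₂ x₁ x₂ y₁ y₂ n₁ n₂ s t)
           (splitSum-* n (swapSign x y) (λ n₁ n₂ → G m₁ m₂ (y₁ ∷ x₁ ∷ n₁) (y₂ ∷ x₂ ∷ n₂)))) ⟩
    expSum x (λ x₁ x₂ → expSum y (λ y₁ y₂ → swapSign x y * H x₁ x₂ y₁ y₂))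
      ≡⟨ trans (expSum-cong x λ x₁ x₂ _ → expSum-* y (swapSign x y) (H x₁ x₂))
           (expSum-* x (swapSign x y) (λ x₁ x₂ → expSum y (H x₁ x₂))) ⟩
    swapSign x y * expSum x (λ x₁ x₂ → expSum y (H x₁ x₂))
      ≡⟨ cong (swapSign x y *_) (expSum-comm x y H) ⟩
    swapSign x y * expSum y (λ y₁ y₂ → expSum x (λ x₁ x₂ → H x₁ x₂ y₁ y₂))
      ≡⟨ cong (swapSign x y *_) (splitSum-∷-∷ y x n (G m₁ m₂)) ⟨
    swapSign x y * splitSum (y ∷ x ∷ n) (G m₁ m₂) ∎
    where
    H : Exponent → Exponent → Exponent → Exponent → ℚ
    H x₁ x₂ y₁ y₂ = splitSum n (λ n₁ n₂ → G m₁ m₂ (y₁ ∷ x₁ ∷ n₁) (y₂ ∷ x₂ ∷ n₂))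

-- The signed sum of f over the ways to insert x into m.  Iterating it, average
-- is the signed average over the reorderings of m.

insertions : Exponent → Coefficients → Coefficients
insertions x f []      = f [ x ]
insertions x f (z ∷ m) = f (x ∷ z ∷ m) + swapSign x z * insertions x (λ n → f (z ∷ n)) m

natural : ℕ → ℚ
natural zero    = 0ℚ
natural (suc n) = 1ℚ + natural n

natural-nonNegative : ∀ n → NonNegative (natural n)
natural-nonNegative zero    = _
natural-nonNegative (suc n) = ℚₚ.nonNeg+nonNeg⇒nonNeg 1ℚ (natural n) {{natural-nonNegative n}}

natural-nonZero : ∀ n → NonZero (natural (suc n))
natural-nonZero n = ℚₚ.pos⇒nonZero (natural (suc n))
  {{ℚₚ.pos+nonNeg⇒pos 1ℚ (natural n) {{natural-nonNegative n}}}}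

-- The value is 1/(n + 1), as an entry can be inserted into a word of length n at n + 1 places.
-- Averaging is where division in ℚ enters.
reciprocal : ℕ → ℚ
reciprocal n = (1/ natural (suc n)) {{natural-nonZero n}}

reciprocal-* : ∀ n → reciprocal n * natural (suc n) ≡ 1ℚ
reciprocal-* n = ℚₚ.*-inverseˡ (natural (suc n)) {{natural-nonZero n}}

average : Coefficients → Coefficients
average f []      = f []
average f (x ∷ m) = reciprocal (length m) * average (insertions x f) m

module _ where
  open +-*-Solver

  insertions-cong : ∀ x {f g : Coefficients} → (∀ m → f m ≡ g m) → ∀ m → insertions x f m ≡ insertions x g m
  insertions-cong x h []      = h [ x ]
  insertions-cong x h (z ∷ m) = cong₂ _+_ (h (x ∷ z ∷ m))
    (cong (swapSign x z *_) (insertions-cong x (λ n → h (z ∷ n)) m))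

  insertions-+ : ∀ x f g m → insertions x (λ n → f n + g n) m ≡ insertions x f m + insertions x g m
  insertions-+ x f g []      = refl
  insertions-+ x f g (z ∷ m) = trans
    (cong (λ w → f (x ∷ z ∷ m) + g (x ∷ z ∷ m) + swapSign x z * w) (insertions-+ x (λ n → f (z ∷ n)) (λ n → g (z ∷ n)) m))
    (solve 5 (λ a b s u v → a :+ b :+ s :* (u :+ v) := a :+ s :* u :+ (b :+ s :* v)) refl
      (f (x ∷ z ∷ m)) (g (x ∷ z ∷ m)) (swapSign x z)
      (insertions x (λ n → f (z ∷ n)) m) (insertions x (λ n → g (z ∷ n)) m))

  -- All words made by inserting into `m` have the same length, so a weight depending on the length
  -- alone factors out. Through `average-*` this pulls out the number of places in `average-fixes`.
  insertions-* : ∀ x (w : ℕ → ℚ) f m →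
    insertions x (λ n → w (length n) * f n) m ≡ w (suc (length m)) * insertions x f m
  insertions-* x w f []      = refl
  insertions-* x w f (z ∷ m) = trans
    (cong (λ u → w (suc (suc (length m))) * f (x ∷ z ∷ m) + swapSign x z * u)
      (insertions-* x (λ k → w (suc k)) (λ n → f (z ∷ n)) m))
    (solve 4 (λ w a s u → w :* a :+ s :* (w :* u) := w :* (a :+ s :* u)) refl
      (w (suc (suc (length m)))) (f (x ∷ z ∷ m)) (swapSign x z) (insertions x (λ n → f (z ∷ n)) m))

  -- Both orders of insertion run over the same placements of `x` and `y` in `m`. They count the
  -- passages of `x` and `y` past each other differently, which accounts for the factor.
  insertions-comm : ∀ x y f m →
    insertions y (insertions x f) m ≡ swapSign x y * insertions x (insertions y f) m
  insertions-comm x y f [] = begin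
    f (x ∷ y ∷ []) + s * f (y ∷ x ∷ [])
      ≡⟨ cong (_+ s * f (y ∷ x ∷ [])) (trans (sym (ℚₚ.*-identityˡ (f (x ∷ y ∷ [])))) (cong (_* f (x ∷ y ∷ [])) (sym (swapSign-square x y)))) ⟩
    s * s * f (x ∷ y ∷ []) + s * f (y ∷ x ∷ [])
      ≡⟨ solve 3 (λ s a b → s :* s :* a :+ s :* b := s :* (b :+ s :* a)) refl s (f (x ∷ y ∷ [])) (f (y ∷ x ∷ [])) ⟩
    s * (f (y ∷ x ∷ []) + s * f (x ∷ y ∷ []))
      ≡⟨ cong (λ t → s * (f (y ∷ x ∷ []) + t * f (x ∷ y ∷ []))) (swapSign-sym x y) ⟩
    s * (f (y ∷ x ∷ []) + swapSign y x * f (x ∷ y ∷ [])) ∎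
    where s = swapSign x y
  insertions-comm x y f (z ∷ m) = begin
    a + s * (b + u * A) + v * insertions y (λ n → f (x ∷ z ∷ n) + u * insertions x f′ n) m
      ≡⟨ cong (λ w → a + s * (b + u * A) + v * w) (expand y x u) ⟩
    a + s * (b + u * A) + v * (B + u * insertions y (insertions x f′) m)
      ≡⟨ cong (λ w → a + s * (b + u * A) + v * (B + u * w)) (insertions-comm x y f′ m) ⟩
    a + s * (b + u * A) + v * (B + u * (s * C))
      -- The right side has a factor `s` in front, which the terms `a` and `B` lack; they receive it
      -- from 1 = s * s.
      ≡⟨ cong₂ (λ p q → p + s * (b + u * A) + v * (q + u * (s * C))) (ℚₚ.*-identityˡ a) (ℚₚ.*-identityˡ B) ⟨
    1ℚ * a + s * (b + u * A) + v * (1ℚ * B + u * (s * C))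
      ≡⟨ cong (λ o → o * a + s * (b + u * A) + v * (o * B + u * (s * C))) (swapSign-square x y) ⟨
    s * s * a + s * (b + u * A) + v * (s * s * B + u * (s * C))
      ≡⟨ solve 8 (λ s u v a b A B C → s :* s :* a :+ s :* (b :+ u :* A) :+ v :* (s :* s :* B :+ u :* (s :* C)) :=
           s :* (b :+ s :* (a :+ v :* B) :+ u :* (A :+ v :* C))) refl s u v a b A B C ⟩
    s * (b + s * (a + v * B) + u * (A + v * C))
      ≡⟨ cong₂ (λ t w → s * (b + t * (a + v * B) + u * w)) (swapSign-sym x y) (sym (expand x y v)) ⟩
    s * (b + swapSign y x * (a + v * B) + u * insertions x (λ n → f (y ∷ z ∷ n) + v * insertions y f′ n) m) ∎
    where
    s = swapSign x y
    u = swapSign x z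
    v = swapSign y z
    f′ : Coefficients
    f′ n = f (z ∷ n)
    a = f (x ∷ y ∷ z ∷ m)
    b = f (y ∷ x ∷ z ∷ m)
    A = insertions x (λ n → f (y ∷ z ∷ n)) m
    B = insertions y (λ n → f (x ∷ z ∷ n)) m
    C = insertions x (insertions y f′) m
    expand : ∀ y x u → insertions y (λ n → f (x ∷ z ∷ n) + u * insertions x f′ n) m ≡
             insertions y (λ n → f (x ∷ z ∷ n)) m + u * insertions y (insertions x f′) m
    expand y x u = trans (insertions-+ y (λ n → f (x ∷ z ∷ n)) (λ n → u * insertions x f′ n) m)
      (cong (insertions y (λ n → f (x ∷ z ∷ n)) m +_) (insertions-* y (λ _ → u) (insertions x f′) m))

average-cong : ∀ {f g : Coefficients} → (∀ m → f m ≡ g m) → ∀ m → average f m ≡ average g m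
average-cong h []      = h []
average-cong h (x ∷ m) = cong (reciprocal (length m) *_) (average-cong (insertions-cong x h) m)

average-+ : ∀ f g m → average (λ n → f n + g n) m ≡ average f m + average g m
average-+ f g []      = refl
average-+ f g (x ∷ m) = trans
  (cong (reciprocal (length m) *_) (trans (average-cong (insertions-+ x f g) m)
    (average-+ (insertions x f) (insertions x g) m)))
  (ℚₚ.*-distribˡ-+ (reciprocal (length m)) _ _)

average-* : ∀ (w : ℕ → ℚ) f m → average (λ n → w (length n) * f n) m ≡ w (length m) * average f m
average-* w f []      = refl
average-* w f (x ∷ m) = trans
  (cong (reciprocal (length m) *_) (trans (average-cong (insertions-* x w f) m)
    (average-* (λ k → w (suc k)) (insertions x f) m)))
  (solve 3 (λ a b c → a :* (b :* c) := b :* (a :* c)) refl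
    (reciprocal (length m)) (w (suc (length m))) (average (insertions x f) m))
  where open +-*-Solver

average-∑ : ∀ {A : Set} (xs : List A) (F : A → Coefficients) m →
  average (λ n → ∑ xs (λ x → F x n)) m ≡ ∑ xs (λ x → average (F x) m)
average-∑ []       F m = begin
  average (λ n → ∑ [] (λ x → F x n)) m  ≡⟨ average-cong (λ n → trans (∑-[] _) (sym (ℚₚ.*-zeroˡ 0ℚ))) m ⟩
  average (λ n → 0ℚ * 0ℚ) m             ≡⟨ average-* (λ _ → 0ℚ) (λ _ → 0ℚ) m ⟩
  0ℚ * average (λ _ → 0ℚ) m             ≡⟨ ℚₚ.*-zeroˡ (average (λ _ → 0ℚ) m) ⟩
  0ℚ                                    ≡⟨ ∑-[] _ ⟨
  ∑ [] (λ x → average (F x) m)          ∎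
average-∑ (x ∷ xs) F m = begin
  average (λ n → ∑ (x ∷ xs) (λ y → F y n)) m       ≡⟨ average-cong (λ n → ∑-∷ x xs (λ y → F y n)) m ⟩
  average (λ n → F x n + ∑ xs (λ y → F y n)) m     ≡⟨ average-+ (F x) (λ n → ∑ xs (λ y → F y n)) m ⟩
  average (F x) m + average (λ n → ∑ xs (λ y → F y n)) m  ≡⟨ cong (average (F x) m +_) (average-∑ xs F m) ⟩
  average (F x) m + ∑ xs (λ y → average (F y) m)   ≡⟨ ∑-∷ x xs _ ⟨
  ∑ (x ∷ xs) (λ y → average (F y) m)               ∎

-- An exchange at the front is `insertions-comm`. Behind an entry `z`, the average of `f` is a
-- multiple of the average of `insertions z f` on the remaining word, and the multiple depends only
-- on the length.
average-adjacentSymmetric : ∀ f → AdjacentSymmetric (average f)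
average-adjacentSymmetric f [] x y n = begin
  r * (r′ * average (insertions y (insertions x f)) n)
    ≡⟨ cong (λ z → r * (r′ * z)) (trans (average-cong (insertions-comm x y f) n)
         (average-* (λ _ → swapSign x y) (insertions x (insertions y f)) n)) ⟩
  r * (r′ * (swapSign x y * average (insertions x (insertions y f)) n))
    ≡⟨ solve 4 (λ a b c d → a :* (b :* (c :* d)) := c :* (a :* (b :* d))) refl r r′ (swapSign x y)
         (average (insertions x (insertions y f)) n) ⟩
  swapSign x y * (r * (r′ * average (insertions x (insertions y f)) n)) ∎
  where
  open +-*-Solver
  r = reciprocal (suc (length n))
  r′ = reciprocal (length n)
average-adjacentSymmetric f (z ∷ m) x y n = begin
  reciprocal (length (m ++ x ∷ y ∷ n)) * average (insertions z f) (m ++ x ∷ y ∷ n)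
    ≡⟨ cong₂ (λ k w → reciprocal k * w)
         (trans (length-++ m) (sym (length-++ m))) (average-adjacentSymmetric (insertions z f) m x y n) ⟩
  r * (swapSign x y * average (insertions z f) (m ++ y ∷ x ∷ n))
    ≡⟨ solve 3 (λ a b c → a :* (b :* c) := b :* (a :* c)) refl r (swapSign x y) _ ⟩
  swapSign x y * (r * average (insertions z f) (m ++ y ∷ x ∷ n)) ∎
  where
  open +-*-Solver
  r = reciprocal (length (m ++ y ∷ x ∷ n))

-- Moving the inserted `x` back to the front cancels the sign of its insertion, so all
-- `length m + 1` places contribute the same value.
insertions-adjacentSymmetric : ∀ {f} → AdjacentSymmetric f → ∀ x m →
  insertions x f m ≡ natural (suc (length m)) * f (x ∷ m)
insertions-adjacentSymmetric {f} h x []      = sym (trans (cong (_* f [ x ]) (ℚₚ.+-identityʳ 1ℚ)) (ℚₚ.*-identityˡ (f [ x ])))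
insertions-adjacentSymmetric {f} h x (z ∷ m) = begin
  f (x ∷ z ∷ m) + s * insertions x (λ n → f (z ∷ n)) m
    ≡⟨ cong (λ w → f (x ∷ z ∷ m) + s * w) (insertions-adjacentSymmetric (λ k → h (z ∷ k)) x m) ⟩
  f (x ∷ z ∷ m) + s * (natural (suc (length m)) * f (z ∷ x ∷ m))
    ≡⟨ solve 4 (λ a s n b → a :+ s :* (n :* b) := a :+ n :* (s :* b)) refl
         (f (x ∷ z ∷ m)) s (natural (suc (length m))) (f (z ∷ x ∷ m)) ⟩
  f (x ∷ z ∷ m) + natural (suc (length m)) * (s * f (z ∷ x ∷ m))
    ≡⟨ cong (λ w → f (x ∷ z ∷ m) + natural (suc (length m)) * w) (h [] x z m) ⟨
  f (x ∷ z ∷ m) + natural (suc (length m)) * f (x ∷ z ∷ m)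
    ≡⟨ solve 2 (λ a n → a :+ n :* a := (con 1ℚ :+ n) :* a) refl (f (x ∷ z ∷ m)) (natural (suc (length m))) ⟩
  natural (suc (suc (length m))) * f (x ∷ z ∷ m) ∎
  where
  open +-*-Solver
  s = swapSign x z

average-fixes : ∀ {f} → AdjacentSymmetric f → ∀ m → average f m ≡ f m
average-fixes h []      = refl
average-fixes {f} h (x ∷ m) = begin
  r * average (insertions x f) m
    ≡⟨ cong (r *_) (trans (average-cong (insertions-adjacentSymmetric h x) m)
         (average-* (λ k → natural (suc k)) (λ n → f (x ∷ n)) m)) ⟩
  r * (natural (suc (length m)) * average (λ n → f (x ∷ n)) m)
    ≡⟨ cong (λ w → r * (natural (suc (length m)) * w)) (average-fixes (λ k → h (x ∷ k)) m) ⟩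
  r * (natural (suc (length m)) * f (x ∷ m))
    ≡⟨ ℚₚ.*-assoc r _ _ ⟨
  r * natural (suc (length m)) * f (x ∷ m)
    ≡⟨ trans (cong (_* f (x ∷ m)) (reciprocal-* (length m))) (ℚₚ.*-identityˡ _) ⟩
  f (x ∷ m) ∎
  where r = reciprocal (length m)

insertions-vanish : ∀ x (f : Coefficients) m → (∀ n → degree n ≡ degree (x ∷ m) → f n ≡ 0ℚ) → insertions x f m ≡ 0ℚ
insertions-vanish x f []      h = h [ x ] refl
insertions-vanish x f (z ∷ m) h = begin
  f (x ∷ z ∷ m) + swapSign x z * insertions x (λ n → f (z ∷ n)) m
    ≡⟨ cong₂ (λ a b → a + swapSign x z * b) (h (x ∷ z ∷ m) refl)
         (insertions-vanish x (λ n → f (z ∷ n)) m (λ n p → h (z ∷ n) (shifted n p))) ⟩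
  0ℚ + swapSign x z * 0ℚ
    ≡⟨ trans (ℚₚ.+-identityˡ _) (ℚₚ.*-zeroʳ (swapSign x z)) ⟩
  0ℚ ∎
  where
  shifted : ∀ n → degree n ≡ degree (x ∷ m) → degree (z ∷ n) ≡ degree (x ∷ z ∷ m)
  shifted n p = begin
    degree (z ∷ n)                    ≡⟨ degree-∷ z n ⟩
    degree [ z ] ℕ.+ degree n         ≡⟨ cong (degree [ z ] ℕ.+_) p ⟩
    degree [ z ] ℕ.+ degree (x ∷ m)   ≡⟨ degree-∷ z (x ∷ m) ⟨
    degree (z ∷ x ∷ m)                ≡⟨ cong₂ ℕ._+_ (xDegree-swap [] z x m) (θDegree-swap [] z x m) ⟩
    degree (x ∷ z ∷ m)                ∎

average-vanish : ∀ (f : Coefficients) m → (∀ n → degree n ≡ degree m → f n ≡ 0ℚ) → average f m ≡ 0ℚ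
average-vanish f []      h = h [] refl
average-vanish f (x ∷ m) h = trans
  (cong (reciprocal (length m) *_) (average-vanish (insertions x f) m (λ n p → insertions-vanish x f n
    (λ k q → h k (trans q (trans (degree-∷ x n) (trans (cong (degree [ x ] ℕ.+_) p) (sym (degree-∷ x m)))))))))
  (ℚₚ.*-zeroʳ (reciprocal (length m)))

-- Deleting the trivial entries before averaging makes the result trivial-invariant for every `f`.
symmetrized : Coefficients → Coefficients
symmetrized f m = average f (reduced m)

symmetrized-trivialInvariant : ∀ f → TrivialInvariant (symmetrized f)
symmetrized-trivialInvariant f m n = cong (λ c → average f (map exponent c)) (composition-trivial m n)

symmetrized-adjacentSymmetric : ∀ f → AdjacentSymmetric (symmetrized f)
symmetrized-adjacentSymmetric f m x y n = begin
  average f (reduced (m ++ x ∷ y ∷ n))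
    ≡⟨ cong (average f) (reduced-++ m (x ∷ y ∷ n)) ⟩
  average f (reduced m ++ reduced (x ∷ y ∷ n))
    ≡⟨ swapped ⟩
  swapSign x y * average f (reduced m ++ reduced (y ∷ x ∷ n))
    ≡⟨ cong (λ k → swapSign x y * average f k) (reduced-++ m (y ∷ x ∷ n)) ⟨
  swapSign x y * average f (reduced (m ++ y ∷ x ∷ n)) ∎
  where
  swapped : average f (reduced m ++ reduced (x ∷ y ∷ n)) ≡ swapSign x y * average f (reduced m ++ reduced (y ∷ x ∷ n))
  swapped with trivial? x | trivial? y
  ... | inj₁ refl | inj₁ refl = sym (ℚₚ.*-identityˡ _)
  ... | inj₁ refl | inj₂ q    = trans
    (cong (λ k → average f (reduced m ++ k)) (trans (reduced-∷ y n q) (sym (reduced-∷ y (trivial ∷ n) q))))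
    (sym (ℚₚ.*-identityˡ _))
  ... | inj₂ p    | inj₁ refl = trans
    (cong (λ k → average f (reduced m ++ k)) (trans (reduced-∷ x (trivial ∷ n) p) (sym (reduced-∷ x n p))))
    (sym (trans (cong (_* average f (reduced m ++ reduced (x ∷ n))) (swapSign-sym x trivial)) (ℚₚ.*-identityˡ _)))
  ... | inj₂ p    | inj₂ q    = begin
    average f (reduced m ++ reduced (x ∷ y ∷ n))
      ≡⟨ cong (λ k → average f (reduced m ++ k)) (trans (reduced-∷ x (y ∷ n) p) (cong (x ∷_) (reduced-∷ y n q))) ⟩
    average f (reduced m ++ x ∷ y ∷ reduced n)
      ≡⟨ average-adjacentSymmetric f (reduced m) x y (reduced n) ⟩
    swapSign x y * average f (reduced m ++ y ∷ x ∷ reduced n)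
      ≡⟨ cong (λ k → swapSign x y * average f (reduced m ++ k)) (trans (reduced-∷ y (x ∷ n) q) (cong (y ∷_) (reduced-∷ x n p))) ⟨
    swapSign x y * average f (reduced m ++ reduced (y ∷ x ∷ n)) ∎

symmetrized-degree : ∀ {f d} → (∀ m → degree m ≢ d → f m ≡ 0ℚ) → ∀ m → degree m ≢ d → symmetrized f m ≡ 0ℚ
symmetrized-degree {f} h m p = average-vanish f (reduced m)
  (λ n q → h n (λ r → p (trans (sym (trans q (degree-reduced m))) r)))

-- The average fixes `f` and is linear, so averaging the expansion into monomial quasisymmetric
-- functions keeps the coordinates `f p`.
symmetrized-expansion : ∀ {f} → TrivialInvariant f → AdjacentSymmetric f →
  ∀ N → (∀ m → N < degree m → f m ≡ 0ℚ) →
  ∀ m → f m ≡ ∑ (wordsUpTo N N) (λ p → f p * symmetrized (monomialQuasisymmetric p) m)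
symmetrized-expansion {f} t h N vanish m = begin
  f m
    ≡⟨ trivialInvariant-reduced t m ⟩
  f (reduced m)
    ≡⟨ average-fixes h (reduced m) ⟨
  average f (reduced m)
    ≡⟨ average-cong (monomialQuasisymmetric-expansion t N vanish) (reduced m) ⟩
  average (λ n → ∑ (wordsUpTo N N) (λ p → f p * monomialQuasisymmetric p n)) (reduced m)
    ≡⟨ average-∑ (wordsUpTo N N) (λ p n → f p * monomialQuasisymmetric p n) (reduced m) ⟩
  ∑ (wordsUpTo N N) (λ p → average (λ n → f p * monomialQuasisymmetric p n) (reduced m))
    ≡⟨ ∑-cong (wordsUpTo N N) (λ p → average-* (λ _ → f p) (monomialQuasisymmetric p) (reduced m)) ⟩
  ∑ (wordsUpTo N N) (λ p → f p * symmetrized (monomialQuasisymmetric p) m) ∎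

-- Permutations and adjacent transpositions

count : {A : Set} → (A → Bool) → List A → ℕ
count p xs = length (filterᵇ p xs)

count-∷ : ∀ {A : Set} (p : A → Bool) x xs → count p (x ∷ xs) ≡ fermionic (p x) ℕ.+ count p xs
count-∷ p x xs with p x
... | true  = refl
... | false = refl

count-++ : ∀ {A : Set} (p : A → Bool) xs ys → count p (xs ++ ys) ≡ count p xs ℕ.+ count p ys
count-++ p []       ys = refl
count-++ p (x ∷ xs) ys = begin
  count p (x ∷ xs ++ ys)                             ≡⟨ count-∷ p x (xs ++ ys) ⟩
  fermionic (p x) ℕ.+ count p (xs ++ ys)             ≡⟨ cong (fermionic (p x) ℕ.+_) (count-++ p xs ys) ⟩
  fermionic (p x) ℕ.+ (count p xs ℕ.+ count p ys)    ≡⟨ ℕₚ.+-assoc (fermionic (p x)) _ _ ⟨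
  fermionic (p x) ℕ.+ count p xs ℕ.+ count p ys      ≡⟨ cong (ℕ._+ count p ys) (count-∷ p x xs) ⟨
  count p (x ∷ xs) ℕ.+ count p ys                    ∎

count-map : ∀ {A B : Set} (p : B → Bool) (f : A → B) xs → count p (map f xs) ≡ count (p ∘ f) xs
count-map p f []       = refl
count-map p f (x ∷ xs) = trans (count-∷ p (f x) (map f xs))
  (trans (cong (fermionic (p (f x)) ℕ.+_) (count-map p f xs)) (sym (count-∷ (p ∘ f) x xs)))

count-tabulate : ∀ {A : Set} {n} (p : A → Bool) (f : Fin n → A) →
                 count p (tabulate f) ≡ sum (λ i → fermionic (p (f i)))
count-tabulate {n = zero}  p f = refl
count-tabulate {n = suc n} p f = trans (count-∷ p (f zero) (tabulate (f ∘ suc)))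
  (cong (fermionic (p (f zero)) ℕ.+_) (count-tabulate p (f ∘ suc)))

count-cartesianProduct : ∀ {A B : Set} {n} (p : A × B → Bool) (f : Fin n → A) ys →
  count p (cartesianProduct (tabulate f) ys) ≡ sum (λ i → count (λ y → p (f i , y)) ys)
count-cartesianProduct {n = zero}  p f ys = refl
count-cartesianProduct {n = suc n} p f ys = trans (count-++ p (map (f zero ,_) ys) _)
  (cong₂ ℕ._+_ (count-map p (f zero ,_) ys) (count-cartesianProduct p (f ∘ suc) ys))

isInversion : ∀ {n} → Permutation′ n → (Fin n → Bool) → Fin n → Fin n → Bool
isInversion σ η i j = (toℕ i ℕ.<ᵇ toℕ j) ∧ (toℕ (σ ⟨$⟩ʳ j) ℕ.<ᵇ toℕ (σ ⟨$⟩ʳ i)) ∧ η i ∧ η j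

-- The count of a filtered list is recast as a double sum over `Fin n`, from which the row and the
-- column of one index can be split off.
inversionNumber : ∀ {n} → Permutation′ n → (Fin n → Bool) → ℕ
inversionNumber σ η = sum (λ i → sum (λ j → fermionic (isInversion σ η i j)))

inversions-inversionNumber : ∀ {n} (σ : Permutation′ n) v →
  inversions σ v ≡ inversionNumber σ (λ i → proj₂ (Vec.lookup v i))
inversions-inversionNumber {n} σ v = trans (count-cartesianProduct {n = n} inverted id (allFin n))
  (sum-cong-≗ {n} (λ i → count-tabulate {n = n} (λ j → inverted (i , j)) id))
  where
  inverted : Fin n × Fin n → Bool
  inverted (i , j) = isInversion σ (λ i → proj₂ (Vec.lookup v i)) i j

sum-zero : ∀ {n} {h : Fin n → ℕ} → (∀ i → h i ≡ 0) → sum h ≡ 0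
sum-zero {zero}  p = refl
sum-zero {suc n} p = cong₂ ℕ._+_ (p zero) (sum-zero (p ∘ suc))

fermionic-∧ : ∀ a b → fermionic (a ∧ b) ≡ fermionic a ℕ.* fermionic b
fermionic-∧ true  b = sym (ℕₚ.+-identityʳ (fermionic b))
fermionic-∧ false b = refl

punchIn-<ᵇ : ∀ {n} (k : Fin (suc n)) i j →
  (toℕ (punchIn k i) ℕ.<ᵇ toℕ (punchIn k j)) ≡ (toℕ i ℕ.<ᵇ toℕ j)
punchIn-<ᵇ zero    i       j       = refl
punchIn-<ᵇ (suc k) zero    zero    = refl
punchIn-<ᵇ (suc k) zero    (suc j) = refl
punchIn-<ᵇ (suc k) (suc i) zero    = refl
punchIn-<ᵇ (suc k) (suc i) (suc j) = punchIn-<ᵇ k i j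

-- The exponent of the sign for bringing entry `k` to the front: the θ's in front of `k`, counted
-- only if `k` carries one.
passed : ∀ {n} → Fin (suc n) → (Fin (suc n) → Bool) → ℕ
passed k η = sum (λ i → fermionic ((toℕ (punchIn k i) ℕ.<ᵇ toℕ k) ∧ η (punchIn k i) ∧ η k))

-- Removing the index sent to the first place leaves the inversions among the
-- other indices; those lost are the pairs (i , k) with i < k.

inversionNumber-remove : ∀ {n} (σ : Permutation′ (suc n)) η → let k = σ ⟨$⟩ˡ zero in
  inversionNumber σ η ≡ passed k η ℕ.+ inversionNumber (remove k σ) (η ∘ punchIn k)
inversionNumber-remove {n} σ η = begin
  sum (λ i → sum (λ j → F i j))
    ≡⟨ sum-remove {n} {k} (λ i → sum (F i)) ⟩
  sum (F k) ℕ.+ sum (λ i → sum (F (punchIn k i)))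
    ≡⟨ cong₂ ℕ._+_ (sum-zero {suc n} row-k) (sum-cong-≗ {n} (λ i → trans (sum-remove {n} {k} (F (punchIn k i)))
         (cong₂ ℕ._+_ (column-k i) (sum-cong-≗ {n} (rest i))))) ⟩
  sum (λ i → fermionic ((toℕ (punchIn k i) ℕ.<ᵇ toℕ k) ∧ η (punchIn k i) ∧ η k)
    ℕ.+ sum (λ j → fermionic (isInversion σ′ (η ∘ punchIn k) i j)))
    ≡⟨ ∑-distrib-+ {n} (λ i → fermionic ((toℕ (punchIn k i) ℕ.<ᵇ toℕ k) ∧ η (punchIn k i) ∧ η k)) _ ⟩
  passed k η ℕ.+ inversionNumber σ′ (η ∘ punchIn k) ∎
  where
  k = σ ⟨$⟩ˡ zero
  σ′ = remove k σ
  F : Fin (suc n) → Fin (suc n) → ℕ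
  F i j = fermionic (isInversion σ η i j)
  image-k : σ ⟨$⟩ʳ k ≡ zero
  image-k = Permutation.inverseʳ σ
  image : ∀ i → σ ⟨$⟩ʳ punchIn k i ≡ suc (σ′ ⟨$⟩ʳ i)
  image i = Permutation.punchIn-permute′ σ zero i
  row-k : ∀ j → F k j ≡ 0
  row-k j = cong fermionic (trans
    (cong (λ z → (toℕ k ℕ.<ᵇ toℕ j) ∧ (toℕ (σ ⟨$⟩ʳ j) ℕ.<ᵇ toℕ z) ∧ η k ∧ η j) image-k)
    (∧-zeroʳ (toℕ k ℕ.<ᵇ toℕ j)))
  column-k : ∀ i → F (punchIn k i) k ≡ fermionic ((toℕ (punchIn k i) ℕ.<ᵇ toℕ k) ∧ η (punchIn k i) ∧ η k)
  column-k i = cong₂ (λ y z → fermionic ((toℕ (punchIn k i) ℕ.<ᵇ toℕ k) ∧ (toℕ y ℕ.<ᵇ toℕ z) ∧ η (punchIn k i) ∧ η k))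
    image-k (image i)
  rest : ∀ i j → F (punchIn k i) (punchIn k j) ≡ fermionic (isInversion σ′ (η ∘ punchIn k) i j)
  rest i j = trans
    (cong₂ (λ y z → fermionic ((toℕ (punchIn k i) ℕ.<ᵇ toℕ (punchIn k j)) ∧ (toℕ y ℕ.<ᵇ toℕ z)
      ∧ η (punchIn k i) ∧ η (punchIn k j))) (image j) (image i))
    (cong (λ b → fermionic (b ∧ (toℕ (σ′ ⟨$⟩ʳ j) ℕ.<ᵇ toℕ (σ′ ⟨$⟩ʳ i)) ∧ η (punchIn k i) ∧ η (punchIn k j)))
      (punchIn-<ᵇ k i j))

-- By induction the entry is brought to the second place, with the first entry held fixed as a
-- prefix; one exchange then moves it to the front.
adjacentSymmetric-front : ∀ {n f} → AdjacentSymmetric f → ∀ (k : Fin (suc n)) g →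
  f (tabulate g) ≡ sign (passed k (proj₂ ∘ g)) * f (g k ∷ tabulate (g ∘ punchIn k))
adjacentSymmetric-front {n} {f} h zero g = sym (trans
  (cong (λ z → sign z * f (tabulate g)) (sum-zero {n} (λ _ → refl))) (ℚₚ.*-identityˡ (f (tabulate g))))
adjacentSymmetric-front {suc n} {f} h (suc k) g = begin
  f (g zero ∷ tabulate (g ∘ suc))
    ≡⟨ adjacentSymmetric-front {f = λ m → f (g zero ∷ m)} (λ m → h (g zero ∷ m)) k (g ∘ suc) ⟩
  sign p * f (g zero ∷ g (suc k) ∷ rest)
    ≡⟨ cong (sign p *_) (h [] (g zero) (g (suc k)) rest) ⟩
  sign p * (swapSign (g zero) (g (suc k)) * f (g (suc k) ∷ g zero ∷ rest))
    ≡⟨ solve 3 (λ a b c → a :* (b :* c) := (b :* a) :* c) refl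
         (sign p) (swapSign (g zero) (g (suc k))) (f (g (suc k) ∷ g zero ∷ rest)) ⟩
  (swapSign (g zero) (g (suc k)) * sign p) * f (g (suc k) ∷ g zero ∷ rest)
    ≡⟨ cong (λ z → (sign z * sign p) * f (g (suc k) ∷ g zero ∷ rest))
         (fermionic-∧ (proj₂ (g zero)) (proj₂ (g (suc k)))) ⟨
  (sign q * sign p) * f (g (suc k) ∷ g zero ∷ rest)
    ≡⟨ cong (_* f (g (suc k) ∷ g zero ∷ rest)) (sign-+ q p) ⟨
  sign (q ℕ.+ p) * f (g (suc k) ∷ g zero ∷ rest) ∎
  where
  open +-*-Solver
  p = passed k (proj₂ ∘ g ∘ suc)
  q = fermionic (proj₂ (g zero) ∧ proj₂ (g (suc k)))
  rest = tabulate (g ∘ suc ∘ punchIn k)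

-- Let `k` be the index that `σ` sends to the first place. With `g k` fixed as a prefix, the tail is
-- permuted by `remove k σ`; then `adjacentSymmetric-front` returns `g k` to its original position.
adjacentSymmetric-permute : ∀ {n f} → AdjacentSymmetric f → ∀ (σ : Permutation′ n) g →
  f (tabulate (λ j → g (σ ⟨$⟩ˡ j))) ≡ sign (inversionNumber σ (proj₂ ∘ g)) * f (tabulate g)
adjacentSymmetric-permute {zero}  {f} h σ g = sym (ℚₚ.*-identityˡ (f []))
adjacentSymmetric-permute {suc n} {f} h σ g = begin
  f (g k ∷ tabulate (λ j → g (σ ⟨$⟩ˡ suc j)))
    ≡⟨ cong (λ l → f (g k ∷ l)) (tabulate-cong (λ j → cong g (preimage j))) ⟩
  f (g k ∷ tabulate (λ j → g (punchIn k (σ′ ⟨$⟩ˡ j))))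
    ≡⟨ adjacentSymmetric-permute {f = λ m → f (g k ∷ m)} (λ m → h (g k ∷ m)) σ′ (g ∘ punchIn k) ⟩
  sign I * F
    ≡⟨ cong (sign I *_) (ℚₚ.*-identityˡ F) ⟨
  sign I * (1ℚ * F)
    -- `adjacentSymmetric-front` yields `sign p * F`, not `F`; the missing sign comes from writing 1
    -- as a square.
    ≡⟨ cong (λ z → sign I * (z * F)) (sign-square p) ⟨
  sign I * (sign p * sign p * F)
    ≡⟨ solve 3 (λ i p f → i :* (p :* p :* f) := (p :* i) :* (p :* f)) refl (sign I) (sign p) F ⟩
  (sign p * sign I) * (sign p * F)
    ≡⟨ cong₂ _*_ (sign-+ p I) (adjacentSymmetric-front {f = f} h k g) ⟨
  sign (p ℕ.+ I) * f (tabulate g)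
    ≡⟨ cong (λ z → sign z * f (tabulate g)) (inversionNumber-remove σ (proj₂ ∘ g)) ⟨
  sign (inversionNumber σ (proj₂ ∘ g)) * f (tabulate g) ∎
  where
  open +-*-Solver
  k = σ ⟨$⟩ˡ zero
  σ′ = remove k σ
  I = inversionNumber σ′ (proj₂ ∘ g ∘ punchIn k)
  p = passed k (proj₂ ∘ g)
  F = f (g k ∷ tabulate (g ∘ punchIn k))
  preimage : ∀ j → σ ⟨$⟩ˡ suc j ≡ punchIn k (σ′ ⟨$⟩ˡ j)
  preimage j = begin
    σ ⟨$⟩ˡ suc j                                ≡⟨ cong (λ z → σ ⟨$⟩ˡ suc z) (Permutation.inverseʳ σ′) ⟨
    σ ⟨$⟩ˡ suc (σ′ ⟨$⟩ʳ (σ′ ⟨$⟩ˡ j))            ≡⟨ cong (σ ⟨$⟩ˡ_) (Permutation.punchIn-permute′ σ zero (σ′ ⟨$⟩ˡ j)) ⟨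
    σ ⟨$⟩ˡ (σ ⟨$⟩ʳ punchIn k (σ′ ⟨$⟩ˡ j))       ≡⟨ Permutation.inverseˡ σ ⟩
    punchIn k (σ′ ⟨$⟩ˡ j)                       ∎

toList-tabulate : ∀ {A : Set} {n} (g : Fin n → A) → toList (Vec.tabulate g) ≡ tabulate g
toList-tabulate {n = zero}  g = refl
toList-tabulate {n = suc n} g = cong (g zero ∷_) (toList-tabulate (g ∘ suc))

adjacentSymmetric⇒symmetric : ∀ {f} → AdjacentSymmetric f → Symmetric f
adjacentSymmetric⇒symmetric {f} h n σ v = begin
  f (toList (permute σ v))
    ≡⟨ cong f (toList-tabulate (λ j → Vec.lookup v (σ ⟨$⟩ˡ j))) ⟩
  f (tabulate (λ j → Vec.lookup v (σ ⟨$⟩ˡ j)))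
    ≡⟨ adjacentSymmetric-permute {f = f} h σ (Vec.lookup v) ⟩
  sign (inversionNumber σ (proj₂ ∘ Vec.lookup v)) * f (tabulate (Vec.lookup v))
    ≡⟨ cong₂ (λ i l → sign i * f l) (inversions-inversionNumber σ v)
         (trans (cong toList (sym (tabulate∘lookup v))) (toList-tabulate (Vec.lookup v))) ⟨
  sign (inversions σ v) * f (toList v) ∎

swapFirst : ∀ n → Permutation′ (suc (suc n))
swapFirst n = permutation to to involutive involutive
  where
  to : Fin (suc (suc n)) → Fin (suc (suc n))
  to zero          = suc zero
  to (suc zero)    = zero
  to (suc (suc i)) = suc (suc i)
  involutive : ∀ i → to (to i) ≡ i
  involutive zero          = refl
  involutive (suc zero)    = refl
  involutive (suc (suc i)) = refl

<ᵇ-asym : ∀ m n b → (m ℕ.<ᵇ n) ∧ (n ℕ.<ᵇ m) ∧ b ≡ false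
<ᵇ-asym zero    zero    b = refl
<ᵇ-asym zero    (suc n) b = refl
<ᵇ-asym (suc m) zero    b = refl
<ᵇ-asym (suc m) (suc n) b = <ᵇ-asym m n b

-- Only the first two indices are put out of order, and the pair counts when both carry a θ. For the
-- later indices the two inequalities of an inversion contradict each other.
inversionNumber-swapFirst : ∀ n η →
  inversionNumber (swapFirst n) η ≡ fermionic (η zero) ℕ.* fermionic (η (suc zero))
inversionNumber-swapFirst n η = begin
  q ℕ.+ sum {n} (λ _ → 0) ℕ.+ (sum {n} (λ _ → 0) ℕ.+ sum (λ i → sum (λ j → F i j)))
    ≡⟨ cong₂ (λ x y → q ℕ.+ x ℕ.+ y) zeros (cong₂ ℕ._+_ zeros (sum-zero {n} (λ i → sum-zero {n} (λ j →
         cong fermionic (<ᵇ-asym (toℕ i) (toℕ j) _))))) ⟩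
  q ℕ.+ 0 ℕ.+ 0
    ≡⟨ trans (ℕₚ.+-identityʳ (q ℕ.+ 0)) (ℕₚ.+-identityʳ q) ⟩
  q
    ≡⟨ fermionic-∧ (η zero) (η (suc zero)) ⟩
  fermionic (η zero) ℕ.* fermionic (η (suc zero)) ∎
  where
  q = fermionic (η zero ∧ η (suc zero))
  F : Fin n → Fin n → ℕ
  F i j = fermionic (isInversion (swapFirst n) η (suc (suc i)) (suc (suc j)))
  zeros : sum {n} (λ j → 0) ≡ 0
  zeros = sum-zero {n} (λ _ → refl)

inversionNumber-lift₀ : ∀ {n} (σ : Permutation′ n) η →
  inversionNumber (lift₀ σ) η ≡ inversionNumber σ (η ∘ suc)
inversionNumber-lift₀ {n} σ η =
  cong (ℕ._+ inversionNumber σ (η ∘ suc)) (sum-zero {n} (λ _ → refl))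

symmetric-tabulate : ∀ {f} → Symmetric f → ∀ {n} (σ : Permutation′ n) g →
  f (tabulate (λ j → g (σ ⟨$⟩ˡ j))) ≡ sign (inversionNumber σ (proj₂ ∘ g)) * f (tabulate g)
symmetric-tabulate {f} h {n} σ g = begin
  f (tabulate (λ j → g (σ ⟨$⟩ˡ j)))
    ≡⟨ cong f (tabulate-cong (λ j → lookup∘tabulate g (σ ⟨$⟩ˡ j))) ⟨
  f (tabulate (λ j → Vec.lookup v (σ ⟨$⟩ˡ j)))
    ≡⟨ cong f (toList-tabulate (λ j → Vec.lookup v (σ ⟨$⟩ˡ j))) ⟨
  f (toList (permute σ v))
    ≡⟨ h n σ v ⟩
  sign (inversions σ v) * f (toList v)
    ≡⟨ cong₂ (λ i l → sign i * f l)
         (trans (inversions-inversionNumber σ v) (sum-cong-≗ {n} λ i → sum-cong-≗ {n} λ j →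
           cong₂ (λ a b → fermionic ((toℕ i ℕ.<ᵇ toℕ j) ∧ (toℕ (σ ⟨$⟩ʳ j) ℕ.<ᵇ toℕ (σ ⟨$⟩ʳ i)) ∧ proj₂ a ∧ proj₂ b))
             (lookup∘tabulate g i) (lookup∘tabulate g j)))
         (toList-tabulate g) ⟩
  sign (inversionNumber σ (proj₂ ∘ g)) * f (tabulate g) ∎
  where v = Vec.tabulate g

-- A permutation realizing the exchange behind the prefix `m`: the exchange of the first two
-- indices, lifted once for each entry of `m`. The size is a field and words are given by
-- `tabulate`, so that no equation between lengths has to be transported.
record AdjacentTransposition (m : Monomial) (x y : Exponent) (n : Monomial) : Set where
  field
    {size}      : ℕ
    σ           : Permutation′ size
    g           : Fin size → Exponent
    original    : tabulate g ≡ m ++ y ∷ x ∷ n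
    permuted    : tabulate (λ j → g (σ ⟨$⟩ˡ j)) ≡ m ++ x ∷ y ∷ n
    inversion-swapSign : sign (inversionNumber σ (proj₂ ∘ g)) ≡ swapSign x y

adjacentTransposition : ∀ m x y n → AdjacentTransposition m x y n
adjacentTransposition [] x y n = record
  { σ = swapFirst (length n)
  ; g = lookup (y ∷ x ∷ n)
  ; original = tabulate-lookup (y ∷ x ∷ n)
  ; permuted = cong (λ l → x ∷ y ∷ l) (tabulate-lookup n)
  ; inversion-swapSign = trans
      (cong sign (inversionNumber-swapFirst (length n) (proj₂ ∘ lookup (y ∷ x ∷ n)))) (swapSign-sym y x)
  }
adjacentTransposition (z ∷ m) x y n = record
  { σ = lift₀ σ
  ; g = z∷g
  ; original = cong (z ∷_) original
  ; permuted = cong (z ∷_) permuted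
  ; inversion-swapSign = trans (cong sign (inversionNumber-lift₀ σ (proj₂ ∘ z∷g))) inversion-swapSign
  }
  where
  open AdjacentTransposition (adjacentTransposition m x y n)
  z∷g : Fin (suc size) → Exponent
  z∷g zero    = z
  z∷g (suc i) = g i

symmetric⇒adjacentSymmetric : ∀ {f} → Symmetric f → AdjacentSymmetric f
symmetric⇒adjacentSymmetric {f} h m x y n = begin
  f (m ++ x ∷ y ∷ n)
    ≡⟨ cong f permuted ⟨
  f (tabulate (λ j → g (σ ⟨$⟩ˡ j)))
    ≡⟨ symmetric-tabulate {f} h σ g ⟩
  sign (inversionNumber σ (proj₂ ∘ g)) * f (tabulate g)
    ≡⟨ cong₂ (λ s l → s * f l) inversion-swapSign original ⟩
  swapSign x y * f (m ++ y ∷ x ∷ n) ∎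
  where open AdjacentTransposition (adjacentTransposition m x y n)

-- A trivial entry carries no θ and passes every other entry without sign. It can be moved to the
-- end, where `WellDefined` deletes it. This is why symmetric series are quasisymmetric.
adjacentSymmetric⇒trivialInvariant : ∀ {f} → WellDefined f → AdjacentSymmetric f → TrivialInvariant f
adjacentSymmetric⇒trivialInvariant w h (z ∷ m) n =
  adjacentSymmetric⇒trivialInvariant (λ k → w (z ∷ k)) (λ k → h (z ∷ k)) m n
adjacentSymmetric⇒trivialInvariant w h [] []      = w []
adjacentSymmetric⇒trivialInvariant {f} w h [] (e ∷ n) = begin
  f (trivial ∷ e ∷ n)        ≡⟨ h [] trivial e n ⟩
  1ℚ * f (e ∷ trivial ∷ n)   ≡⟨ ℚₚ.*-identityˡ _ ⟩
  f (e ∷ trivial ∷ n)        ≡⟨ adjacentSymmetric⇒trivialInvariant (λ k → w (e ∷ k)) (λ k → h (e ∷ k)) [] n ⟩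
  f (e ∷ n)                  ∎

-- Symmetric functions in superspace as an admissible subspace

Λ-member : ∀ {f} → Bounded f → TrivialInvariant f → AdjacentSymmetric f → Subspace.Member ΛSubspace f
Λ-member {f} b t h = trivialInvariant⇒wellDefined t , b , adjacentSymmetric⇒symmetric {f} h

Λ-adjacentSymmetric : ∀ {f} → Subspace.Member ΛSubspace f → AdjacentSymmetric f
Λ-adjacentSymmetric {f} (_ , _ , h) = symmetric⇒adjacentSymmetric {f} h

Λ-trivialInvariant : ∀ {f} → Subspace.Member ΛSubspace f → TrivialInvariant f
Λ-trivialInvariant {f} p@(w , _) = adjacentSymmetric⇒trivialInvariant {f} w (Λ-adjacentSymmetric p)

Λ-admissible : Admissible ΛSubspace
Λ-admissible = record
  { bounded-member          = λ (_ , b , _) → b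
  ; trivialInvariant-member = Λ-trivialInvariant
  ; one-member     = Λ-member bounded-one one-trivialInvariant one-adjacentSymmetric
  ; product-member = λ {f} {g} p@(_ , b , _) q@(_ , c , _) → Λ-member (bounded-product {f} {g} b c)
      (product-trivialInvariant {f} {g} (Λ-trivialInvariant p) (Λ-trivialInvariant q))
      (product-adjacentSymmetric {f} {g} (Λ-adjacentSymmetric p) (Λ-adjacentSymmetric q))
  ; weight-member  = λ {f} w p@(_ , b , _) → Λ-member (bounded-weight (λ m → w (xDegree m) (θDegree m)) b)
      (weight-trivialInvariant {f} w (Λ-trivialInvariant p))
      (weight-adjacentSymmetric {f} w (Λ-adjacentSymmetric p))
  ; prefix-member  = λ {f} n p@(_ , b , _) → Λ-member (bounded-prefix {f} n b)
      (prefix-trivialInvariant {f} n (Λ-trivialInvariant p))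
      (prefix-adjacentSymmetric {f} n (Λ-adjacentSymmetric p))
  ; suffix-member  = λ {f} m p@(_ , b , _) → Λ-member (bounded-suffix {f} m b)
      (suffix-trivialInvariant {f} m (Λ-trivialInvariant p))
      (suffix-adjacentSymmetric {f} m (Λ-adjacentSymmetric p))
  ; words = λ N → wordsUpTo N N
  ; basis = λ p → symmetrized (monomialQuasisymmetric p) ,
      Λ-member (bounded-degree (degree p) (symmetrized-degree (monomialQuasisymmetric-degree p)))
        (symmetrized-trivialInvariant (monomialQuasisymmetric p))
        (symmetrized-adjacentSymmetric (monomialQuasisymmetric p))
  ; basis-degree = λ p → symmetrized-degree (monomialQuasisymmetric-degree p)
  ; expansion = λ p N vanish → symmetrized-expansion (Λ-trivialInvariant p) (Λ-adjacentSymmetric p) N vanish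
  }

Λ⊆sQSym : ∀ {f} → Subspace.Member ΛSubspace f → Subspace.Member sQSymSubspace f
Λ⊆sQSym p@(_ , b , _) = sQSym-member b (Λ-trivialInvariant p)

proposition5p9 : Σ[ H ∈ HopfAlgebra sQSym FermionicDegree ]
    IsSuperspaceHopf H
    × SignedCommutative H
    × IsGradedBy H Degree
    × Connected sQSym Degree
    × Σ[ K ∈ HopfAlgebra Λ FermionicDegree ]
    IsSuperspaceHopf K
    × Σ[ ι ∈ (∣ Λ ∣ → ∣ sQSym ∣) ]
    (∀ f m → coeff (ι f) m ≡ coeff f m) × IsHopfSubalgebra K H ι
proposition5p9 =
  Q.hopf , Q.isSuperspaceHopf , (λ {j} {k} {f} {g} → Q.signedCommutative {j} {k} {f} {g}) , Q.gradedByDegree , Q.connected ,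
  L.hopf , L.isSuperspaceHopf , I.ι , (λ _ _ → refl) , I.isHopfSubalgebra
  where
  module Q where
    open Coalgebra sQSym-admissible public
    open Antipode sQSym-admissible public
  module L = Antipode Λ-admissible
  module I = Inclusion Λ-admissible sQSym-admissible Λ⊆sQSym
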